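{- For every integer $n\geq 3$, the triangular tower graph ${TT}_{n,n,n}$ is claw-contractible-free and claw-free, and its chromatic symmetric function is not $e$-positive.
   Context: All graphs are finite and simple. For a graph $G$ with vertex set $V=\{v_1,\dots,v_N\}$, the chromatic symmetric function is $X_G=\sum_\kappa x_{\kappa(v_1)}\cdots x_{\kappa(v_N)}$, summed over all proper colourings $\kappa:V\to\{1,2,\dots\}$. The elementary symmetric functions are $e_i=\sum_{j_1<\cdots<j_i}x_{j_1}\cdots x_{j_i}$ and $e_\lambda=e_{\lambda_1}\cdots e_{\lambda_\ell}$; they form a basis of the symmetric functions. A symmetric function is $e$-positive if it is a non-negative linear combination of the $e_\lambda$. The claw is $K_{1,3}$. A graph is claw-free if it has no induced subgraph isomorphic to the claw. A graph $G$ contracts to the claw if there is a subset $S$ of its edges such that contracting the edges of $S$ and replacing multiple edges by single edges yields the claw; $G$ is claw-contractible-free if it does not contract to the claw. For $a,b,c\geq 2$, the triangular tower graph ${TT}_{a,b,c}$ is the graph on vertices $v_1,\dots,v_{a+b+c}$ with edges $v_iv_{i+1}$ for $i\in\{1,\dots,a-1\}\cup\{a+1,\dots,a+b-1\}\cup\{a+b+1,\dots,a+b+c-1\}$, together with $v_1v_{a+1}$, $v_{a+1}v_{a+b+1}$, $v_{a+b+1}v_1$ and $v_av_{a+b}$, $v_{a+b}v_{a+b+c}$, $v_{a+b+c}v_a$. -}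

module Defs where

open import Data.Nat as ℕ using (ℕ; zero; suc; _+_; _∸_; _≤ᵇ_; _≡ᵇ_)
open import Data.Fin using (Fin; zero; suc; toℕ)
open import Data.Fin.Properties using (_≟_)
open import Data.Bool using (Bool; true; false; _∧_; _∨_; not; if_then_else_)
open import Data.List using (List; []; _∷_; [_]; map; concatMap; allFin; foldr; length; lookup)
open import Data.List.Relation.Unary.All using (All)
open import Data.Vec.Functional using () renaming (_∷_ to _∷ᶠ_)
open import Data.Product using (Σ; ∃; ∃-syntax; _×_; _,_)
open import Data.Integer using (+_)
open import Data.Rational using (ℚ; 0ℚ; _/_; _≤_) renaming (_+_ to _+ℚ_; _*_ to _*ℚ_)
open import Relation.Nullary using (¬_; does)
open import Relation.Binary.PropositionalEquality using (_≡_; _≢_)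
open import Relation.Binary.Construct.Closure.ReflexiveTransitive using (Star)
open import Function.Bundles using (_⇔_)

-- Finite simple graphs on vertex set Fin N, given by a Boolean
-- adjacency function (the graphs constructed below are symmetric and
-- irreflexive by construction).

Graph : ℕ → Set
Graph N = Fin N → Fin N → Bool

Adj : ∀ {N} → Graph N → Fin N → Fin N → Set
Adj G u v = G u v ≡ true

-- The triangular tower graph TT_{a,b,c} on v_1, …, v_{a+b+c}.
-- Vertex v_i (1-indexed, as in the paper) is the element i-1 of Fin (a+b+c).

inRange : ℕ → ℕ → ℕ → Bool
inRange lo hi i = (lo ≤ᵇ i) ∧ (i ≤ᵇ hi)

isPair : ℕ → ℕ → ℕ → ℕ → Bool
isPair x y i j = (i ≡ᵇ x) ∧ (j ≡ᵇ y)

-- directed list of generating edges (i , j) of TT_{a,b,c}, 1-indexed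
ttEdge : ℕ → ℕ → ℕ → ℕ → ℕ → Bool
ttEdge a b c i j =
     ((j ≡ᵇ suc i) ∧ (inRange 1 (a ∸ 1) i
                       ∨ inRange (a + 1) (a + b ∸ 1) i
                       ∨ inRange (a + b + 1) (a + b + c ∸ 1) i))
  ∨ isPair 1 (a + 1) i j
  ∨ isPair (a + 1) (a + b + 1) i j
  ∨ isPair (a + b + 1) 1 i j
  ∨ isPair a (a + b) i j
  ∨ isPair (a + b) (a + b + c) i j
  ∨ isPair (a + b + c) a i j

TT : (a b c : ℕ) → Graph (a + b + c)
TT a b c u v =
  (ttEdge a b c (suc (toℕ u)) (suc (toℕ v)) ∨ ttEdge a b c (suc (toℕ v)) (suc (toℕ u)))
  ∧ not (toℕ u ≡ᵇ toℕ v)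

InducedClaw : ∀ {N} → Graph N → Fin N → Fin N → Fin N → Fin N → Set
InducedClaw G v x y z =
  (v ≢ x) × (v ≢ y) × (v ≢ z) × (x ≢ y) × (x ≢ z) × (y ≢ z) ×
  Adj G v x × Adj G v y × Adj G v z ×
  ¬ Adj G x y × ¬ Adj G x z × ¬ Adj G y z

ClawFree : ∀ {N} → Graph N → Set
ClawFree {N} G = ∀ v x y z → ¬ InducedClaw G v x y z

clawAdj : Fin 4 → Fin 4 → Bool
clawAdj zero zero = false
clawAdj zero (suc _) = true
clawAdj (suc _) zero = true
clawAdj (suc _) (suc _) = false

-- G contracts to the claw: there is a set S of edges of G (given as a
-- Boolean predicate contained in the adjacency) such that the graph
-- obtained by contracting S (vertices = connected components of (V,S),
-- two distinct components adjacent iff some edge of G joins them) is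
-- isomorphic to the claw.  The isomorphism is given by φ : V → Fin 4
-- whose fibres are exactly the connected components of (V,S).

SEdge : ∀ {N} → (Fin N → Fin N → Bool) → Fin N → Fin N → Set
SEdge S u v = (S u v ≡ true) Data.Sum.⊎ (S v u ≡ true)
  where import Data.Sum

ContractsToClaw : ∀ {N} → Graph N → Set
ContractsToClaw {N} G =
  Σ (Fin N → Fin N → Bool) λ S →
    (∀ u v → S u v ≡ true → Adj G u v) ×
    Σ (Fin N → Fin 4) λ φ →
      (∀ p → ∃[ u ] φ u ≡ p) ×
      (∀ u v → φ u ≡ φ v → Star (SEdge S) u v) ×
      (∀ u v → SEdge S u v → φ u ≡ φ v) ×
      (∀ p q → p ≢ q →
         (clawAdj p q ≡ true) ⇔ (∃[ u ] ∃[ v ] (φ u ≡ p × φ v ≡ q × Adj G u v)))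

ClawContractibleFree : ∀ {N} → Graph N → Set
ClawContractibleFree G = ¬ ContractsToClaw G

-- Symmetric functions, represented by their monomial coefficients:
-- f k α is the coefficient of x_1^{α 1} ⋯ x_k^{α k}.  Every monomial
-- has this form for some k, so two symmetric functions are equal iff
-- these coefficients agree for all k and α.

SymFun : Set
SymFun = (k : ℕ) → (Fin k → ℕ) → ℚ

fromℕℚ : ℕ → ℚ
fromℕℚ n = + n / 1

allFunsOver : ∀ {A : Set} → List A → (n : ℕ) → List (Fin n → A)
allFunsOver xs zero = [ (λ ()) ]
allFunsOver xs (suc n) = concatMap (λ f → map (λ c → c ∷ᶠ f) xs) (allFunsOver xs n)

countᵇ : ∀ {A : Set} → (A → Bool) → List A → ℕ
countᵇ p = foldr (λ x acc → if p x then suc acc else acc) 0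

finEqᵇ : ∀ {n} → Fin n → Fin n → Bool
finEqᵇ i j = does (i ≟ j)

allᵇ : ∀ {A : Set} → (A → Bool) → List A → Bool
allᵇ p = foldr (λ x acc → p x ∧ acc) true

Properᵇ : ∀ {N k} → Graph N → (Fin N → Fin k) → Bool
Properᵇ {N} G κ =
  allᵇ (λ u → allᵇ (λ v → not (G u v) ∨ not (finEqᵇ (κ u) (κ v))) (allFin N)) (allFin N)

hasFibresᵇ : ∀ {N k} → (Fin N → Fin k) → (Fin k → ℕ) → Bool
hasFibresᵇ {N} {k} κ α =
  allᵇ (λ i → countᵇ (λ v → finEqᵇ (κ v) i) (allFin N) ≡ᵇ α i) (allFin k)

chromatic : ∀ {N} → Graph N → SymFun
chromatic {N} G k α =
  fromℕℚ (countᵇ (λ κ → Properᵇ G κ ∧ hasFibresᵇ κ α) (allFunsOver (allFin k) N))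

-- e_λ = e_{λ_1} ⋯ e_{λ_ℓ}: the coefficient of x_1^{α 1} ⋯ x_k^{α k} is the
-- number of ways of choosing, for each factor r, a set of λ_r distinct
-- variables (a 0-1 row M r), such that variable i is chosen α i times in
-- total (i.e. 0-1 matrices with row sums λ and column sums α).
eBasis : List ℕ → SymFun
eBasis λs k α =
  fromℕℚ (countᵇ ok (allFunsOver (allFunsOver (false ∷ true ∷ []) k) (length λs)))
  where
  ok : (Fin (length λs) → Fin k → Bool) → Bool
  ok M = allᵇ (λ r → countᵇ (M r) (allFin k) ≡ᵇ lookup λs r) (allFin (length λs))
       ∧ allᵇ (λ i → countᵇ (λ r → M r i) (allFin (length λs)) ≡ᵇ α i) (allFin k)

data IsPartition : List ℕ → Set where
  []ᵖ  : IsPartition []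
  [_]ᵖ : ∀ {p} → 1 ℕ.≤ p → IsPartition (p ∷ [])
  consᵖ : ∀ {p q λs} → q ℕ.≤ p → IsPartition (q ∷ λs) → IsPartition (p ∷ q ∷ λs)

linComb : List (ℚ × List ℕ) → SymFun
linComb [] k α = 0ℚ
linComb ((c , λs) ∷ ts) k α = (c *ℚ eBasis λs k α) +ℚ linComb ts k α

EPositive : SymFun → Set
EPositive f =
  Σ (List (ℚ × List ℕ)) λ ts →
    All (λ t → (0ℚ ≤ Data.Product.proj₁ t) × IsPartition (Data.Product.proj₂ t)) ts ×
    (∀ k α → f k α ≡ linComb ts k α)

{-# OPTIONS --safe #-}
module Submission where

-- The tower is claw-free because the neighbours of a vertex are covered by two cliques.  It does not
-- contract to the claw: at most one leaf class meets each of the two triangles, so a third one lies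
-- inside a path, and a connected centre going around it leaves room for only one further class.
--
-- For the chromatic symmetric function, evaluate in n variables at the powers of a primitive n-th root
-- of unity ζ, where e_1, …, e_{n-1} vanish and e_n = (-1)^{n-1} =: s.  In degree 3n only e_{(n,n,n)}
-- survives, so an e-positive function takes a value of the same sign as s³.  There the power sums
-- p_1, …, p_{n-1} vanish too, whence the proper colourings of a path on n vertices with end colours i, j
-- contribute s (1 - (n-1) δ_{ij}); gluing three such paths along two triangles gives the value
-- -n (n-1)² (n-2) s³.
--
-- Instead of constructing ζ, we replace its powers t ↦ ζ^t by a function f : ℕ → ℚ of period n which sums
-- to zero along every progression t, t + b, …, t + (n-1) b with n ∤ b, and has f 0 = 1.

-- A rational `f` can replace the powers of ζ because every identity used is linear in a single
-- power ζ^t: multiplication by ζ^d becomes the shift of `t` by d, and the scalars that appear are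
-- rational anyway. Hence the statements below carry a free exponent `t`, and all values stay in the
-- ordered field ℚ, where signs can be compared. The price is that nothing corresponds to ζ^a ζ^b as
-- a product of values of `f`. Products, of the factors of e_λ or of the colourings of the three
-- paths, are therefore evaluated one factor at a time, each leaving a scalar in front of an `f`
-- that the next factor can use again.
--
-- The value -n (n-1)² (n-2) s³ arises as follows. There are n (n-1) (n-2) ways to colour one
-- triangle, and for each of them the weighted sum over the colours of the other triangle is 1 - 3
-- (2-n) + 2 (3-2n) = -(n-1). The factor n-2 is the reason for n ≥ 3: the value vanishes for n = 2.

open import Defs
open import Data.Bool using (Bool; true; false; _∧_; _∨_; not; if_then_else_; T)
import Data.Bool.Properties as Bool
open import Data.Empty using (⊥; ⊥-elim)
open import Data.Fin using (Fin; zero; suc; toℕ; fromℕ; fromℕ<; splitAt; _↑ˡ_; _↑ʳ_)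
import Data.Fin.Properties as Fin
import Data.Integer as ℤ
import Data.Integer.Properties as ℤ
open import Data.List using (List; []; _∷_; _++_; map; concatMap; allFin; tabulate; upTo; applyUpTo; foldr; length; lookup)
open import Data.List.Relation.Unary.All using (All; []; _∷_)
open import Data.Nat using (ℕ; zero; suc; _+_; _*_; _∸_; _≤_; _<_; _≤?_; _≡ᵇ_; _≤ᵇ_; s≤s; z≤n; s≤s⁻¹; NonZero; >-nonZero; >-nonZero⁻¹)
open import Data.Nat.Divisibility using (_∣_; _∤_; _∣?_; divides; _∣0; ∣-refl; ∣⇒≤; ∣1⇒≡1; m∣m*n; n∣m*n; ∣n⇒∣m*n; ∣m∣n⇒∣m+n; ∣m+n∣m⇒∣n; *-cancelʳ-∣)
open import Data.Nat.GCD using (gcd; gcd[m,n]∣m; gcd[m,n]∣n; gcd-GCD; module Bézout)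
open import Data.Nat.ListAction using (sum; product)
open import Data.Nat.Primality using (Prime; prime?; euclidsLemma; prime⇒irreducible; prime⇒nonZero; ¬prime[1])
open import Data.Nat.Primality.Factorisation using (PrimeFactorisation; factorise)
import Data.Nat.Properties as ℕ
open import Data.Nat.Tactic.RingSolver using () renaming (solve-∀ to ℕ-solve-∀)
open import Data.Product using (_×_; _,_; proj₁; proj₂; ∃-syntax; uncurry)
open import Data.Rational using (ℚ; 0ℚ; 1ℚ; 1/_; toℚᵘ; ≢-nonZero; positive; nonNegative) renaming (_+_ to _+ℚ_; _*_ to _*ℚ_; _-_ to _-ℚ_; -_ to -ℚ_; _≤_ to _≤ℚ_; _<_ to _<ℚ_)
import Data.Rational.Properties as ℚ
open import Data.Rational.Unnormalised using (mkℚᵘ; *≡*)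
import Data.Rational.Unnormalised.Properties as ℚᵘ
open import Data.Sum using (_⊎_; inj₁; inj₂; [_,_]′)
open import Data.Vec.Functional using () renaming (_∷_ to _∷ᶠ_; _++_ to _++ᶠ_)
open import Data.Vec.Functional.Properties using (lookup-++ˡ; lookup-++ʳ)
open import Function using (_∘_; Equivalence)
open import Relation.Binary using (tri<; tri≈; tri>)
open import Relation.Binary.Construct.Closure.ReflexiveTransitive using (Star; ε; _◅_)
open import Relation.Binary.PropositionalEquality
open import Relation.Nullary using (¬_; yes; no; contradiction; does)
open import Relation.Nullary.Decidable using (dec⇒maybe; dec-true; dec-false; toWitness; ¬?; _→-dec_; _⊎-dec_)
open import Tactic.RingSolver using (solve-∀)
open import Tactic.RingSolver.Core.AlmostCommutativeRing using (AlmostCommutativeRing; fromCommutativeRing)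
open ≡-Reasoning

-- Finite sums

ℚ-ring : AlmostCommutativeRing _ _
ℚ-ring = fromCommutativeRing ℚ.+-*-commutativeRing (λ x → dec⇒maybe (0ℚ ℚ.≟ x))

private variable
  A B : Set

∑ : List A → (A → ℚ) → ℚ
∑ xs g = foldr (λ x acc → g x +ℚ acc) 0ℚ xs

∑-cong : ∀ (xs : List A) {g h : A → ℚ} → (∀ x → g x ≡ h x) → ∑ xs g ≡ ∑ xs h
∑-cong []       eq = refl
∑-cong (x ∷ xs) eq = cong₂ _+ℚ_ (eq x) (∑-cong xs eq)

∑-zero : ∀ (xs : List A) {g : A → ℚ} → (∀ x → g x ≡ 0ℚ) → ∑ xs g ≡ 0ℚ
∑-zero []       eq = refl
∑-zero (x ∷ xs) eq = trans (cong₂ _+ℚ_ (eq x) (∑-zero xs eq)) (ℚ.+-identityˡ 0ℚ)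

∑-+ : ∀ (xs : List A) (g h : A → ℚ) → ∑ xs (λ x → g x +ℚ h x) ≡ ∑ xs g +ℚ ∑ xs h
∑-+ []       g h = refl
∑-+ (x ∷ xs) g h = trans (cong (g x +ℚ h x +ℚ_) (∑-+ xs g h)) (middle (g x) (h x) _ _)
  where
  middle : ∀ a b c d → a +ℚ b +ℚ (c +ℚ d) ≡ a +ℚ c +ℚ (b +ℚ d)
  middle = solve-∀ ℚ-ring

∑-* : ∀ (xs : List A) (c : ℚ) (g : A → ℚ) → ∑ xs (λ x → c *ℚ g x) ≡ c *ℚ ∑ xs g
∑-* []       c g = sym (ℚ.*-zeroʳ c)
∑-* (x ∷ xs) c g = trans (cong (c *ℚ g x +ℚ_) (∑-* xs c g)) (sym (ℚ.*-distribˡ-+ c (g x) (∑ xs g)))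

∑-*ʳ : ∀ (xs : List A) (g : A → ℚ) (c : ℚ) → ∑ xs (λ x → g x *ℚ c) ≡ ∑ xs g *ℚ c
∑-*ʳ xs g c = trans (∑-cong xs (λ x → ℚ.*-comm (g x) c)) (trans (∑-* xs c g) (ℚ.*-comm c _))

∑-neg : ∀ (xs : List A) (g : A → ℚ) → ∑ xs (λ x → -ℚ g x) ≡ -ℚ ∑ xs g
∑-neg []       g = refl
∑-neg (x ∷ xs) g = trans (cong (-ℚ g x +ℚ_) (∑-neg xs g)) (sym (ℚ.neg-distrib-+ (g x) (∑ xs g)))

∑-- : ∀ (xs : List A) (g h : A → ℚ) → ∑ xs (λ x → g x -ℚ h x) ≡ ∑ xs g -ℚ ∑ xs h
∑-- xs g h = trans (∑-+ xs g _) (cong (∑ xs g +ℚ_) (∑-neg xs h))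

∑-swap : ∀ (xs : List A) (ys : List B) (g : A → B → ℚ) →
  ∑ xs (λ x → ∑ ys (g x)) ≡ ∑ ys (λ y → ∑ xs (λ x → g x y))
∑-swap []       ys g = sym (∑-zero ys (λ _ → refl))
∑-swap (x ∷ xs) ys g = trans (cong (∑ ys (g x) +ℚ_) (∑-swap xs ys g)) (sym (∑-+ ys (g x) _))

∑-++ : ∀ (xs ys : List A) (g : A → ℚ) → ∑ (xs ++ ys) g ≡ ∑ xs g +ℚ ∑ ys g
∑-++ []       ys g = sym (ℚ.+-identityˡ _)
∑-++ (x ∷ xs) ys g = trans (cong (g x +ℚ_) (∑-++ xs ys g)) (sym (ℚ.+-assoc (g x) _ _))

∑-map : ∀ (h : A → B) (xs : List A) (g : B → ℚ) → ∑ (map h xs) g ≡ ∑ xs (g ∘ h)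
∑-map h []       g = refl
∑-map h (x ∷ xs) g = cong (g (h x) +ℚ_) (∑-map h xs g)

∑-concatMap : ∀ (h : A → List B) (xs : List A) (g : B → ℚ) →
  ∑ (concatMap h xs) g ≡ ∑ xs (λ x → ∑ (h x) g)
∑-concatMap h []       g = refl
∑-concatMap h (x ∷ xs) g =
  trans (∑-++ (h x) (concatMap h xs) g) (cong (∑ (h x) g +ℚ_) (∑-concatMap h xs g))

∑-tabulate : ∀ {n} (h : Fin n → A) (g : A → ℚ) → ∑ (tabulate h) g ≡ ∑ (allFin n) (g ∘ h)
∑-tabulate {n = zero}  h g = refl
∑-tabulate {n = suc n} h g = cong (g (h zero) +ℚ_)
  (trans (∑-tabulate (h ∘ suc) g) (sym (∑-tabulate suc (g ∘ h))))

∑-allFin-suc : ∀ {n} (g : Fin (suc n) → ℚ) →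
  ∑ (allFin (suc n)) g ≡ g zero +ℚ ∑ (allFin n) (g ∘ suc)
∑-allFin-suc g = cong (g zero +ℚ_) (∑-tabulate suc g)

∑-applyUpTo : ∀ (h : ℕ → A) n (g : A → ℚ) → ∑ (applyUpTo h n) g ≡ ∑ (upTo n) (g ∘ h)
∑-applyUpTo h zero    g = refl
∑-applyUpTo h (suc n) g = cong (g (h zero) +ℚ_)
  (trans (∑-applyUpTo (h ∘ suc) n g) (sym (∑-applyUpTo suc n (g ∘ h))))

∑-upTo-suc : ∀ n (g : ℕ → ℚ) → ∑ (upTo (suc n)) g ≡ g 0 +ℚ ∑ (upTo n) (g ∘ suc)
∑-upTo-suc n g = cong (g 0 +ℚ_) (∑-applyUpTo suc n g)

∑-upTo-last : ∀ n (g : ℕ → ℚ) → ∑ (upTo (suc n)) g ≡ ∑ (upTo n) g +ℚ g n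
∑-upTo-last zero    g = ℚ.+-comm (g 0) 0ℚ
∑-upTo-last (suc n) g = begin
  ∑ (upTo (suc (suc n))) g                     ≡⟨ ∑-upTo-suc (suc n) g ⟩
  g 0 +ℚ ∑ (upTo (suc n)) (g ∘ suc)            ≡⟨ cong (g 0 +ℚ_) (∑-upTo-last n (g ∘ suc)) ⟩
  g 0 +ℚ (∑ (upTo n) (g ∘ suc) +ℚ g (suc n))   ≡⟨ ℚ.+-assoc (g 0) _ _ ⟨
  g 0 +ℚ ∑ (upTo n) (g ∘ suc) +ℚ g (suc n)     ≡⟨ cong (_+ℚ g (suc n)) (∑-upTo-suc n g) ⟨
  ∑ (upTo (suc n)) g +ℚ g (suc n)              ∎

∑-toℕ : ∀ n (g : ℕ → ℚ) → ∑ (allFin n) (g ∘ toℕ) ≡ ∑ (upTo n) g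
∑-toℕ zero    g = refl
∑-toℕ (suc n) g = trans (∑-allFin-suc {n} (g ∘ toℕ))
  (trans (cong (g 0 +ℚ_) (∑-toℕ n (g ∘ suc))) (sym (∑-upTo-suc n g)))

∑-allFunsOver-suc : ∀ (xs : List A) n (g : (Fin (suc n) → A) → ℚ) →
  ∑ (allFunsOver xs (suc n)) g ≡ ∑ (allFunsOver xs n) (λ f → ∑ xs (λ c → g (c ∷ᶠ f)))
∑-allFunsOver-suc xs n g =
  trans (∑-concatMap (λ f → map (_∷ᶠ f) xs) (allFunsOver xs n) g)
        (∑-cong (allFunsOver xs n) (λ f → ∑-map (_∷ᶠ f) xs g))

-- `_/_` reduces by a gcd that does not compute for a variable numerator, so the identity is checked
-- on unnormalised fractions.
fromℕℚ-suc : ∀ n → fromℕℚ (suc n) ≡ 1ℚ +ℚ fromℕℚ n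
fromℕℚ-suc n = ℚ.toℚᵘ-injective (ℚᵘ.≃-trans (ℚ.toℚᵘ-fromℚᵘ (mkℚᵘ (ℤ.+ suc n) 0))
  (ℚᵘ.≃-sym (ℚᵘ.≃-trans (ℚ.toℚᵘ-homo-+ 1ℚ (fromℕℚ n))
    (ℚᵘ.≃-trans (ℚᵘ.+-congʳ (toℚᵘ 1ℚ) (ℚ.toℚᵘ-fromℚᵘ (mkℚᵘ (ℤ.+ n) 0)))
      (*≡* (trans (ℤ.*-identityʳ _) (trans (cong (λ k → ℤ.+ 1 ℤ.+ k) (ℤ.*-identityʳ (ℤ.+ n))) (sym (ℤ.*-identityʳ _)))))))))

⟦_⟧ : Bool → ℚ
⟦ true ⟧  = 1ℚ
⟦ false ⟧ = 0ℚ

⟦⟧-∧ : ∀ a b → ⟦ a ∧ b ⟧ ≡ ⟦ a ⟧ *ℚ ⟦ b ⟧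
⟦⟧-∧ true  b = sym (ℚ.*-identityˡ ⟦ b ⟧)
⟦⟧-∧ false b = sym (ℚ.*-zeroˡ ⟦ b ⟧)

⟦⟧-not : ∀ a → ⟦ not a ⟧ ≡ 1ℚ -ℚ ⟦ a ⟧
⟦⟧-not true  = refl
⟦⟧-not false = refl

countᵇ-∑ : ∀ (p : A → Bool) (xs : List A) → fromℕℚ (countᵇ p xs) ≡ ∑ xs (λ x → ⟦ p x ⟧)
countᵇ-∑ p []       = refl
countᵇ-∑ p (x ∷ xs) with p x
... | true  = trans (fromℕℚ-suc (countᵇ p xs)) (cong (1ℚ +ℚ_) (countᵇ-∑ p xs))
... | false = trans (countᵇ-∑ p xs) (sym (ℚ.+-identityˡ _))

∑-1 : ∀ n → ∑ (allFin n) (λ _ → 1ℚ) ≡ fromℕℚ n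
∑-1 zero    = refl
∑-1 (suc n) = trans (∑-allFin-suc {n} (λ _ → 1ℚ)) (trans (cong (1ℚ +ℚ_) (∑-1 n)) (sym (fromℕℚ-suc n)))

finEqᵇ-suc : ∀ {n} (i j : Fin n) → finEqᵇ (suc i) (suc j) ≡ finEqᵇ i j
finEqᵇ-suc i j with i Fin.≟ j
... | yes _ = refl
... | no _  = refl

∑-δ : ∀ {n} (i : Fin n) (g : Fin n → ℚ) → ∑ (allFin n) (λ j → ⟦ finEqᵇ i j ⟧ *ℚ g j) ≡ g i
∑-δ {suc n} zero g = begin
  ∑ (allFin (suc n)) (λ j → ⟦ finEqᵇ zero j ⟧ *ℚ g j)  ≡⟨ ∑-allFin-suc (λ j → ⟦ finEqᵇ zero j ⟧ *ℚ g j) ⟩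
  1ℚ *ℚ g zero +ℚ ∑ (allFin n) (λ j → 0ℚ *ℚ g (suc j)) ≡⟨ cong₂ _+ℚ_ (ℚ.*-identityˡ (g zero)) (∑-zero (allFin n) (λ j → ℚ.*-zeroˡ (g (suc j)))) ⟩
  g zero +ℚ 0ℚ                                         ≡⟨ ℚ.+-identityʳ (g zero) ⟩
  g zero ∎
∑-δ {suc n} (suc i) g = begin
  ∑ (allFin (suc n)) (λ j → ⟦ finEqᵇ (suc i) j ⟧ *ℚ g j)  ≡⟨ ∑-allFin-suc (λ j → ⟦ finEqᵇ (suc i) j ⟧ *ℚ g j) ⟩
  0ℚ *ℚ g zero +ℚ ∑ (allFin n) (λ j → ⟦ finEqᵇ (suc i) (suc j) ⟧ *ℚ g (suc j))
    ≡⟨ cong₂ _+ℚ_ (ℚ.*-zeroˡ (g zero)) (∑-cong (allFin n) (λ j → cong (λ b → ⟦ b ⟧ *ℚ g (suc j)) (finEqᵇ-suc i j))) ⟩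
  0ℚ +ℚ ∑ (allFin n) (λ j → ⟦ finEqᵇ i j ⟧ *ℚ g (suc j))  ≡⟨ ℚ.+-identityˡ _ ⟩
  ∑ (allFin n) (λ j → ⟦ finEqᵇ i j ⟧ *ℚ g (suc j))        ≡⟨ ∑-δ i (g ∘ suc) ⟩
  g (suc i) ∎

-- Balanced functions and elementary symmetric functions at roots of unity

0≤fromℕℚ : ∀ n → 0ℚ ≤ℚ fromℕℚ n
0≤fromℕℚ zero    = ℚ.≤-refl
0≤fromℕℚ (suc n) = subst (0ℚ ≤ℚ_) (sym (fromℕℚ-suc n))
  (ℚ.+-mono-≤ {0ℚ} {1ℚ} {0ℚ} (ℚ.nonNegative⁻¹ 1ℚ) (0≤fromℕℚ n))

0<fromℕℚ-suc : ∀ n → 0ℚ <ℚ fromℕℚ (suc n)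
0<fromℕℚ-suc n = subst (0ℚ <ℚ_) (sym (fromℕℚ-suc n))
  (ℚ.+-mono-<-≤ {0ℚ} {1ℚ} {0ℚ} (ℚ.positive⁻¹ 1ℚ) (0≤fromℕℚ n))

*-cancel-0 : ∀ p q → p ≢ 0ℚ → p *ℚ q ≡ 0ℚ → q ≡ 0ℚ
*-cancel-0 p q p≢0 pq≡0 = begin
  q                    ≡⟨ ℚ.*-identityˡ q ⟨
  1ℚ *ℚ q              ≡⟨ cong (_*ℚ q) (ℚ.*-inverseˡ p) ⟨
  1/ p *ℚ p *ℚ q       ≡⟨ ℚ.*-assoc (1/ p) p q ⟩
  1/ p *ℚ (p *ℚ q)     ≡⟨ cong (1/ p *ℚ_) pq≡0 ⟩
  1/ p *ℚ 0ℚ           ≡⟨ ℚ.*-zeroʳ (1/ p) ⟩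
  0ℚ                   ∎
  where instance _ = ≢-nonZero p≢0

Periodic : ℕ → (ℕ → ℚ) → Set
Periodic n f = ∀ t → f (t + n) ≡ f t

periodic-* : ∀ {n f} → Periodic n f → ∀ k t → f (t + k * n) ≡ f t
periodic-* {n} {f} per zero    t = cong f (ℕ.+-identityʳ t)
periodic-* {n} {f} per (suc k) t =
  trans (cong f (sym (ℕ.+-assoc t n (k * n)))) (trans (periodic-* per k (t + n)) (per t))

-- f behaves like a linear functional on the powers t ↦ ζ^t of a primitive n-th root of unity ζ.
record Balanced (n : ℕ) (f : ℕ → ℚ) : Set where
  field
    periodic : Periodic n f
    balanced : ∀ b t → n ∤ b → ∑ (upTo n) (λ k → f (t + k * b)) ≡ 0ℚ

sgn : ℕ → ℚ
sgn zero    = 1ℚ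
sgn (suc k) = -ℚ sgn k

sgn² : ∀ k → sgn k *ℚ sgn k ≡ 1ℚ
sgn² zero    = refl
sgn² (suc k) = trans (neg*neg (sgn k)) (sgn² k)
  where
  neg*neg : ∀ a → (-ℚ a) *ℚ (-ℚ a) ≡ a *ℚ a
  neg*neg = solve-∀ ℚ-ring

-- e f k b t stands for e_b(1, ζ, …, ζ^{k-1}) ζ^t, where f replaces the powers of ζ.
e : (ℕ → ℚ) → ℕ → ℕ → ℕ → ℚ
e f zero    zero    t = f t
e f zero    (suc b) t = 0ℚ
e f (suc k) zero    t = e f k zero t
e f (suc k) (suc b) t = e f k (suc b) (t + suc b) +ℚ e f k b (t + b)

e-cong : ∀ {f g} → (∀ t → f t ≡ g t) → ∀ k b t → e f k b t ≡ e g k b t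
e-cong eq zero    zero    t = eq t
e-cong eq zero    (suc b) t = refl
e-cong eq (suc k) zero    t = e-cong eq k zero t
e-cong eq (suc k) (suc b) t = cong₂ _+ℚ_ (e-cong eq k (suc b) (t + suc b)) (e-cong eq k b (t + b))

module _ (f : ℕ → ℚ) where

  e-0 : ∀ k t → e f k 0 t ≡ f t
  e-0 zero    t = refl
  e-0 (suc k) t = e-0 k t

  e-overflow : ∀ k b t → k < b → e f k b t ≡ 0ℚ
  e-overflow zero    (suc b) t _         = refl
  e-overflow (suc k) (suc b) t (s≤s k<b) =
    trans (cong₂ _+ℚ_ (e-overflow k (suc b) (t + suc b) (ℕ.m<n⇒m<1+n k<b)) (e-overflow k b (t + b) k<b)) (ℚ.+-identityˡ 0ℚ)

  -- Turns multiplication by ζ^d into a translation of `f`, so that a sum over `d` can be pushed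
  -- inside by `e-∑`.
  e-shift : ∀ d k b t → e f k b (t + d) ≡ e (λ u → f (u + d)) k b t
  e-shift d zero    zero    t = refl
  e-shift d zero    (suc b) t = refl
  e-shift d (suc k) zero    t = e-shift d k zero t
  e-shift d (suc k) (suc b) t = cong₂ _+ℚ_
    (trans (cong (e f k (suc b)) (comm t d (suc b))) (e-shift d k (suc b) (t + suc b)))
    (trans (cong (e f k b) (comm t d b)) (e-shift d k b (t + b)))
    where
    comm : ∀ t d b → t + d + b ≡ t + b + d
    comm = ℕ-solve-∀

  -- The definition of `e` splits off the variable 1 and takes ζ out of the remaining ones, which
  -- costs ζ^b in degree b. Here the last variable ζ^k is split off instead; the interplay of the
  -- two recursions gives `e-rotate`.
  e-last : ∀ k b t → e f (suc k) (suc b) t ≡ e f k (suc b) t +ℚ e f k b (t + k)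
  e-last zero    zero    t = refl
  e-last zero    (suc b) t = refl
  e-last (suc k) zero    t = begin
    e f (suc k) 1 (t + 1) +ℚ e f k 0 (t + 0)
      ≡⟨ cong₂ _+ℚ_ (e-last k 0 (t + 1)) (cong (e f k 0) (ℕ.+-identityʳ t)) ⟩
    e f k 1 (t + 1) +ℚ e f k 0 (t + 1 + k) +ℚ e f k 0 t
      ≡⟨ cong₂ (λ u v → e f k 1 (t + 1) +ℚ e f k 0 u +ℚ e f k 0 v) (ℕ.+-assoc t 1 k) (sym (ℕ.+-identityʳ t)) ⟩
    e f k 1 (t + 1) +ℚ e f k 0 (t + suc k) +ℚ e f k 0 (t + 0)
      ≡⟨ right-comm (e f k 1 (t + 1)) _ _ ⟩
    e f k 1 (t + 1) +ℚ e f k 0 (t + 0) +ℚ e f k 0 (t + suc k) ∎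
    where
    right-comm : ∀ a b c → a +ℚ b +ℚ c ≡ a +ℚ c +ℚ b
    right-comm = solve-∀ ℚ-ring
  e-last (suc k) (suc b) t = begin
    e f (suc k) (suc (suc b)) (t + suc (suc b)) +ℚ e f (suc k) (suc b) (t + suc b)
      ≡⟨ cong₂ _+ℚ_ (e-last k (suc b) (t + suc (suc b))) (e-last k b (t + suc b)) ⟩
    (e f k (suc (suc b)) (t + suc (suc b)) +ℚ e f k (suc b) (t + suc (suc b) + k)) +ℚ
    (e f k (suc b) (t + suc b) +ℚ e f k b (t + suc b + k))
      ≡⟨ cong₂ (λ u v → (e f k (suc (suc b)) (t + suc (suc b)) +ℚ e f k (suc b) u) +ℚ (e f k (suc b) (t + suc b) +ℚ e f k b v))
           (shift t b k) (shift′ t b k) ⟩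
    (e f k (suc (suc b)) (t + suc (suc b)) +ℚ e f k (suc b) (t + suc k + suc b)) +ℚ
    (e f k (suc b) (t + suc b) +ℚ e f k b (t + suc k + b))
      ≡⟨ middle (e f k (suc (suc b)) (t + suc (suc b))) _ _ _ ⟩
    (e f k (suc (suc b)) (t + suc (suc b)) +ℚ e f k (suc b) (t + suc b)) +ℚ
    (e f k (suc b) (t + suc k + suc b) +ℚ e f k b (t + suc k + b)) ∎
    where
    shift : ∀ t b k → t + suc (suc b) + k ≡ t + suc k + suc b
    shift = ℕ-solve-∀
    shift′ : ∀ t b k → t + suc b + k ≡ t + suc k + b
    shift′ = ℕ-solve-∀
    middle : ∀ a b c d → (a +ℚ b) +ℚ (c +ℚ d) ≡ (a +ℚ c) +ℚ (b +ℚ d)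
    middle = solve-∀ ℚ-ring

e-zero : ∀ k b t → e (λ _ → 0ℚ) k b t ≡ 0ℚ
e-zero zero    zero    t = refl
e-zero zero    (suc b) t = refl
e-zero (suc k) zero    t = e-zero k zero t
e-zero (suc k) (suc b) t =
  trans (cong₂ _+ℚ_ (e-zero k (suc b) (t + suc b)) (e-zero k b (t + b))) (ℚ.+-identityˡ 0ℚ)

e-∑ : ∀ (xs : List A) (f : A → ℕ → ℚ) k b t →
  ∑ xs (λ x → e (f x) k b t) ≡ e (λ u → ∑ xs (λ x → f x u)) k b t
e-∑ xs f zero    zero    t = refl
e-∑ xs f zero    (suc b) t = ∑-zero xs (λ _ → refl)
e-∑ xs f (suc k) zero    t = e-∑ xs f k zero t
e-∑ xs f (suc k) (suc b) t =
  trans (∑-+ xs (λ x → e (f x) k (suc b) (t + suc b)) _)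
        (cong₂ _+ℚ_ (e-∑ xs f k (suc b) (t + suc b)) (e-∑ xs f k b (t + b)))

∑-const : ∀ n (c : ℚ) → ∑ (upTo n) (λ _ → c) ≡ fromℕℚ n *ℚ c
∑-const n c = begin
  ∑ (upTo n) (λ _ → c)           ≡⟨ ∑-toℕ n (λ _ → c) ⟨
  ∑ (allFin n) (λ _ → c)         ≡⟨ ∑-cong (allFin n) (λ _ → ℚ.*-identityˡ c) ⟨
  ∑ (allFin n) (λ _ → 1ℚ *ℚ c)   ≡⟨ ∑-*ʳ (allFin n) (λ _ → 1ℚ) c ⟩
  ∑ (allFin n) (λ _ → 1ℚ) *ℚ c   ≡⟨ cong (_*ℚ c) (∑-1 n) ⟩
  fromℕℚ n *ℚ c                  ∎

module _ {m : ℕ} {f : ℕ → ℚ} (B : Balanced (suc m) f) where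
  open Balanced B
  private n = suc m

  e-periodic : ∀ k b t → e f k b (t + n) ≡ e f k b t
  e-periodic k b t = trans (e-shift f n k b t) (e-cong periodic k b t)

  -- Multiplication by ζ permutes 1, ζ, ..., ζ^m, and e_b is homogeneous, so ζ^b e_b = e_b.
  -- Concretely, splitting off the last variable after the rotation agrees modulo n with splitting
  -- off the first one before it.
  e-rotate : ∀ b t → e f n b (t + b) ≡ e f n b t
  e-rotate zero    t = cong (e f n 0) (ℕ.+-identityʳ t)
  e-rotate (suc b) t = trans (e-last f m b (t + suc b))
    (cong (e f m (suc b) (t + suc b) +ℚ_)
      (trans (cong (e f m b) (shift t b m)) (e-periodic m b (t + b))))
    where
    shift : ∀ t b m → t + suc b + m ≡ t + b + suc m
    shift = ℕ-solve-∀

  e-rotate* : ∀ b k t → e f n b (t + k * b) ≡ e f n b t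
  e-rotate* b zero    t = cong (e f n b) (ℕ.+-identityʳ t)
  e-rotate* b (suc k) t = begin
    e f n b (t + (b + k * b)) ≡⟨ cong (e f n b) (ℕ.+-assoc t b (k * b)) ⟨
    e f n b (t + b + k * b)   ≡⟨ e-rotate* b k (t + b) ⟩
    e f n b (t + b)           ≡⟨ e-rotate b t ⟩
    e f n b t                 ∎

  -- By `e-rotate`, e_b equals the average of ζ^(kb) e_b over k < n. The average is moved inside
  -- `e`, onto `f`, where it vanishes by balancedness.
  e-middle : ∀ b t → n ∤ b → e f n b t ≡ 0ℚ
  e-middle b t n∤b = *-cancel-0 (fromℕℚ n) (e f n b t) (≢-sym (ℚ.<⇒≢ (0<fromℕℚ-suc m))) (begin
    fromℕℚ n *ℚ e f n b t                              ≡⟨ ∑-const n (e f n b t) ⟨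
    ∑ (upTo n) (λ _ → e f n b t)                       ≡⟨ ∑-cong (upTo n) (λ k → e-rotate* b k t) ⟨
    ∑ (upTo n) (λ k → e f n b (t + k * b))             ≡⟨ ∑-cong (upTo n) (λ k → e-shift f (k * b) n b t) ⟩
    ∑ (upTo n) (λ k → e (λ u → f (u + k * b)) n b t)   ≡⟨ e-∑ (upTo n) (λ k u → f (u + k * b)) n b t ⟩
    e (λ u → ∑ (upTo n) (λ k → f (u + k * b))) n b t   ≡⟨ e-cong (λ u → balanced b u n∤b) n b t ⟩
    e (λ _ → 0ℚ) n b t                                 ≡⟨ e-zero n b t ⟩
    0ℚ                                                 ∎)

  -- Read off from the vanishing at T = -1 of ∏ (1 + ζ^j T), whose factor for j = 0 is 1 + T.
  e-without-1 : ∀ b t → b ≤ m → e f m b (t + b) ≡ sgn b *ℚ f t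
  e-without-1 zero    t _   = begin
    e f m 0 (t + 0)  ≡⟨ e-0 f m (t + 0) ⟩
    f (t + 0)        ≡⟨ cong f (ℕ.+-identityʳ t) ⟩
    f t              ≡⟨ ℚ.*-identityˡ (f t) ⟨
    1ℚ *ℚ f t        ∎
  e-without-1 (suc b) t b<m = begin
    e f m (suc b) (t + suc b)
      ≡⟨ split (e f m (suc b) (t + suc b)) (e f m b (t + b)) ⟩
    e f n (suc b) t -ℚ e f m b (t + b)
      ≡⟨ cong₂ _-ℚ_ (e-middle (suc b) t (λ n∣b → ℕ.<⇒≱ (s≤s b<m) (∣⇒≤ n∣b)))
                    (e-without-1 b t (ℕ.<⇒≤ b<m)) ⟩
    0ℚ -ℚ sgn b *ℚ f t
      ≡⟨ neg (sgn b) (f t) ⟩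
    -ℚ sgn b *ℚ f t ∎
    where
    split : ∀ a c → a ≡ a +ℚ c -ℚ c
    split = solve-∀ ℚ-ring
    neg : ∀ a c → 0ℚ -ℚ a *ℚ c ≡ -ℚ a *ℚ c
    neg = solve-∀ ℚ-ring

  e-top : ∀ t → e f n n t ≡ sgn m *ℚ f t
  e-top t = trans (cong₂ _+ℚ_ (e-overflow f m n (t + n) (ℕ.n<1+n m)) (e-without-1 m t ℕ.≤-refl))
    (ℚ.+-identityˡ (sgn m *ℚ f t))

  -- One scalar `c` serves all `t`. This substitutes for multiplicativity: the factors e_b of a
  -- product can be replaced by their scalars in turn.
  e-eval : ∀ b → ∃[ c ] (∀ t → e f n b t ≡ c *ℚ f t) × (c ≡ 0ℚ ⊎ b ≡ 0 × c ≡ 1ℚ ⊎ b ≡ n × c ≡ sgn m)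
  e-eval zero = 1ℚ , (λ t → trans (e-0 f n t) (sym (ℚ.*-identityˡ (f t)))) , inj₂ (inj₁ (refl , refl))
  e-eval b@(suc b′) with ℕ.<-cmp b n
  ... | tri< b<n _ _ = 0ℚ , (λ t → trans (e-middle b t (λ n∣b → ℕ.<⇒≱ b<n (∣⇒≤ n∣b))) (sym (ℚ.*-zeroˡ (f t)))) , inj₁ refl
  ... | tri≈ _ refl _ = sgn m , e-top , inj₂ (inj₂ (refl , refl))
  ... | tri> _ _ n<b = 0ℚ , (λ t → trans (e-overflow f n b t n<b) (sym (ℚ.*-zeroˡ (f t)))) , inj₁ refl

-- Proper colourings of a path

∑-upTo-cong : ∀ n {g h : ℕ → ℚ} → (∀ a → a < n → g a ≡ h a) → ∑ (upTo n) g ≡ ∑ (upTo n) h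
∑-upTo-cong zero    eq = refl
∑-upTo-cong (suc n) {g} {h} eq = begin
  ∑ (upTo (suc n)) g     ≡⟨ ∑-upTo-last n g ⟩
  ∑ (upTo n) g +ℚ g n    ≡⟨ cong₂ _+ℚ_ (∑-upTo-cong n (λ a a<n → eq a (ℕ.m<n⇒m<1+n a<n))) (eq n (ℕ.n<1+n n)) ⟩
  ∑ (upTo n) h +ℚ h n    ≡⟨ ∑-upTo-last n h ⟨
  ∑ (upTo (suc n)) h     ∎

pathᵇ : ∀ {m k} → (Fin (suc m) → Fin k) → Bool
pathᵇ {zero}  κ = true
pathᵇ {suc m} κ = not (finEqᵇ (κ zero) (κ (suc zero))) ∧ pathᵇ (κ ∘ suc)

weight : ∀ {m k} → (Fin m → Fin k) → ℕ
weight {zero}  κ = 0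
weight {suc m} κ = toℕ (κ zero) + weight (κ ∘ suc)

_⟦≢⟧_ : ∀ {k} → Fin k → Fin k → ℚ
i ⟦≢⟧ j = 1ℚ -ℚ ⟦ finEqᵇ i j ⟧

module _ {m : ℕ} {f : ℕ → ℚ} (B : Balanced (suc m) f) where
  open Balanced B
  private
    n = suc m
    F = allFin n

  -- Since the power sums p_1, …, p_{n-1} of the n-th roots of unity vanish, the end-to-end
  -- generating function of proper colourings of a path on l + 1 ≤ n vertices reduces to
  -- (-1)^l (δ_{ij} x_i^{l+1} - Σ_{a=1}^{l} x_i^a x_j^{l+1-a}).
  h : ℕ → Fin n → Fin n → ℕ → ℚ
  h l i j t = ∑ (upTo l) (λ a → f (t + suc a * toℕ i + (l ∸ a) * toℕ j))

  h-suc : ∀ l i j t → f (t + toℕ i + suc l * toℕ j) +ℚ h l i j (t + toℕ i) ≡ h (suc l) i j t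
  h-suc l i j t = sym (trans (∑-upTo-suc l (λ a → f (t + suc a * toℕ i + (suc l ∸ a) * toℕ j)))
    (cong₂ _+ℚ_ (cong (λ x → f (t + x + suc l * toℕ j)) (ℕ.*-identityˡ (toℕ i)))
      (∑-cong (upTo l) (λ a → cong (λ x → f (x + (l ∸ a) * toℕ j)) (sym (ℕ.+-assoc t (toℕ i) (suc a * toℕ i)))))))

  -- Summed over the colour `k`, the term of index `a` is a power sum of exponent a + 1, and 1 ≤ a +
  -- 1 ≤ l < n.
  ∑-h : ∀ l j t → l < n → ∑ F (λ k → h l k j t) ≡ 0ℚ
  ∑-h l j t l<n = begin
    ∑ F (λ k → h l k j t)
      ≡⟨ ∑-swap F (upTo l) (λ k a → f (t + suc a * toℕ k + (l ∸ a) * toℕ j)) ⟩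
    ∑ (upTo l) (λ a → ∑ F (λ k → f (t + suc a * toℕ k + (l ∸ a) * toℕ j)))
      ≡⟨ ∑-upTo-cong l (λ a a<l → begin
           ∑ F (λ k → f (t + suc a * toℕ k + (l ∸ a) * toℕ j))
             ≡⟨ ∑-toℕ n (λ k → f (t + suc a * k + (l ∸ a) * toℕ j)) ⟩
           ∑ (upTo n) (λ k → f (t + suc a * k + (l ∸ a) * toℕ j))
             ≡⟨ ∑-cong (upTo n) (λ k → cong f (shift t (suc a) k ((l ∸ a) * toℕ j))) ⟩
           ∑ (upTo n) (λ k → f (t + (l ∸ a) * toℕ j + k * suc a))
             ≡⟨ balanced (suc a) (t + (l ∸ a) * toℕ j) (λ n∣a → ℕ.<⇒≱ (ℕ.≤-<-trans a<l l<n) (∣⇒≤ n∣a)) ⟩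
           0ℚ ∎) ⟩
    ∑ (upTo l) (λ _ → 0ℚ)
      ≡⟨ ∑-zero (upTo l) (λ _ → refl) ⟩
    0ℚ ∎
    where
    shift : ∀ t a k c → t + a * k + c ≡ t + c + k * a
    shift = ℕ-solve-∀

  -- The weight `G` on the two end colours is arbitrary so that it can absorb the triangle
  -- conditions, and later the sums over the other paths.
  pathSum : ∀ l (G : Fin n → Fin n → ℚ) (t : ℕ) → ℚ
  pathSum l G t = ∑ (allFunsOver F (suc l)) (λ κ → ⟦ pathᵇ κ ⟧ *ℚ (G (κ zero) (κ (fromℕ l)) *ℚ f (t + weight κ)))

  pathForm : ∀ l (G : Fin n → Fin n → ℚ) (t : ℕ) → ℚ
  pathForm l G t = ∑ F (λ i → G i i *ℚ f (t + suc l * toℕ i)) -ℚ ∑ F (λ i → ∑ F (λ j → G i j *ℚ h l i j t))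

  -- The new edge contributes 1 - δ. In the diagonal part of `pathForm`, the 1 gives `P`, which is
  -- the missing first term of `h (suc l)`, and the δ gives the new diagonal `Q`. In the `h` part,
  -- the 1 gives zero by `∑-h`, and the δ gives `R`, the other terms of `h (suc l)`. The signs come
  -- out reversed, whence (-1)^l.
  pathForm-suc : ∀ l G t → suc l < n →
    ∑ F (λ c → pathForm l (λ k j → c ⟦≢⟧ k *ℚ G c j) (t + toℕ c)) ≡ -ℚ pathForm (suc l) G t
  pathForm-suc l G t l<n = begin
    ∑ F (λ c → pathForm l (λ k j → c ⟦≢⟧ k *ℚ G c j) (t + toℕ c))
      ≡⟨ ∑-cong F (λ c → cong₂ _-ℚ_ (diagonal c) (rest c)) ⟩
    ∑ F (λ c → P c -ℚ Q c -ℚ (0ℚ -ℚ R c))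
      ≡⟨ ∑-cong F (λ c → regroup (P c) (Q c) (R c)) ⟩
    ∑ F (λ c → P c +ℚ R c -ℚ Q c)
      ≡⟨ ∑-- F (λ c → P c +ℚ R c) Q ⟩
    ∑ F (λ c → P c +ℚ R c) -ℚ ∑ F Q
      ≡⟨ cong₂ _-ℚ_ (∑-cong F (λ c → trans (sym (∑-+ F (λ k → G c k *ℚ f (t + toℕ c + suc l * toℕ k)) _))
            (∑-cong F (λ k → trans (sym (ℚ.*-distribˡ-+ (G c k) _ _)) (cong (G c k *ℚ_) (h-suc l c k t))))))
          (∑-cong F (λ c → cong (λ x → G c c *ℚ f x) (ℕ.+-assoc t (toℕ c) (suc l * toℕ c)))) ⟩
    ∑ F (λ c → ∑ F (λ k → G c k *ℚ h (suc l) c k t)) -ℚ ∑ F (λ c → G c c *ℚ f (t + suc (suc l) * toℕ c))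
      ≡⟨ flip- (∑ F (λ c → ∑ F (λ k → G c k *ℚ h (suc l) c k t))) _ ⟩
    -ℚ pathForm (suc l) G t ∎
    where
    P Q R : Fin n → ℚ
    P c = ∑ F (λ k → G c k *ℚ f (t + toℕ c + suc l * toℕ k))
    Q c = G c c *ℚ f (t + toℕ c + suc l * toℕ c)
    R c = ∑ F (λ j → G c j *ℚ h l c j (t + toℕ c))
    regroup : ∀ a b c → a -ℚ b -ℚ (0ℚ -ℚ c) ≡ a +ℚ c -ℚ b
    regroup = solve-∀ ℚ-ring
    flip- : ∀ a b → a -ℚ b ≡ -ℚ (b -ℚ a)
    flip- = solve-∀ ℚ-ring
    expand : ∀ d g x → (1ℚ -ℚ d) *ℚ g *ℚ x ≡ g *ℚ x -ℚ d *ℚ (g *ℚ x)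
    expand = solve-∀ ℚ-ring
    diagonal : ∀ c → ∑ F (λ k → c ⟦≢⟧ k *ℚ G c k *ℚ f (t + toℕ c + suc l * toℕ k)) ≡ P c -ℚ Q c
    diagonal c = begin
      ∑ F (λ k → c ⟦≢⟧ k *ℚ G c k *ℚ f (t + toℕ c + suc l * toℕ k))
        ≡⟨ ∑-cong F (λ k → expand ⟦ finEqᵇ c k ⟧ (G c k) _) ⟩
      ∑ F (λ k → G c k *ℚ f (t + toℕ c + suc l * toℕ k) -ℚ ⟦ finEqᵇ c k ⟧ *ℚ (G c k *ℚ f (t + toℕ c + suc l * toℕ k)))
        ≡⟨ ∑-- F (λ k → G c k *ℚ f (t + toℕ c + suc l * toℕ k)) _ ⟩
      P c -ℚ ∑ F (λ k → ⟦ finEqᵇ c k ⟧ *ℚ (G c k *ℚ f (t + toℕ c + suc l * toℕ k)))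
        ≡⟨ cong (λ x → P c -ℚ x) (∑-δ c (λ k → G c k *ℚ f (t + toℕ c + suc l * toℕ k))) ⟩
      P c -ℚ Q c ∎
    rest : ∀ c → ∑ F (λ k → ∑ F (λ j → c ⟦≢⟧ k *ℚ G c j *ℚ h l k j (t + toℕ c))) ≡ 0ℚ -ℚ R c
    rest c = begin
      ∑ F (λ k → ∑ F (λ j → c ⟦≢⟧ k *ℚ G c j *ℚ h l k j (t + toℕ c)))
        ≡⟨ ∑-swap F F (λ k j → c ⟦≢⟧ k *ℚ G c j *ℚ h l k j (t + toℕ c)) ⟩
      ∑ F (λ j → ∑ F (λ k → c ⟦≢⟧ k *ℚ G c j *ℚ h l k j (t + toℕ c)))
        ≡⟨ ∑-cong F (λ j → begin
             ∑ F (λ k → c ⟦≢⟧ k *ℚ G c j *ℚ h l k j (t + toℕ c))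
               ≡⟨ ∑-cong F (λ k → expand ⟦ finEqᵇ c k ⟧ (G c j) _) ⟩
             ∑ F (λ k → G c j *ℚ h l k j (t + toℕ c) -ℚ ⟦ finEqᵇ c k ⟧ *ℚ (G c j *ℚ h l k j (t + toℕ c)))
               ≡⟨ ∑-- F (λ k → G c j *ℚ h l k j (t + toℕ c)) _ ⟩
             ∑ F (λ k → G c j *ℚ h l k j (t + toℕ c)) -ℚ ∑ F (λ k → ⟦ finEqᵇ c k ⟧ *ℚ (G c j *ℚ h l k j (t + toℕ c)))
               ≡⟨ cong₂ _-ℚ_ (trans (∑-* F (G c j) (λ k → h l k j (t + toℕ c)))
                               (trans (cong (G c j *ℚ_) (∑-h l j (t + toℕ c) (ℕ.<⇒≤ l<n))) (ℚ.*-zeroʳ (G c j))))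
                             (∑-δ c (λ k → G c j *ℚ h l k j (t + toℕ c))) ⟩
             0ℚ -ℚ G c j *ℚ h l c j (t + toℕ c) ∎) ⟩
      ∑ F (λ j → 0ℚ -ℚ G c j *ℚ h l c j (t + toℕ c))
        ≡⟨ ∑-- F (λ _ → 0ℚ) (λ j → G c j *ℚ h l c j (t + toℕ c)) ⟩
      ∑ F (λ _ → 0ℚ) -ℚ R c
        ≡⟨ cong (_-ℚ R c) (∑-zero F (λ _ → refl)) ⟩
      0ℚ -ℚ R c ∎

  pathSum-form : ∀ l G t → l < n → pathSum l G t ≡ sgn l *ℚ pathForm l G t
  pathSum-form zero G t _ = begin
    pathSum 0 G t
      ≡⟨ ∑-allFunsOver-suc F 0 (λ κ → ⟦ pathᵇ κ ⟧ *ℚ (G (κ zero) (κ zero) *ℚ f (t + weight κ))) ⟩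
    ∑ F (λ c → 1ℚ *ℚ (G c c *ℚ f (t + (toℕ c + 0)))) +ℚ 0ℚ
      ≡⟨ ℚ.+-identityʳ (∑ F (λ c → 1ℚ *ℚ (G c c *ℚ f (t + (toℕ c + 0))))) ⟩
    ∑ F (λ c → 1ℚ *ℚ (G c c *ℚ f (t + (toℕ c + 0))))
      ≡⟨ ∑-* F 1ℚ (λ c → G c c *ℚ f (t + (toℕ c + 0))) ⟩
    1ℚ *ℚ D
      ≡⟨ minus-0 D ⟩
    1ℚ *ℚ (D -ℚ 0ℚ)
      ≡⟨ cong (λ x → 1ℚ *ℚ (D -ℚ x)) (∑-zero F (λ i → ∑-zero F (λ j → ℚ.*-zeroʳ (G i j)))) ⟨
    1ℚ *ℚ pathForm 0 G t ∎
    where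
    D = ∑ F (λ c → G c c *ℚ f (t + (toℕ c + 0)))
    minus-0 : ∀ a → 1ℚ *ℚ a ≡ 1ℚ *ℚ (a -ℚ 0ℚ)
    minus-0 = solve-∀ ℚ-ring
  pathSum-form (suc l) G t l<n = begin
    pathSum (suc l) G t
      ≡⟨ ∑-allFunsOver-suc F (suc l) (λ κ → ⟦ pathᵇ κ ⟧ *ℚ (G (κ zero) (κ (fromℕ (suc l))) *ℚ f (t + weight κ))) ⟩
    ∑ (allFunsOver F (suc l)) (λ κ → ∑ F (λ c → term κ c))
      ≡⟨ ∑-swap (allFunsOver F (suc l)) F term ⟩
    ∑ F (λ c → ∑ (allFunsOver F (suc l)) (λ κ → term κ c))
      ≡⟨ ∑-cong F (λ c → ∑-cong (allFunsOver F (suc l)) (λ κ → regroup κ c)) ⟩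
    -- Once the first colour `c` is fixed, its edge condition and `G c` together form an end weight
    -- for the shorter path, and its power of ζ goes into the exponent.
    ∑ F (λ c → pathSum l (λ k j → c ⟦≢⟧ k *ℚ G c j) (t + toℕ c))
      ≡⟨ ∑-cong F (λ c → pathSum-form l (λ k j → c ⟦≢⟧ k *ℚ G c j) (t + toℕ c) (ℕ.<⇒≤ l<n)) ⟩
    ∑ F (λ c → sgn l *ℚ pathForm l (λ k j → c ⟦≢⟧ k *ℚ G c j) (t + toℕ c))
      ≡⟨ ∑-* F (sgn l) (λ c → pathForm l (λ k j → c ⟦≢⟧ k *ℚ G c j) (t + toℕ c)) ⟩
    sgn l *ℚ ∑ F (λ c → pathForm l (λ k j → c ⟦≢⟧ k *ℚ G c j) (t + toℕ c))
      ≡⟨ cong (sgn l *ℚ_) (pathForm-suc l G t l<n) ⟩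
    sgn l *ℚ (-ℚ pathForm (suc l) G t)
      ≡⟨ neg (sgn l) (pathForm (suc l) G t) ⟩
    sgn (suc l) *ℚ pathForm (suc l) G t ∎
    where
    term : (Fin (suc l) → Fin n) → Fin n → ℚ
    term κ c = ⟦ not (finEqᵇ c (κ zero)) ∧ pathᵇ κ ⟧ *ℚ (G c (κ (fromℕ l)) *ℚ f (t + (toℕ c + weight κ)))
    neg : ∀ a b → a *ℚ (-ℚ b) ≡ (-ℚ a) *ℚ b
    neg = solve-∀ ℚ-ring
    assoc : ∀ a b c d → a *ℚ b *ℚ (c *ℚ d) ≡ b *ℚ (a *ℚ c *ℚ d)
    assoc = solve-∀ ℚ-ring
    regroup : ∀ κ c → term κ c ≡
      ⟦ pathᵇ κ ⟧ *ℚ (c ⟦≢⟧ κ zero *ℚ G c (κ (fromℕ l)) *ℚ f (t + toℕ c + weight κ))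
    regroup κ c = begin
      ⟦ not (finEqᵇ c (κ zero)) ∧ pathᵇ κ ⟧ *ℚ (G c (κ (fromℕ l)) *ℚ f (t + (toℕ c + weight κ)))
        ≡⟨ cong₂ (λ x y → x *ℚ (G c (κ (fromℕ l)) *ℚ f y))
             (trans (⟦⟧-∧ (not (finEqᵇ c (κ zero))) (pathᵇ κ)) (cong (_*ℚ ⟦ pathᵇ κ ⟧) (⟦⟧-not (finEqᵇ c (κ zero)))))
             (sym (ℕ.+-assoc t (toℕ c) (weight κ))) ⟩
      c ⟦≢⟧ κ zero *ℚ ⟦ pathᵇ κ ⟧ *ℚ (G c (κ (fromℕ l)) *ℚ f (t + toℕ c + weight κ))
        ≡⟨ assoc (c ⟦≢⟧ κ zero) ⟦ pathᵇ κ ⟧ (G c (κ (fromℕ l))) _ ⟩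
      ⟦ pathᵇ κ ⟧ *ℚ (c ⟦≢⟧ κ zero *ℚ G c (κ (fromℕ l)) *ℚ f (t + toℕ c + weight κ)) ∎

  -- For i = j each of the n - 1 terms is ζ^t, since the exponents of x_i add up to n. For i ≠ j
  -- adding the term a = 0, also equal to ζ^t, completes a geometric series of ratio ζ^(i-j), whose
  -- sum is zero.
  h-full : ∀ i j t → h m i j t ≡ (fromℕℚ n *ℚ ⟦ finEqᵇ i j ⟧ -ℚ 1ℚ) *ℚ f t
  h-full i j t with i Fin.≟ j
  ... | yes refl = begin
    h m i i t                     ≡⟨ ∑-upTo-cong m same ⟩
    ∑ (upTo m) (λ _ → f t)        ≡⟨ ∑-const m (f t) ⟩
    fromℕℚ m *ℚ f t               ≡⟨ pred (fromℕℚ m) (f t) ⟩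
    ((1ℚ +ℚ fromℕℚ m) *ℚ 1ℚ -ℚ 1ℚ) *ℚ f t
                                  ≡⟨ cong (λ x → (x *ℚ 1ℚ -ℚ 1ℚ) *ℚ f t) (fromℕℚ-suc m) ⟨
    (fromℕℚ n *ℚ 1ℚ -ℚ 1ℚ) *ℚ f t ∎
    where
    pred : ∀ a b → a *ℚ b ≡ ((1ℚ +ℚ a) *ℚ 1ℚ -ℚ 1ℚ) *ℚ b
    pred = solve-∀ ℚ-ring
    collect : ∀ t a c x → t + suc a * x + c * x ≡ t + x * suc (a + c)
    collect = ℕ-solve-∀
    same : ∀ a → a < m → f (t + suc a * toℕ i + (m ∸ a) * toℕ i) ≡ f t
    same a a<m = trans (cong f (trans (collect t a (m ∸ a) (toℕ i))
      (cong (λ x → t + toℕ i * suc x) (ℕ.m+[n∸m]≡n (ℕ.<⇒≤ a<m))))) (periodic-* periodic (toℕ i) t)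
  ... | no i≢j = begin
    h m i j t                              ≡⟨ add-sub (f (t + n * y)) (h m i j t) ⟩
    f (t + n * y) +ℚ h m i j t -ℚ f (t + n * y)
      ≡⟨ cong₂ (λ a b → a +ℚ h m i j t -ℚ b)
           (cong (λ a → f (a + n * y)) (sym (ℕ.+-identityʳ t)))
           (trans (cong (λ a → f (t + a)) (ℕ.*-comm n y)) (periodic-* periodic y t)) ⟩
    f (t + 0 * x + n * y) +ℚ h m i j t -ℚ f t
      ≡⟨ cong (_-ℚ f t) (∑-upTo-suc m (λ a → f (t + a * x + (n ∸ a) * y))) ⟨
    ∑ (upTo n) (λ a → f (t + a * x + (n ∸ a) * y)) -ℚ f t
      ≡⟨ cong (_-ℚ f t) (∑-upTo-cong n rotate) ⟩
    ∑ (upTo n) (λ a → f (t + n * y + a * (x + (n ∸ y)))) -ℚ f t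
      ≡⟨ cong (_-ℚ f t) (balanced (x + (n ∸ y)) (t + n * y) n∤d) ⟩
    0ℚ -ℚ f t
      ≡⟨ tidy (fromℕℚ n) (f t) ⟩
    (fromℕℚ n *ℚ 0ℚ -ℚ 1ℚ) *ℚ f t ∎
    where
    x = toℕ i
    y = toℕ j
    y≤n : y ≤ n
    y≤n = ℕ.<⇒≤ (Fin.toℕ<n j)
    add-sub : ∀ a b → b ≡ a +ℚ b -ℚ a
    add-sub = solve-∀ ℚ-ring
    tidy : ∀ a b → 0ℚ -ℚ b ≡ (a *ℚ 0ℚ -ℚ 1ℚ) *ℚ b
    tidy = solve-∀ ℚ-ring
    expand : ∀ t a x z y c → t + a * x + c * y + a * (y + z) ≡ t + (c + a) * y + a * (x + z)
    expand = ℕ-solve-∀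
    rotate : ∀ a → a < n → f (t + a * x + (n ∸ a) * y) ≡ f (t + n * y + a * (x + (n ∸ y)))
    rotate a a<n = trans (sym (periodic-* periodic a (t + a * x + (n ∸ a) * y))) (cong f (begin
      t + a * x + (n ∸ a) * y + a * n             ≡⟨ cong (λ z → t + a * x + (n ∸ a) * y + a * z) (ℕ.m+[n∸m]≡n y≤n) ⟨
      t + a * x + (n ∸ a) * y + a * (y + (n ∸ y)) ≡⟨ expand t a x (n ∸ y) y (n ∸ a) ⟩
      t + ((n ∸ a) + a) * y + a * (x + (n ∸ y))   ≡⟨ cong (λ z → t + z * y + a * (x + (n ∸ y))) (ℕ.m∸n+n≡m (ℕ.<⇒≤ a<n)) ⟩
      t + n * y + a * (x + (n ∸ y))               ∎))
    -- `x + (n ∸ y)` represents i - j modulo n without subtraction. It lies strictly between 0 and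
    -- 2n and equals n only if i = j.
    n∤d : n ∤ x + (n ∸ y)
    n∤d (divides 0 eq) = ℕ.<⇒≢ (ℕ.m<n⇒0<n∸m (Fin.toℕ<n j)) (sym (ℕ.m+n≡0⇒n≡0 x eq))
    n∤d (divides 1 eq) = i≢j (Fin.toℕ-injective (ℕ.+-cancelʳ-≡ (n ∸ y) x y
      (trans eq (trans (ℕ.+-identityʳ n) (sym (ℕ.m+[n∸m]≡n y≤n))))))
    n∤d (divides (suc (suc q)) eq) = ℕ.<⇒≱ (ℕ.+-mono-<-≤ (Fin.toℕ<n i) (ℕ.m∸n≤m n y))
      (ℕ.≤-trans (ℕ.+-monoʳ-≤ n (ℕ.m≤m+n n (q * n))) (ℕ.≤-reflexive (sym eq)))

  transfer : Fin n → Fin n → ℚ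
  transfer i j = 1ℚ -ℚ fromℕℚ m *ℚ ⟦ finEqᵇ i j ⟧

  -- For l = n - 1 the diagonal exponent t + n i reduces to t, and δ - (n δ - 1) = 1 - (n-1) δ
  -- remains.
  pathSum-full : ∀ G t → pathSum m G t ≡ sgn m *ℚ ∑ F (λ i → ∑ F (λ j → G i j *ℚ transfer i j)) *ℚ f t
  pathSum-full G t = begin
    pathSum m G t
      ≡⟨ pathSum-form m G t (ℕ.n<1+n m) ⟩
    sgn m *ℚ pathForm m G t
      ≡⟨ cong (sgn m *ℚ_) (begin
        pathForm m G t
          ≡⟨ cong (_-ℚ ∑ F (λ i → ∑ F (λ j → G i j *ℚ h m i j t)))
               (∑-cong F (λ i → trans (cong (G i i *ℚ_) (trans (cong (λ x → f (t + x)) (ℕ.*-comm n (toℕ i))) (periodic-* periodic (toℕ i) t)))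
                  (sym (∑-δ i (λ j → G i j *ℚ f t))))) ⟩
        ∑ F (λ i → ∑ F (λ j → ⟦ finEqᵇ i j ⟧ *ℚ (G i j *ℚ f t))) -ℚ ∑ F (λ i → ∑ F (λ j → G i j *ℚ h m i j t))
          ≡⟨ ∑-- F (λ i → ∑ F (λ j → ⟦ finEqᵇ i j ⟧ *ℚ (G i j *ℚ f t))) _ ⟨
        ∑ F (λ i → ∑ F (λ j → ⟦ finEqᵇ i j ⟧ *ℚ (G i j *ℚ f t)) -ℚ ∑ F (λ j → G i j *ℚ h m i j t))
          ≡⟨ ∑-cong F (λ i → sym (∑-- F (λ j → ⟦ finEqᵇ i j ⟧ *ℚ (G i j *ℚ f t)) _)) ⟩
        ∑ F (λ i → ∑ F (λ j → ⟦ finEqᵇ i j ⟧ *ℚ (G i j *ℚ f t) -ℚ G i j *ℚ h m i j t))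
          ≡⟨ ∑-cong F (λ i → ∑-cong F (λ j → trans
               (cong (λ x → ⟦ finEqᵇ i j ⟧ *ℚ (G i j *ℚ f t) -ℚ G i j *ℚ x)
                 (trans (h-full i j t) (cong (λ x → (x *ℚ ⟦ finEqᵇ i j ⟧ -ℚ 1ℚ) *ℚ f t) (fromℕℚ-suc m))))
               (combine ⟦ finEqᵇ i j ⟧ (G i j) (f t) (fromℕℚ m)))) ⟩
        ∑ F (λ i → ∑ F (λ j → G i j *ℚ transfer i j *ℚ f t))
          ≡⟨ ∑-cong F (λ i → ∑-*ʳ F (λ j → G i j *ℚ transfer i j) (f t)) ⟩
        ∑ F (λ i → ∑ F (λ j → G i j *ℚ transfer i j) *ℚ f t)
          ≡⟨ ∑-*ʳ F (λ i → ∑ F (λ j → G i j *ℚ transfer i j)) (f t) ⟩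
        ∑ F (λ i → ∑ F (λ j → G i j *ℚ transfer i j)) *ℚ f t ∎) ⟩
    sgn m *ℚ (∑ F (λ i → ∑ F (λ j → G i j *ℚ transfer i j)) *ℚ f t)
      ≡⟨ ℚ.*-assoc (sgn m) _ (f t) ⟨
    sgn m *ℚ ∑ F (λ i → ∑ F (λ j → G i j *ℚ transfer i j)) *ℚ f t ∎
    where
    combine : ∀ d g x k → d *ℚ (g *ℚ x) -ℚ g *ℚ (((1ℚ +ℚ k) *ℚ d -ℚ 1ℚ) *ℚ x) ≡ g *ℚ (1ℚ -ℚ k *ℚ d) *ℚ x
    combine = solve-∀ ℚ-ring

-- Existence of balanced functions

∑-cyclic : ∀ n (φ : ℕ → ℚ) → (∀ k → φ (k + n) ≡ φ k) → ∀ d →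
  ∑ (upTo n) (λ k → φ (k + d)) ≡ ∑ (upTo n) φ
∑-cyclic n φ per zero    = ∑-cong (upTo n) (λ k → cong φ (ℕ.+-identityʳ k))
∑-cyclic n φ per (suc d) = begin
  ∑ (upTo n) (λ k → φ (k + suc d))
    ≡⟨ ∑-cong (upTo n) (λ k → cong φ (ℕ.+-suc k d)) ⟩
  ∑ (upTo n) (λ k → φ (suc k + d))
    ≡⟨ cancel (φ d) _ ⟩
  φ d +ℚ ∑ (upTo n) (λ k → φ (suc k + d)) -ℚ φ d
    ≡⟨ cong (_-ℚ φ d) (∑-upTo-suc n (λ k → φ (k + d))) ⟨
  ∑ (upTo (suc n)) (λ k → φ (k + d)) -ℚ φ d
    ≡⟨ cong (_-ℚ φ d) (∑-upTo-last n (λ k → φ (k + d))) ⟩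
  ∑ (upTo n) (λ k → φ (k + d)) +ℚ φ (n + d) -ℚ φ d
    ≡⟨ cong (λ x → ∑ (upTo n) (λ k → φ (k + d)) +ℚ x -ℚ φ d) (trans (cong φ (ℕ.+-comm n d)) (per d)) ⟩
  ∑ (upTo n) (λ k → φ (k + d)) +ℚ φ d -ℚ φ d
    ≡⟨ cancelʳ (∑ (upTo n) (λ k → φ (k + d))) (φ d) ⟩
  ∑ (upTo n) (λ k → φ (k + d))
    ≡⟨ ∑-cyclic n φ per d ⟩
  ∑ (upTo n) φ ∎
  where
  cancel : ∀ a b → b ≡ a +ℚ b -ℚ a
  cancel = solve-∀ ℚ-ring
  cancelʳ : ∀ a b → a +ℚ b -ℚ b ≡ a
  cancelʳ = solve-∀ ℚ-ring

prime-factor : ∀ k → .{{NonZero k}} → k ≢ 1 → ∃[ p ] Prime p × p ∣ k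
prime-factor k k≢1 = head (PrimeFactorisation.factors F) (PrimeFactorisation.isFactorisation F) (PrimeFactorisation.factorsPrime F)
  where
  F = factorise k
  head : ∀ ps → k ≡ product ps → All Prime ps → ∃[ p ] Prime p × p ∣ k
  head []       eq []       = contradiction eq k≢1
  head (p ∷ ps) eq (pp ∷ _) = p , pp , subst (p ∣_) (sym eq) (m∣m*n (product ps))

-- Membership in the image of 1 - (shift by c) on functions on ℤ/n.
IsDifference : ℕ → ℕ → (ℕ → ℚ) → Set
IsDifference n c f = ∃[ h ] Periodic n h × (∀ t → f t ≡ h t -ℚ h (t + c))

-- If c is a multiple k b modulo n, then shifting by `c` moves the progression of step `b` onto
-- itself by k places, so the two sums cancel. Multiples of n on both sides express the congruence
-- within ℕ.
difference⇒∑≡0 : ∀ n b c k r s {f} → IsDifference n c f → c + r * n ≡ k * b + s * n →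
  ∀ t → ∑ (upTo n) (λ k → f (t + k * b)) ≡ 0ℚ
difference⇒∑≡0 n b c k r s {f} (h , per , f≡) c≡kb t = begin
  ∑ (upTo n) (λ j → f (t + j * b))                  ≡⟨ ∑-cong (upTo n) (λ j → f≡ (t + j * b)) ⟩
  ∑ (upTo n) (λ j → φ j -ℚ h (t + j * b + c))        ≡⟨ ∑-cong (upTo n) (λ j → cong (λ x → φ j -ℚ x) (shift j)) ⟩
  ∑ (upTo n) (λ j → φ j -ℚ φ (j + k))                ≡⟨ ∑-- (upTo n) φ (λ j → φ (j + k)) ⟩
  ∑ (upTo n) φ -ℚ ∑ (upTo n) (λ j → φ (j + k))       ≡⟨ cong (λ x → ∑ (upTo n) φ -ℚ x) (∑-cyclic n φ φ-per k) ⟩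
  ∑ (upTo n) φ -ℚ ∑ (upTo n) φ                       ≡⟨ ℚ.+-inverseʳ (∑ (upTo n) φ) ⟩
  0ℚ                                                 ∎
  where
  φ : ℕ → ℚ
  φ j = h (t + j * b)
  distrib : ∀ t j n b → t + (j + n) * b ≡ t + j * b + b * n
  distrib = ℕ-solve-∀
  φ-per : ∀ j → φ (j + n) ≡ φ j
  φ-per j = trans (cong h (distrib t j n b)) (periodic-* per b (t + j * b))
  expand : ∀ t j b k s n → t + j * b + (k * b + s * n) ≡ t + (j + k) * b + s * n
  expand = ℕ-solve-∀
  shift : ∀ j → h (t + j * b + c) ≡ φ (j + k)
  shift j = begin
    h (t + j * b + c)                ≡⟨ periodic-* per r (t + j * b + c) ⟨
    h (t + j * b + c + r * n)        ≡⟨ cong h (ℕ.+-assoc (t + j * b) c (r * n)) ⟩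
    h (t + j * b + (c + r * n))      ≡⟨ cong (λ x → h (t + j * b + x)) c≡kb ⟩
    h (t + j * b + (k * b + s * n))  ≡⟨ cong h (expand t j b k s n) ⟩
    h (t + (j + k) * b + s * n)      ≡⟨ periodic-* per s (t + (j + k) * b) ⟩
    φ (j + k)                        ∎

module _ (n : ℕ) .{{n≢0 : NonZero n}} where

  -- f = ∏ (1 - shift by n/p) applied to the indicator of nℕ, over the primes p < m dividing n.
  -- It survives each factor because, for a prime p not yet used, its support consists of multiples
  -- of the largest power of p dividing n, and n/p is not one.
  record Sieve (m : ℕ) (f : ℕ → ℚ) : Set where
    field
      periodic   : Periodic n f
      nonzero    : ∃[ t ] f t ≢ 0ℚ
      difference : ∀ {p} → p < m → Prime p → ∀ c → n ≡ c * p → IsDifference n c f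
      support    : ∀ {p} → m ≤ p → Prime p → p ∣ n → ∀ t → f t ≢ 0ℚ → ∃[ c ] p ∤ c × n ∣ c * t

  indicator : ℕ → ℚ
  indicator t = ⟦ does (n ∣? t) ⟧

  indicator-sieve : Sieve 0 indicator
  indicator-sieve = record
    { periodic   = periodic
    ; nonzero    = 0 , λ eq → 1≢0 (trans (cong ⟦_⟧ (sym (dec-true (n ∣? 0) (n ∣0)))) eq)
    ; difference = λ ()
    ; support    = λ _ pp _ t ft≢0 → 1 , (λ p∣1 → ¬prime[1] (subst Prime (∣1⇒≡1 p∣1) pp)) , subst (n ∣_) (sym (ℕ.*-identityˡ t)) (n∣ t ft≢0)
    }
    where
    1≢0 : 1ℚ ≢ 0ℚ
    1≢0 ()
    n∣ : ∀ t → indicator t ≢ 0ℚ → n ∣ t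
    n∣ t it≢0 with n ∣? t
    ... | yes n∣t = n∣t
    ... | no _    = contradiction refl it≢0
    periodic : Periodic n indicator
    periodic t with n ∣? t
    ... | yes n∣t = cong ⟦_⟧ (dec-true (n ∣? t + n) (∣m∣n⇒∣m+n n∣t ∣-refl))
    ... | no n∤t  = cong ⟦_⟧ (dec-false (n ∣? t + n) (λ n∣t+n → n∤t (∣m+n∣m⇒∣n (subst (n ∣_) (ℕ.+-comm t n) n∣t+n) ∣-refl)))

  sieve-step : ∀ {p f} → Sieve p f → Prime p → ∀ c → n ≡ c * p → Sieve (suc p) (λ t → f t -ℚ f (t + c))
  sieve-step {p} {f} S pp c n≡cp = record
    { periodic   = Df-periodic
    ; nonzero    = t₀ , λ eq → ft₀≢0 (trans (sym (trans (cong (λ x → f t₀ -ℚ x) f[t₀+c]≡0) (ℚ.+-identityʳ (f t₀)))) eq)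
    ; difference = λ q<sp pq d n≡dq → difference′ (ℕ.m≤n⇒m<n∨m≡n (s≤s⁻¹ q<sp)) pq d n≡dq
    ; support    = support′
    }
    where
    open Sieve S
    shift-comm : ∀ a b c → a + b + c ≡ a + c + b
    shift-comm = ℕ-solve-∀
    Df-periodic : Periodic n (λ t → f t -ℚ f (t + c))
    Df-periodic t = cong₂ _-ℚ_ (periodic t) (trans (cong f (shift-comm t n c)) (periodic (t + c)))
    t₀ = proj₁ nonzero
    ft₀≢0 = proj₂ nonzero
    p∣n : p ∣ n
    p∣n = divides c n≡cp
    c≢0 : NonZero c
    c≢0 = ℕ.m*n≢0⇒m≢0 c {{subst NonZero n≡cp (>-nonZero (>-nonZero⁻¹ n))}}
    assoc : ∀ a b c → a * b * c ≡ b * (a * c)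
    assoc = ℕ-solve-∀
    assoc′ : ∀ a b t c → a * b * (t + c) ≡ a * b * t + a * b * c
    assoc′ = ℕ-solve-∀
    -- The witnesses `a` and `b`, prime to `p`, say that the p-part of `n` divides both `t` and
    -- `t + c`. Eliminating `t` gives `n ∣ a * b * c`, and cancelling `c` against `n ≡ c * p` leaves
    -- `p ∣ a * b`.
    clash : ∀ t → f t ≢ 0ℚ → f (t + c) ≢ 0ℚ → ⊥
    clash t ft≢0 ft+c≢0 with support ℕ.≤-refl pp p∣n t ft≢0 | support ℕ.≤-refl pp p∣n (t + c) ft+c≢0
    ... | a , p∤a , n∣at | b , p∤b , n∣b[t+c] =
      [ p∤a , p∤b ]′ (euclidsLemma a b pp (*-cancelʳ-∣ c {{c≢0}} (subst (_∣ a * b * c) (trans n≡cp (ℕ.*-comm c p)) n∣abc)))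
      where
      n∣abc : n ∣ a * b * c
      n∣abc = ∣m+n∣m⇒∣n
        (subst (n ∣_) (trans (sym (ℕ.*-assoc a b (t + c))) (assoc′ a b t c)) (∣n⇒∣m*n a n∣b[t+c]))
        (subst (n ∣_) (sym (assoc a b t)) (∣n⇒∣m*n b n∣at))
    f[t₀+c]≡0 : f (t₀ + c) ≡ 0ℚ
    f[t₀+c]≡0 with f (t₀ + c) ℚ.≟ 0ℚ
    ... | yes eq = eq
    ... | no neq = ⊥-elim (clash t₀ ft₀≢0 neq)
    exchange : ∀ a b c d → a -ℚ b -ℚ (c -ℚ d) ≡ a -ℚ c -ℚ (b -ℚ d)
    exchange = solve-∀ ℚ-ring
    -- Shifts commute, so for an earlier prime the witness `h` is replaced by its own difference by
    -- `c`. For `p` itself the old `f` is the witness.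
    difference′ : ∀ {q} → q < p ⊎ q ≡ p → Prime q → ∀ d → n ≡ d * q → IsDifference n d (λ t → f t -ℚ f (t + c))
    difference′ (inj₂ refl) _ d n≡dp with ℕ.*-cancelʳ-≡ d c p {{prime⇒nonZero pp}} (trans (sym n≡dp) n≡cp)
    ... | refl = f , periodic , λ _ → refl
    difference′ (inj₁ q<p) pq d n≡dq with difference q<p pq d n≡dq
    ... | h , h-per , f≡ = (λ t → h t -ℚ h (t + c)) ,
      (λ t → cong₂ _-ℚ_ (h-per t) (trans (cong h (shift-comm t n c)) (h-per (t + c)))) ,
      (λ t → trans (cong₂ _-ℚ_ (f≡ t) (f≡ (t + c))) (trans (exchange (h t) _ _ _)
        (cong (λ x → h t -ℚ h (t + c) -ℚ (h (t + d) -ℚ h x)) (shift-comm t c d))))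
    -- If `f t` vanishes, the witness for `t + c` is multiplied by `p`: the shift then contributes
    -- `a * (c * p)`, a multiple of n, and `p` is prime to the larger prime `q`.
    support′ : ∀ {q} → suc p ≤ q → Prime q → q ∣ n → ∀ t → f t -ℚ f (t + c) ≢ 0ℚ → ∃[ a ] q ∤ a × n ∣ a * t
    support′ {q} p<q pq q∣n t Df≢0 with f t ℚ.≟ 0ℚ
    ... | no ft≢0 = support (ℕ.<⇒≤ p<q) pq q∣n t ft≢0
    ... | yes ft≡0 with f (t + c) ℚ.≟ 0ℚ
    ...   | yes ft+c≡0 = contradiction (cong₂ _-ℚ_ ft≡0 ft+c≡0) Df≢0
    ...   | no ft+c≢0 with support (ℕ.<⇒≤ p<q) pq q∣n (t + c) ft+c≢0
    ...     | a , q∤a , n∣a[t+c] = a * p , [ q∤a , q∤p ]′ ∘ euclidsLemma a p pq ,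
      ∣m+n∣m⇒∣n (subst (n ∣_) (expand a t c p) (∣n⇒∣m*n p n∣a[t+c])) (subst (λ x → n ∣ a * x) n≡cp (n∣m*n a))
      where
      q∤p : q ∤ p
      q∤p q∣p = [ (λ { refl → ¬prime[1] pq }) , (λ { refl → ℕ.<-irrefl refl p<q }) ]′ (prime⇒irreducible pp q∣p)
      expand : ∀ a t c p → p * (a * (t + c)) ≡ a * (c * p) + a * p * t
      expand = ℕ-solve-∀

  sieve-skip : ∀ {m f} → Sieve m f → ¬ (Prime m × m ∣ n) → Sieve (suc m) f
  sieve-skip S ¬m = record
    { periodic   = periodic
    ; nonzero    = nonzero
    ; difference = λ q<sm pq c n≡cq → [ (λ q<m → difference q<m pq c n≡cq) ,
                     (λ { refl → contradiction (pq , divides c n≡cq) ¬m }) ]′ (ℕ.m≤n⇒m<n∨m≡n (s≤s⁻¹ q<sm))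
    ; support    = λ m<q → support (ℕ.<⇒≤ m<q)
    }
    where open Sieve S

  sieve : ∀ m → ∃[ f ] Sieve m f
  sieve zero = indicator , indicator-sieve
  sieve (suc m) with sieve m | prime? m | m ∣? n
  ... | f , S | yes pm | yes (divides c n≡cm) = (λ t → f t -ℚ f (t + c)) , sieve-step S pm c n≡cm
  ... | f , S | yes _  | no m∤n = f , sieve-skip S (m∤n ∘ proj₂)
  ... | f , S | no ¬pm | _      = f , sieve-skip S (¬pm ∘ proj₁)

  -- A progression of step `b` runs through a coset of the subgroup of ℤ/n generated by b, which is
  -- nontrivial since n ∤ b. It contains a subgroup of prime order p, generated by n/p, and `f` is a
  -- difference by n/p. With d = gcd(b, n), any prime p dividing n/d will do, and Bézout writes n/p
  -- = r d as a multiple of b modulo n.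
  sieve-balanced : ∀ {f} → Sieve (suc n) f → Balanced n f
  sieve-balanced {f} S = record { periodic = periodic ; balanced = balanced }
    where
    open Sieve S
    balanced : ∀ b t → n ∤ b → ∑ (upTo n) (λ k → f (t + k * b)) ≡ 0ℚ
    balanced b t n∤b with gcd[m,n]∣m b n | gcd[m,n]∣n b n | Bézout.identity (gcd-GCD b n)
    ... | d∣b | divides q n≡qd | bez = go (prime-factor q {{q≢0}} q≢1)
      where
      d = gcd b n
      q≢0 : NonZero q
      q≢0 = ℕ.m*n≢0⇒m≢0 q {{subst NonZero n≡qd (>-nonZero (>-nonZero⁻¹ n))}}
      q≢1 : q ≢ 1
      q≢1 refl = n∤b (subst (_∣ b) (sym (trans n≡qd (ℕ.*-identityˡ d))) d∣b)
      go : ∃[ p ] Prime p × p ∣ q → ∑ (upTo n) (λ k → f (t + k * b)) ≡ 0ℚ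
      go (p , pp , divides r q≡rp) = cases bez
        where
        swap-last : ∀ r p d → r * p * d ≡ r * d * p
        swap-last = ℕ-solve-∀
        n≡rdp : n ≡ r * d * p
        n≡rdp = trans n≡qd (trans (cong (_* d) q≡rp) (swap-last r p d))
        p≤n : p < suc n
        p≤n = s≤s (∣⇒≤ (divides (r * d) n≡rdp))
        diff : IsDifference n (r * d) f
        diff = difference p≤n pp (r * d) n≡rdp
        e₁ : ∀ r d y n → r * d + r * y * n ≡ r * (d + y * n)
        e₁ = ℕ-solve-∀
        e₂ : ∀ r x b n → r * (x * b) ≡ r * x * b + 0 * n
        e₂ = ℕ-solve-∀
        cases : Bézout.Identity d b n → ∑ (upTo n) (λ k → f (t + k * b)) ≡ 0ℚ
        cases (Bézout.+- x y eq) = difference⇒∑≡0 n b (r * d) (r * x) (r * y) 0 diff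
          (trans (e₁ r d y n) (trans (cong (r *_) eq) (e₂ r x b n))) t
        -- Here d ≡ -x b modulo n, and the coefficient -x is replaced by (n-1) x to stay in ℕ;
        -- `negative` exposes the predecessor of `n`.
        cases (Bézout.-+ x y eq) = negative n refl
          where
          negative : ∀ n′ → n ≡ n′ → ∑ (upTo n) (λ k → f (t + k * b)) ≡ 0ℚ
          negative zero    refl = refl
          negative (suc n′) refl = difference⇒∑≡0 n b (r * d) (r * n′ * x) (r * n′ * y) (r * d) diff
            (trans (cong (r * d +_) (trans (reassoc r n′ y (suc n′)) (cong (r * n′ *_) (sym eq)))) (e₃ r d n′ x b)) t
            where
            reassoc : ∀ r k y n → r * k * y * n ≡ r * k * (y * n)
            reassoc = ℕ-solve-∀
            e₃ : ∀ r d k x b → r * d + r * k * (d + x * b) ≡ r * k * x * b + r * d * suc k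
            e₃ = ℕ-solve-∀

  -- The sieve guarantees only some nonzero value; moving it to 0 and rescaling it to 1 preserves
  -- periodicity and balancedness.
  balanced-exists : ∃[ f ] Balanced n f × f 0 ≡ 1ℚ
  balanced-exists with sieve (suc n)
  ... | f , S = g , record { periodic = g-periodic ; balanced = g-balanced } , ℚ.*-inverseˡ (f t₀) {{nz}}
    where
    open Sieve S using (nonzero)
    open Balanced (sieve-balanced S)
    t₀ = proj₁ nonzero
    nz = ≢-nonZero (proj₂ nonzero)
    r = (1/ f t₀) {{nz}}
    g : ℕ → ℚ
    g t = r *ℚ f (t + t₀)
    shift-comm : ∀ a b c → a + b + c ≡ a + c + b
    shift-comm = ℕ-solve-∀
    g-periodic : ∀ t → g (t + n) ≡ g t
    g-periodic t = cong (r *ℚ_) (trans (cong f (shift-comm t n t₀)) (periodic (t + t₀)))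
    g-balanced : ∀ b t → n ∤ b → ∑ (upTo n) (λ k → g (t + k * b)) ≡ 0ℚ
    g-balanced b t n∤b = begin
      ∑ (upTo n) (λ k → g (t + k * b))                        ≡⟨ ∑-* (upTo n) r (λ k → f (t + k * b + t₀)) ⟩
      r *ℚ ∑ (upTo n) (λ k → f (t + k * b + t₀)) ≡⟨ cong (r *ℚ_) (∑-cong (upTo n) (λ k → cong f (shift-comm t (k * b) t₀))) ⟩
      r *ℚ ∑ (upTo n) (λ k → f (t + t₀ + k * b)) ≡⟨ cong (r *ℚ_) (balanced b (t + t₀) n∤b) ⟩
      r *ℚ 0ℚ                                  ≡⟨ ℚ.*-zeroʳ r ⟩
      0ℚ                                                      ∎

-- Evaluation of symmetric functions

allᵇ-tabulate : ∀ {k} (p : A → Bool) (h : Fin k → A) → allᵇ p (tabulate h) ≡ allᵇ (p ∘ h) (allFin k)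
allᵇ-tabulate {k = zero}  p h = refl
allᵇ-tabulate {k = suc k} p h = cong (p (h zero) ∧_)
  (trans (allᵇ-tabulate p (h ∘ suc)) (sym (allᵇ-tabulate (p ∘ h) suc)))

allᵇ-allFin-suc : ∀ {k} (p : Fin (suc k) → Bool) → allᵇ p (allFin (suc k)) ≡ p zero ∧ allᵇ (p ∘ suc) (allFin k)
allᵇ-allFin-suc p = cong (p zero ∧_) (allᵇ-tabulate p suc)

allᵇ-cong : ∀ (xs : List A) {p q : A → Bool} → (∀ x → p x ≡ q x) → allᵇ p xs ≡ allᵇ q xs
allᵇ-cong []       eq = refl
allᵇ-cong (x ∷ xs) eq = cong₂ _∧_ (eq x) (allᵇ-cong xs eq)

toBit : Bool → ℕ
toBit b = if b then 1 else 0

countᵇ-tabulate : ∀ {k} (p : A → Bool) (h : Fin k → A) → countᵇ p (tabulate h) ≡ countᵇ (p ∘ h) (allFin k)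
countᵇ-tabulate {k = zero}  p h = refl
countᵇ-tabulate {k = suc k} p h = cong (λ c → if p (h zero) then suc c else c)
  (trans (countᵇ-tabulate p (h ∘ suc)) (sym (countᵇ-tabulate (p ∘ h) suc)))

countᵇ-allFin-suc : ∀ {k} (p : Fin (suc k) → Bool) →
  countᵇ p (allFin (suc k)) ≡ toBit (p zero) + countᵇ (p ∘ suc) (allFin k)
countᵇ-allFin-suc p with p zero
... | true  = cong suc (countᵇ-tabulate p suc)
... | false = countᵇ-tabulate p suc

countᵇ-cong : ∀ (xs : List A) {p q : A → Bool} → (∀ x → p x ≡ q x) → countᵇ p xs ≡ countᵇ q xs
countᵇ-cong []       eq = refl
countᵇ-cong (x ∷ xs) eq = cong₂ (λ b c → if b then suc c else c) (eq x) (countᵇ-cong xs eq)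

size : ∀ {k} → (Fin k → ℕ) → ℕ
size {zero}  α = 0
size {suc k} α = α zero + size (α ∘ suc)

-- This is Σ i α_i with positions counted from 0, the exponent of ζ in the monomial x^α: removing
-- the first position lowers every index by one, which `size` makes up for.
moment : ∀ {k} → (Fin k → ℕ) → ℕ
moment {zero}  α = 0
moment {suc k} α = moment (α ∘ suc) + size (α ∘ suc)

size-cong : ∀ {k} {α β : Fin k → ℕ} → (∀ i → α i ≡ β i) → size α ≡ size β
size-cong {zero}  eq = refl
size-cong {suc k} eq = cong₂ _+_ (eq zero) (size-cong (eq ∘ suc))

moment-cong : ∀ {k} {α β : Fin k → ℕ} → (∀ i → α i ≡ β i) → moment α ≡ moment β
moment-cong {zero}  eq = refl
moment-cong {suc k} eq = cong₂ _+_ (moment-cong (eq ∘ suc)) (size-cong (eq ∘ suc))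

size-0 : ∀ k → size {k} (λ _ → 0) ≡ 0
size-0 zero    = refl
size-0 (suc k) = size-0 k

moment-0 : ∀ k → moment {k} (λ _ → 0) ≡ 0
moment-0 zero    = refl
moment-0 (suc k) = cong₂ _+_ (moment-0 k) (size-0 k)

private
  interchange : ∀ a b c d → a + b + (c + d) ≡ a + c + (b + d)
  interchange = ℕ-solve-∀

size-+ : ∀ {k} (α β : Fin k → ℕ) → size (λ i → α i + β i) ≡ size α + size β
size-+ {zero}  α β = refl
size-+ {suc k} α β = trans (cong (α zero + β zero +_) (size-+ (α ∘ suc) (β ∘ suc)))
  (interchange (α zero) (β zero) _ _)

moment-+ : ∀ {k} (α β : Fin k → ℕ) → moment (λ i → α i + β i) ≡ moment α + moment β
moment-+ {zero}  α β = refl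
moment-+ {suc k} α β = trans (cong₂ _+_ (moment-+ (α ∘ suc) (β ∘ suc)) (size-+ (α ∘ suc) (β ∘ suc)))
  (interchange (moment (α ∘ suc)) (moment (β ∘ suc)) _ _)

size-δ : ∀ {k} (c : Fin k) → size (λ i → toBit (finEqᵇ c i)) ≡ 1
size-δ {suc k} zero    = cong suc (size-0 k)
size-δ {suc k} (suc c) = trans (size-cong (λ i → cong toBit (finEqᵇ-suc c i))) (size-δ c)

moment-δ : ∀ {k} (c : Fin k) → moment (λ i → toBit (finEqᵇ c i)) ≡ toℕ c
moment-δ {suc k} zero    = cong₂ _+_ (moment-0 k) (size-0 k)
moment-δ {suc k} (suc c) = trans
  (cong₂ _+_ (trans (moment-cong (λ i → cong toBit (finEqᵇ-suc c i))) (moment-δ c))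
             (trans (size-cong (λ i → cong toBit (finEqᵇ-suc c i))) (size-δ c)))
  (ℕ.+-comm (toℕ c) 1)

entry≤size : ∀ {k} (α : Fin k → ℕ) i → α i ≤ size α
entry≤size α zero    = ℕ.m≤m+n (α zero) _
entry≤size α (suc i) = ℕ.≤-trans (entry≤size (α ∘ suc) i) (ℕ.m≤n+m _ (α zero))

size-bits : ∀ {k} (p : Fin k → Bool) → size (toBit ∘ p) ≡ countᵇ p (allFin k)
size-bits {zero}  p = refl
size-bits {suc k} p = trans (cong (toBit (p zero) +_) (size-bits (p ∘ suc))) (sym (countᵇ-allFin-suc p))

∑-upTo-δ : ∀ n c (g : ℕ → ℚ) → c < n → ∑ (upTo n) (λ x → ⟦ c ≡ᵇ x ⟧ *ℚ g x) ≡ g c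
∑-upTo-δ (suc n) zero g _ = begin
  ∑ (upTo (suc n)) (λ x → ⟦ 0 ≡ᵇ x ⟧ *ℚ g x)      ≡⟨ ∑-upTo-suc n (λ x → ⟦ 0 ≡ᵇ x ⟧ *ℚ g x) ⟩
  1ℚ *ℚ g 0 +ℚ ∑ (upTo n) (λ x → 0ℚ *ℚ g (suc x)) ≡⟨ cong₂ _+ℚ_ (ℚ.*-identityˡ (g 0)) (∑-zero (upTo n) (λ x → ℚ.*-zeroˡ (g (suc x)))) ⟩
  g 0 +ℚ 0ℚ                                       ≡⟨ ℚ.+-identityʳ (g 0) ⟩
  g 0                                             ∎
∑-upTo-δ (suc n) (suc c) g (s≤s c<n) = begin
  ∑ (upTo (suc n)) (λ x → ⟦ suc c ≡ᵇ x ⟧ *ℚ g x)  ≡⟨ ∑-upTo-suc n (λ x → ⟦ suc c ≡ᵇ x ⟧ *ℚ g x) ⟩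
  0ℚ *ℚ g 0 +ℚ ∑ (upTo n) (λ x → ⟦ c ≡ᵇ x ⟧ *ℚ g (suc x)) ≡⟨ cong₂ _+ℚ_ (ℚ.*-zeroˡ (g 0)) (∑-upTo-δ n c (g ∘ suc) c<n) ⟩
  0ℚ +ℚ g (suc c)                                 ≡⟨ ℚ.+-identityˡ (g (suc c)) ⟩
  g (suc c)                                       ∎

∑-upTo-δ-out : ∀ n c (g : ℕ → ℚ) → n ≤ c → ∑ (upTo n) (λ x → ⟦ c ≡ᵇ x ⟧ *ℚ g x) ≡ 0ℚ
∑-upTo-δ-out zero    c       g _         = refl
∑-upTo-δ-out (suc n) (suc c) g (s≤s n≤c) = begin
  ∑ (upTo (suc n)) (λ x → ⟦ suc c ≡ᵇ x ⟧ *ℚ g x)  ≡⟨ ∑-upTo-suc n (λ x → ⟦ suc c ≡ᵇ x ⟧ *ℚ g x) ⟩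
  0ℚ *ℚ g 0 +ℚ ∑ (upTo n) (λ x → ⟦ c ≡ᵇ x ⟧ *ℚ g (suc x)) ≡⟨ cong₂ _+ℚ_ (ℚ.*-zeroˡ (g 0)) (∑-upTo-δ-out n c (g ∘ suc) n≤c) ⟩
  0ℚ +ℚ 0ℚ                                        ≡⟨ ℚ.+-identityˡ 0ℚ ⟩
  0ℚ                                              ∎

-- Exponent vectors and colourings are functions known to agree only pointwise, so summands have to
-- be shown to respect this.
Extensional : ∀ {k} → ((Fin k → A) → ℚ) → Set
Extensional g = ∀ {α β} → (∀ i → α i ≡ β i) → g α ≡ g β

∷-cong : ∀ {k} (x : A) {α β : Fin k → A} → (∀ i → α i ≡ β i) → ∀ i → (x ∷ᶠ α) i ≡ (x ∷ᶠ β) i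
∷-cong x eq zero    = refl
∷-cong x eq (suc i) = eq i

-- If `c` leaves the box of exponents up to `N`, no summand survives, but then `w c` vanishes as
-- well by the last hypothesis.
∑-pick : ∀ N {k} (c : Fin k → ℕ) (w : (Fin k → ℕ) → ℚ) → Extensional w →
  (∀ α i → N < α i → w α ≡ 0ℚ) →
  ∑ (allFunsOver (upTo (suc N)) k) (λ α → ⟦ allᵇ (λ i → c i ≡ᵇ α i) (allFin k) ⟧ *ℚ w α) ≡ w c
∑-pick N {zero} c w w-ext w-out = trans (ℚ.+-identityʳ (1ℚ *ℚ w (λ ())))
  (trans (ℚ.*-identityˡ (w (λ ()))) (w-ext (λ ())))
∑-pick N {suc k} c w w-ext w-out = begin
  ∑ (allFunsOver (upTo (suc N)) (suc k)) (λ α → ⟦ allᵇ (λ i → c i ≡ᵇ α i) (allFin (suc k)) ⟧ *ℚ w α)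
    ≡⟨ ∑-allFunsOver-suc (upTo (suc N)) k (λ α → ⟦ allᵇ (λ i → c i ≡ᵇ α i) (allFin (suc k)) ⟧ *ℚ w α) ⟩
  ∑ Fs (λ α → ∑ (upTo (suc N)) (λ x → ⟦ allᵇ (λ i → c i ≡ᵇ (x ∷ᶠ α) i) (allFin (suc k)) ⟧ *ℚ w (x ∷ᶠ α)))
    ≡⟨ ∑-cong Fs (λ α → ∑-cong (upTo (suc N)) (λ x → trans
         (cong (_*ℚ w (x ∷ᶠ α)) (trans (cong ⟦_⟧ (allᵇ-allFin-suc (λ i → c i ≡ᵇ (x ∷ᶠ α) i))) (⟦⟧-∧ (c zero ≡ᵇ x) (rest α))))
         (regroup ⟦ c zero ≡ᵇ x ⟧ ⟦ rest α ⟧ (w (x ∷ᶠ α))))) ⟩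
  ∑ Fs (λ α → ∑ (upTo (suc N)) (λ x → ⟦ rest α ⟧ *ℚ (⟦ c zero ≡ᵇ x ⟧ *ℚ w (x ∷ᶠ α))))
    ≡⟨ ∑-cong Fs (λ α → trans (∑-* (upTo (suc N)) ⟦ rest α ⟧ (λ x → ⟦ c zero ≡ᵇ x ⟧ *ℚ w (x ∷ᶠ α)))
                              (cong (⟦ rest α ⟧ *ℚ_) (head α))) ⟩
  ∑ Fs (λ α → ⟦ rest α ⟧ *ℚ w (c zero ∷ᶠ α))
    ≡⟨ ∑-pick N (c ∘ suc) (λ α → w (c zero ∷ᶠ α)) (λ eq → w-ext (∷-cong (c zero) eq)) (λ α i → w-out (c zero ∷ᶠ α) (suc i)) ⟩
  w (c zero ∷ᶠ (c ∘ suc))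
    ≡⟨ w-ext (λ { zero → refl ; (suc i) → refl }) ⟩
  w c ∎
  where
  Fs = allFunsOver (upTo (suc N)) k
  rest : (Fin k → ℕ) → Bool
  rest α = allᵇ (λ i → c (suc i) ≡ᵇ α i) (allFin k)
  regroup : ∀ a b c → a *ℚ b *ℚ c ≡ b *ℚ (a *ℚ c)
  regroup = solve-∀ ℚ-ring
  head : ∀ α → ∑ (upTo (suc N)) (λ x → ⟦ c zero ≡ᵇ x ⟧ *ℚ w (x ∷ᶠ α)) ≡ w (c zero ∷ᶠ α)
  head α with c zero ≤? N
  ... | yes c≤N = ∑-upTo-δ (suc N) (c zero) (λ x → w (x ∷ᶠ α)) (s≤s c≤N)
  ... | no c≰N  = trans (∑-upTo-δ-out (suc N) (c zero) (λ x → w (x ∷ᶠ α)) (ℕ.≰⇒> c≰N))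
                        (sym (w-out (c zero ∷ᶠ α) zero (ℕ.≰⇒> c≰N)))

-- The degree-N part of a symmetric function evaluated at x_j = ζ^{j-1}, 1 ≤ j ≤ k, where f
-- replaces the powers of ζ.
module Evaluation (f : ℕ → ℚ) (N k : ℕ) where

  evalMonomial : (Fin k → ℕ) → ℚ
  evalMonomial α = ⟦ size α ≡ᵇ N ⟧ *ℚ f (moment α)

  -- A monomial of degree `N` has no exponent above `N`, so the finite box contains all that
  -- `evalMonomial` does not kill.
  eval : SymFun → ℚ
  eval F = ∑ (allFunsOver (upTo (suc N)) k) (λ α → F k α *ℚ evalMonomial α)

  eval-cong : ∀ {F F′ : SymFun} → (∀ α → F k α ≡ F′ k α) → eval F ≡ eval F′
  eval-cong eq = ∑-cong (allFunsOver (upTo (suc N)) k) (λ α → cong (_*ℚ evalMonomial α) (eq α))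

  evalMonomial-ext : Extensional evalMonomial
  evalMonomial-ext eq = cong₂ (λ a b → ⟦ a ≡ᵇ N ⟧ *ℚ f b) (size-cong eq) (moment-cong eq)

  evalMonomial-out : ∀ α i → N < α i → evalMonomial α ≡ 0ℚ
  evalMonomial-out α i N<αi with size α ≡ᵇ N in eq
  ... | false = ℚ.*-zeroˡ (f (moment α))
  ... | true  = contradiction (entry≤size α i)
    (ℕ.<⇒≱ (subst (_< α i) (sym (ℕ.≡ᵇ⇒≡ (size α) N (subst T (sym eq) _))) N<αi))

  -- The coefficients of `chromatic` and of `eBasis` both count objects of prescribed content,
  -- colourings in one case and 0-1 matrices in the other. The evaluation is then a sum over the
  -- objects themselves.
  eval-count : ∀ (xs : List A) (p : A → Bool) (c : A → Fin k → ℕ) →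
    ∑ (allFunsOver (upTo (suc N)) k)
      (λ α → fromℕℚ (countᵇ (λ x → p x ∧ allᵇ (λ i → c x i ≡ᵇ α i) (allFin k)) xs) *ℚ evalMonomial α)
    ≡ ∑ xs (λ x → ⟦ p x ⟧ *ℚ evalMonomial (c x))
  eval-count xs p c = begin
    ∑ αs (λ α → fromℕℚ (countᵇ (λ x → p x ∧ q x α) xs) *ℚ evalMonomial α)
      ≡⟨ ∑-cong αs (λ α → trans (cong (_*ℚ evalMonomial α) (countᵇ-∑ (λ x → p x ∧ q x α) xs))
           (sym (∑-*ʳ xs (λ x → ⟦ p x ∧ q x α ⟧) (evalMonomial α)))) ⟩
    ∑ αs (λ α → ∑ xs (λ x → ⟦ p x ∧ q x α ⟧ *ℚ evalMonomial α))
      ≡⟨ ∑-swap αs xs (λ α x → ⟦ p x ∧ q x α ⟧ *ℚ evalMonomial α) ⟩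
    ∑ xs (λ x → ∑ αs (λ α → ⟦ p x ∧ q x α ⟧ *ℚ evalMonomial α))
      ≡⟨ ∑-cong xs (λ x → trans (∑-cong αs (λ α → trans (cong (_*ℚ evalMonomial α) (⟦⟧-∧ (p x) (q x α))) (ℚ.*-assoc ⟦ p x ⟧ ⟦ q x α ⟧ (evalMonomial α))))
           (∑-* αs ⟦ p x ⟧ (λ α → ⟦ q x α ⟧ *ℚ evalMonomial α))) ⟩
    ∑ xs (λ x → ⟦ p x ⟧ *ℚ ∑ αs (λ α → ⟦ q x α ⟧ *ℚ evalMonomial α))
      ≡⟨ ∑-cong xs (λ x → cong (⟦ p x ⟧ *ℚ_) (∑-pick N (c x) evalMonomial evalMonomial-ext evalMonomial-out)) ⟩
    ∑ xs (λ x → ⟦ p x ⟧ *ℚ evalMonomial (c x)) ∎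
    where
    αs = allFunsOver (upTo (suc N)) k
    q = λ x α → allᵇ (λ i → c x i ≡ᵇ α i) (allFin k)

-- Evaluation of e_λ by 0-1 matrices

bits : List Bool
bits = false ∷ true ∷ []

-- A row with `b` ones is a monomial of e_b. Splitting off its first entry reproduces the recursion
-- of `e`: re-indexing the other columns costs one factor ζ for each remaining one, hence the shift
-- by `b` or by `b - 1`.
∑-bits : ∀ (f : ℕ → ℚ) k b t →
  ∑ (allFunsOver bits k) (λ row → ⟦ countᵇ row (allFin k) ≡ᵇ b ⟧ *ℚ f (t + moment (toBit ∘ row))) ≡ e f k b t
∑-bits f zero zero t = trans (ℚ.+-identityʳ (1ℚ *ℚ f (t + 0))) (trans (ℚ.*-identityˡ (f (t + 0))) (cong f (ℕ.+-identityʳ t)))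
∑-bits f zero (suc b) t = trans (ℚ.+-identityʳ (0ℚ *ℚ f (t + 0))) (ℚ.*-zeroˡ (f (t + 0)))
∑-bits f (suc k) b t = begin
  ∑ (allFunsOver bits (suc k)) (λ row → ⟦ countᵇ row (allFin (suc k)) ≡ᵇ b ⟧ *ℚ f (t + moment (toBit ∘ row)))
    ≡⟨ ∑-allFunsOver-suc bits k (λ row → ⟦ countᵇ row (allFin (suc k)) ≡ᵇ b ⟧ *ℚ f (t + moment (toBit ∘ row))) ⟩
  ∑ rows (λ row → term false row +ℚ (term true row +ℚ 0ℚ))
    ≡⟨ ∑-cong rows (λ row → cong (term false row +ℚ_) (ℚ.+-identityʳ (term true row))) ⟩
  ∑ rows (λ row → term false row +ℚ term true row)
    ≡⟨ ∑-+ rows (term false) (term true) ⟩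
  ∑ rows (term false) +ℚ ∑ rows (term true)
    ≡⟨ cong (_+ℚ ∑ rows (term true)) (shifted {false} b (λ row → cong (_≡ᵇ b) (countᵇ-allFin-suc (false ∷ᶠ row)))) ⟩
  e f k b (t + b) +ℚ ∑ rows (term true)
    ≡⟨ second b refl ⟩
  e f (suc k) b t ∎
  where
  rows = allFunsOver bits k
  term : Bool → (Fin k → Bool) → ℚ
  term c row = ⟦ countᵇ (c ∷ᶠ row) (allFin (suc k)) ≡ᵇ b ⟧ *ℚ f (t + (moment (toBit ∘ row) + size (toBit ∘ row)))
  shifted : ∀ {c} b′ → (∀ row → (countᵇ (c ∷ᶠ row) (allFin (suc k)) ≡ᵇ b) ≡ (countᵇ row (allFin k) ≡ᵇ b′)) →
    ∑ rows (term c) ≡ e f k b′ (t + b′)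
  shifted {c} b′ eq = trans (∑-cong rows each) (∑-bits f k b′ (t + b′))
    where
    shift : ∀ t m s → t + (m + s) ≡ t + s + m
    shift = ℕ-solve-∀
    each : ∀ row → term c row ≡ ⟦ countᵇ row (allFin k) ≡ᵇ b′ ⟧ *ℚ f (t + b′ + moment (toBit ∘ row))
    each row rewrite eq row with countᵇ row (allFin k) ≡ᵇ b′ in count
    ... | false = trans (ℚ.*-zeroˡ (f (t + (moment (toBit ∘ row) + size (toBit ∘ row))))) (sym (ℚ.*-zeroˡ (f (t + b′ + moment (toBit ∘ row)))))
    ... | true  = cong (λ x → 1ℚ *ℚ f x) (trans (shift t (moment (toBit ∘ row)) (size (toBit ∘ row)))
      (cong (λ s → t + s + moment (toBit ∘ row)) (trans (size-bits row) (ℕ.≡ᵇ⇒≡ _ b′ (subst T (sym count) _)))))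
  second : ∀ b′ → b ≡ b′ → e f k b′ (t + b′) +ℚ ∑ rows (term true) ≡ e f (suc k) b′ t
  second zero refl = trans (cong₂ _+ℚ_ (cong (e f k 0) (ℕ.+-identityʳ t))
      (∑-zero rows (λ row → trans (cong (λ c → ⟦ c ≡ᵇ 0 ⟧ *ℚ f (t + (moment (toBit ∘ row) + size (toBit ∘ row)))) (countᵇ-allFin-suc (true ∷ᶠ row)))
        (ℚ.*-zeroˡ (f (t + (moment (toBit ∘ row) + size (toBit ∘ row))))))))
    (ℚ.+-identityʳ (e f k 0 t))
  second (suc b′) refl = cong (e f k (suc b′) (t + suc b′) +ℚ_)
    (shifted {true} b′ (λ row → cong (_≡ᵇ suc b′) (countᵇ-allFin-suc (true ∷ᶠ row))))

module _ {m : ℕ} {f : ℕ → ℚ} (B : Balanced (suc m) f) (N : ℕ) where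
  private n = suc m
  open Evaluation f N n

  coefficient : ℕ → ℚ
  coefficient b = proj₁ (e-eval B b)

  coefficients : List ℕ → ℚ
  coefficients = foldr (λ b → coefficient b *ℚ_) 1ℚ

  columns : ∀ {l} → (Fin l → Fin n → Bool) → Fin n → ℕ
  columns {l} M i = countᵇ (λ r → M r i) (allFin l)

  columns-∷ : ∀ {l} row (M : Fin l → Fin n → Bool) i → columns (row ∷ᶠ M) i ≡ toBit (row i) + columns M i
  columns-∷ row M i = countᵇ-allFin-suc (λ r → (row ∷ᶠ M) r i)

  rowsᵇ : ∀ λs → (Fin (length λs) → Fin n → Bool) → Bool
  rowsᵇ λs M = allᵇ (λ r → countᵇ (M r) (allFin n) ≡ᵇ lookup λs r) (allFin (length λs))

  -- `a` and `t` record the degree and the exponent contributed by the rows already removed. The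
  -- lower rows are summed first, with the top row only shifting the exponent; they leave a scalar
  -- times `f`, to which `∑-bits` and `e-eval` apply once more.
  ∑-matrices : ∀ λs a t →
    ∑ (allFunsOver (allFunsOver bits n) (length λs))
      (λ M → ⟦ rowsᵇ λs M ⟧ *ℚ (⟦ a + size (columns M) ≡ᵇ N ⟧ *ℚ f (t + moment (columns M))))
    ≡ ⟦ a + sum λs ≡ᵇ N ⟧ *ℚ (coefficients λs *ℚ f t)
  ∑-matrices [] a t = begin
    1ℚ *ℚ (⟦ a + size {n} (λ _ → 0) ≡ᵇ N ⟧ *ℚ f (t + moment {n} (λ _ → 0))) +ℚ 0ℚ
      ≡⟨ cong₂ (λ x y → 1ℚ *ℚ (⟦ a + x ≡ᵇ N ⟧ *ℚ f y) +ℚ 0ℚ) (size-0 n) (trans (cong (t +_) (moment-0 n)) (ℕ.+-identityʳ t)) ⟩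
    1ℚ *ℚ (⟦ a + 0 ≡ᵇ N ⟧ *ℚ f t) +ℚ 0ℚ
      ≡⟨ tidy ⟦ a + 0 ≡ᵇ N ⟧ (f t) ⟩
    ⟦ a + 0 ≡ᵇ N ⟧ *ℚ (1ℚ *ℚ f t) ∎
    where
    tidy : ∀ x y → 1ℚ *ℚ (x *ℚ y) +ℚ 0ℚ ≡ x *ℚ (1ℚ *ℚ y)
    tidy = solve-∀ ℚ-ring
  ∑-matrices (b ∷ λs) a t = begin
    ∑ (allFunsOver rows (suc (length λs))) summand
      ≡⟨ ∑-allFunsOver-suc rows (length λs) summand ⟩
    ∑ Ms (λ M → ∑ rows (λ row → summand (row ∷ᶠ M)))
      ≡⟨ ∑-swap Ms rows (λ M row → summand (row ∷ᶠ M)) ⟩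
    ∑ rows (λ row → ∑ Ms (λ M → summand (row ∷ᶠ M)))
      ≡⟨ ∑-cong rows (λ row → trans (∑-cong Ms (split row))
           (∑-* Ms ⟦ countᵇ row (allFin n) ≡ᵇ b ⟧ (λ M → ⟦ rowsᵇ λs M ⟧ *ℚ (⟦ a + b + size (columns M) ≡ᵇ N ⟧ *ℚ f (t + moment (toBit ∘ row) + moment (columns M)))))) ⟩
    ∑ rows (λ row → ⟦ countᵇ row (allFin n) ≡ᵇ b ⟧ *ℚ
      ∑ Ms (λ M → ⟦ rowsᵇ λs M ⟧ *ℚ (⟦ a + b + size (columns M) ≡ᵇ N ⟧ *ℚ f (t + moment (toBit ∘ row) + moment (columns M)))))
      ≡⟨ ∑-cong rows (λ row → cong (⟦ countᵇ row (allFin n) ≡ᵇ b ⟧ *ℚ_) (∑-matrices λs (a + b) (t + moment (toBit ∘ row)))) ⟩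
    ∑ rows (λ row → ⟦ countᵇ row (allFin n) ≡ᵇ b ⟧ *ℚ (D *ℚ (C *ℚ f (t + moment (toBit ∘ row)))))
      ≡⟨ ∑-cong rows (λ row → regroup ⟦ countᵇ row (allFin n) ≡ᵇ b ⟧ D C (f (t + moment (toBit ∘ row)))) ⟩
    ∑ rows (λ row → D *ℚ C *ℚ (⟦ countᵇ row (allFin n) ≡ᵇ b ⟧ *ℚ f (t + moment (toBit ∘ row))))
      ≡⟨ ∑-* rows (D *ℚ C) (λ row → ⟦ countᵇ row (allFin n) ≡ᵇ b ⟧ *ℚ f (t + moment (toBit ∘ row))) ⟩
    D *ℚ C *ℚ ∑ rows (λ row → ⟦ countᵇ row (allFin n) ≡ᵇ b ⟧ *ℚ f (t + moment (toBit ∘ row)))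
      ≡⟨ cong (D *ℚ C *ℚ_) (trans (∑-bits f n b t) (proj₁ (proj₂ (e-eval B b)) t)) ⟩
    D *ℚ C *ℚ (coefficient b *ℚ f t)
      ≡⟨ collect D C (coefficient b) (f t) ⟩
    D *ℚ (coefficient b *ℚ C *ℚ f t)
      ≡⟨ cong (λ x → ⟦ x ≡ᵇ N ⟧ *ℚ (coefficient b *ℚ C *ℚ f t)) (ℕ.+-assoc a b (sum λs)) ⟩
    ⟦ a + (b + sum λs) ≡ᵇ N ⟧ *ℚ (coefficient b *ℚ C *ℚ f t) ∎
    where
    rows = allFunsOver bits n
    Ms = allFunsOver rows (length λs)
    D = ⟦ a + b + sum λs ≡ᵇ N ⟧
    C = coefficients λs
    summand : (Fin (suc (length λs)) → Fin n → Bool) → ℚ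
    summand M = ⟦ rowsᵇ (b ∷ λs) M ⟧ *ℚ (⟦ a + size (columns M) ≡ᵇ N ⟧ *ℚ f (t + moment (columns M)))
    regroup : ∀ x d c y → x *ℚ (d *ℚ (c *ℚ y)) ≡ d *ℚ c *ℚ (x *ℚ y)
    regroup = solve-∀ ℚ-ring
    collect : ∀ d c x y → d *ℚ c *ℚ (x *ℚ y) ≡ d *ℚ (x *ℚ c *ℚ y)
    collect = solve-∀ ℚ-ring
    split : ∀ row M → summand (row ∷ᶠ M) ≡ ⟦ countᵇ row (allFin n) ≡ᵇ b ⟧ *ℚ
      (⟦ rowsᵇ λs M ⟧ *ℚ (⟦ a + b + size (columns M) ≡ᵇ N ⟧ *ℚ f (t + moment (toBit ∘ row) + moment (columns M))))
    split row M = begin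
      summand (row ∷ᶠ M)
        ≡⟨ cong₂ _*ℚ_ (trans (cong ⟦_⟧ (allᵇ-allFin-suc (λ r → countᵇ ((row ∷ᶠ M) r) (allFin n) ≡ᵇ lookup (b ∷ λs) r)))
                             (⟦⟧-∧ (countᵇ row (allFin n) ≡ᵇ b) (rowsᵇ λs M)))
             (cong₂ (λ x y → ⟦ a + x ≡ᵇ N ⟧ *ℚ f (t + y))
               (trans (size-cong (columns-∷ row M)) (size-+ (toBit ∘ row) (columns M)))
               (trans (moment-cong (columns-∷ row M)) (moment-+ (toBit ∘ row) (columns M)))) ⟩
      ⟦ countᵇ row (allFin n) ≡ᵇ b ⟧ *ℚ ⟦ rowsᵇ λs M ⟧ *ℚ
        (⟦ a + (size (toBit ∘ row) + size (columns M)) ≡ᵇ N ⟧ *ℚ f (t + (moment (toBit ∘ row) + moment (columns M))))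
        ≡⟨ cong₂ (λ x y → ⟦ countᵇ row (allFin n) ≡ᵇ b ⟧ *ℚ ⟦ rowsᵇ λs M ⟧ *ℚ (⟦ a + (x + size (columns M)) ≡ᵇ N ⟧ *ℚ f y))
             (size-bits row) (sym (ℕ.+-assoc t (moment (toBit ∘ row)) (moment (columns M)))) ⟩
      ⟦ countᵇ row (allFin n) ≡ᵇ b ⟧ *ℚ ⟦ rowsᵇ λs M ⟧ *ℚ
        (⟦ a + (countᵇ row (allFin n) + size (columns M)) ≡ᵇ N ⟧ *ℚ f (t + moment (toBit ∘ row) + moment (columns M)))
        ≡⟨ fix ⟩
      ⟦ countᵇ row (allFin n) ≡ᵇ b ⟧ *ℚ
      (⟦ rowsᵇ λs M ⟧ *ℚ (⟦ a + b + size (columns M) ≡ᵇ N ⟧ *ℚ f (t + moment (toBit ∘ row) + moment (columns M)))) ∎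
      where
      zero² : ∀ x y z → 0ℚ *ℚ x *ℚ y ≡ 0ℚ *ℚ z
      zero² = solve-∀ ℚ-ring
      -- The number of ones in the row may be replaced by `b`, since the indicator kills all other
      -- rows.
      fix : ⟦ countᵇ row (allFin n) ≡ᵇ b ⟧ *ℚ ⟦ rowsᵇ λs M ⟧ *ℚ
          (⟦ a + (countᵇ row (allFin n) + size (columns M)) ≡ᵇ N ⟧ *ℚ f (t + moment (toBit ∘ row) + moment (columns M)))
        ≡ ⟦ countᵇ row (allFin n) ≡ᵇ b ⟧ *ℚ
          (⟦ rowsᵇ λs M ⟧ *ℚ (⟦ a + b + size (columns M) ≡ᵇ N ⟧ *ℚ f (t + moment (toBit ∘ row) + moment (columns M))))
      fix with countᵇ row (allFin n) ≡ᵇ b in eq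
      ... | false = zero² ⟦ rowsᵇ λs M ⟧ _ (⟦ rowsᵇ λs M ⟧ *ℚ (⟦ a + b + size (columns M) ≡ᵇ N ⟧ *ℚ f (t + moment (toBit ∘ row) + moment (columns M))))
      ... | true  = trans
        (cong (λ x → 1ℚ *ℚ ⟦ rowsᵇ λs M ⟧ *ℚ (⟦ x ≡ᵇ N ⟧ *ℚ f (t + moment (toBit ∘ row) + moment (columns M))))
          (trans (cong (λ x → a + (x + size (columns M))) (ℕ.≡ᵇ⇒≡ (countᵇ row (allFin n)) b (subst T (sym eq) _))) (sym (ℕ.+-assoc a b (size (columns M))))))
        (ℚ.*-assoc 1ℚ ⟦ rowsᵇ λs M ⟧ (⟦ a + b + size (columns M) ≡ᵇ N ⟧ *ℚ f (t + moment (toBit ∘ row) + moment (columns M))))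

  eval-eBasis : ∀ λs → eval (eBasis λs) ≡ ⟦ sum λs ≡ᵇ N ⟧ *ℚ (coefficients λs *ℚ f 0)
  eval-eBasis λs = trans (eval-count (allFunsOver (allFunsOver bits n) (length λs)) (rowsᵇ λs) columns) (∑-matrices λs 0 0)

-- Evaluation of the chromatic symmetric function

fibres : ∀ {N k} → (Fin N → Fin k) → Fin k → ℕ
fibres {N} κ i = countᵇ (λ v → finEqᵇ (κ v) i) (allFin N)

fibres-suc : ∀ {N k} (κ : Fin (suc N) → Fin k) i → fibres κ i ≡ toBit (finEqᵇ (κ zero) i) + fibres (κ ∘ suc) i
fibres-suc κ i = countᵇ-allFin-suc (λ v → finEqᵇ (κ v) i)

size-fibres : ∀ {N k} (κ : Fin N → Fin k) → size (fibres κ) ≡ N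
size-fibres {zero}  {k} κ = size-0 k
size-fibres {suc N}     κ = trans (size-cong (fibres-suc κ))
  (trans (size-+ (λ i → toBit (finEqᵇ (κ zero) i)) (fibres (κ ∘ suc))) (cong₂ _+_ (size-δ (κ zero)) (size-fibres (κ ∘ suc))))

moment-fibres : ∀ {N k} (κ : Fin N → Fin k) → moment (fibres κ) ≡ weight κ
moment-fibres {zero}  {k} κ = moment-0 k
moment-fibres {suc N}     κ = trans (moment-cong (fibres-suc κ))
  (trans (moment-+ (λ i → toBit (finEqᵇ (κ zero) i)) (fibres (κ ∘ suc))) (cong₂ _+_ (moment-δ (κ zero)) (moment-fibres (κ ∘ suc))))

≡ᵇ-refl : ∀ n → (n ≡ᵇ n) ≡ true
≡ᵇ-refl zero    = refl
≡ᵇ-refl (suc n) = ≡ᵇ-refl n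

eval-chromatic : ∀ (f : ℕ → ℚ) {N} (G : Graph N) k →
  Evaluation.eval f N k (chromatic G) ≡ ∑ (allFunsOver (allFin k) N) (λ κ → ⟦ Properᵇ G κ ⟧ *ℚ f (weight κ))
eval-chromatic f {N} G k = trans (eval-count (allFunsOver (allFin k) N) (Properᵇ G) fibres)
  (∑-cong (allFunsOver (allFin k) N) (λ κ → cong (⟦ Properᵇ G κ ⟧ *ℚ_)
    (trans (cong₂ (λ x y → ⟦ x ⟧ *ℚ f y) (trans (cong (_≡ᵇ N) (size-fibres κ)) (≡ᵇ-refl N)) (moment-fibres κ))
           (ℚ.*-identityˡ (f (weight κ))))))
  where open Evaluation f N k

++-suc : ∀ {m k} (α : Fin (suc m) → A) (β : Fin k → A) i → ((α ∘ suc) ++ᶠ β) i ≡ (α ++ᶠ β) (suc i)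
++-suc {m = m} α β i with splitAt m i
... | inj₁ _ = refl
... | inj₂ _ = refl

++-∷ : ∀ {m k} (c : A) (α : Fin m → A) (β : Fin k → A) i → (c ∷ᶠ (α ++ᶠ β)) i ≡ ((c ∷ᶠ α) ++ᶠ β) i
++-∷ c α β zero    = refl
++-∷ c α β (suc i) = ++-suc (c ∷ᶠ α) β i

∑-allFunsOver-++ : ∀ (xs : List A) m k (g : (Fin (m + k) → A) → ℚ) → Extensional g →
  ∑ (allFunsOver xs (m + k)) g ≡ ∑ (allFunsOver xs k) (λ β → ∑ (allFunsOver xs m) (λ α → g (α ++ᶠ β)))
∑-allFunsOver-++ xs zero    k g g-ext = ∑-cong (allFunsOver xs k) (λ β → sym (ℚ.+-identityʳ (g β)))
∑-allFunsOver-++ xs (suc m) k g g-ext = begin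
  ∑ (allFunsOver xs (suc m + k)) g
    ≡⟨ ∑-allFunsOver-suc xs (m + k) g ⟩
  ∑ (allFunsOver xs (m + k)) (λ γ → ∑ xs (λ c → g (c ∷ᶠ γ)))
    ≡⟨ ∑-allFunsOver-++ xs m k (λ γ → ∑ xs (λ c → g (c ∷ᶠ γ))) (λ eq → ∑-cong xs (λ c → g-ext (∷-cong c eq))) ⟩
  ∑ (allFunsOver xs k) (λ β → ∑ (allFunsOver xs m) (λ α → ∑ xs (λ c → g (c ∷ᶠ (α ++ᶠ β)))))
    ≡⟨ ∑-cong (allFunsOver xs k) (λ β → trans
         (∑-cong (allFunsOver xs m) (λ α → ∑-cong xs (λ c → g-ext (++-∷ c α β))))
         (sym (∑-allFunsOver-suc xs m (λ α → g (α ++ᶠ β))))) ⟩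
  ∑ (allFunsOver xs k) (λ β → ∑ (allFunsOver xs (suc m)) (λ α → g (α ++ᶠ β))) ∎

weight-cong : ∀ {m k} {α β : Fin m → Fin k} → (∀ i → α i ≡ β i) → weight α ≡ weight β
weight-cong {zero}  eq = refl
weight-cong {suc m} eq = cong₂ _+_ (cong toℕ (eq zero)) (weight-cong (eq ∘ suc))

weight-++ : ∀ {m l k} (α : Fin m → Fin k) (β : Fin l → Fin k) → weight (α ++ᶠ β) ≡ weight α + weight β
weight-++ {zero}  α β = refl
weight-++ {suc m} α β = trans (cong (toℕ (α zero) +_)
  (trans (weight-cong {α = (α ++ᶠ β) ∘ suc} (λ i → sym (++-suc α β i))) (weight-++ (α ∘ suc) β)))
  (sym (ℕ.+-assoc (toℕ (α zero)) (weight (α ∘ suc)) (weight β)))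

-- The triangular tower

T⇒≡ : ∀ {b} → T b → b ≡ true
T⇒≡ = Equivalence.to Bool.T-≡

≡⇒T : ∀ {b} → b ≡ true → T b
≡⇒T = Equivalence.from Bool.T-≡

∧-elim : ∀ {a b} → T (a ∧ b) → T a × T b
∧-elim = Equivalence.to Bool.T-∧

∧-intro : ∀ {a b} → T a → T b → T (a ∧ b)
∧-intro p q = Equivalence.from Bool.T-∧ (p , q)

∨-elim : ∀ {a b} → T (a ∨ b) → T a ⊎ T b
∨-elim = Equivalence.to Bool.T-∨

∨-introˡ : ∀ {a b} → T a → T (a ∨ b)
∨-introˡ = Equivalence.from Bool.T-∨ ∘ inj₁

∨-introʳ : ∀ {a b} → T b → T (a ∨ b)
∨-introʳ {a} = Equivalence.from (Bool.T-∨ {a}) ∘ inj₂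

isPair-elim : ∀ {x y} i j → T (isPair x y i j) → i ≡ x × j ≡ y
isPair-elim {x} {y} i j t with ∧-elim {i ≡ᵇ x} t
... | p , q = ℕ.≡ᵇ⇒≡ i x p , ℕ.≡ᵇ⇒≡ j y q

isPair-intro : ∀ {x y i j} → i ≡ x → j ≡ y → T (isPair x y i j)
isPair-intro {x} {y} refl refl = ∧-intro {x ≡ᵇ x} (ℕ.≡⇒≡ᵇ x x refl) (ℕ.≡⇒≡ᵇ y y refl)

inRange-elim : ∀ {lo hi} i → T (inRange lo hi i) → lo ≤ i × i ≤ hi
inRange-elim {lo} {hi} i t with ∧-elim {lo ≤ᵇ i} t
... | p , q = ℕ.≤ᵇ⇒≤ lo i p , ℕ.≤ᵇ⇒≤ i hi q

inRange-intro : ∀ {lo hi i} → lo ≤ i → i ≤ hi → T (inRange lo hi i)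
inRange-intro {lo} {hi} {i} p q = ∧-intro {lo ≤ᵇ i} (ℕ.≤⇒≤ᵇ p) (ℕ.≤⇒≤ᵇ q)

module Tower (m : ℕ) where
  n : ℕ
  n = suc m

  G : Graph (n + n + n)
  G = TT n n n

  offset : Fin 3 → ℕ
  offset zero             = 0
  offset (suc zero)       = n
  offset (suc (suc zero)) = n + n

  vertex : Fin 3 → Fin n → Fin (n + n + n)
  vertex zero             p = (p ↑ˡ n) ↑ˡ n
  vertex (suc zero)       p = (n ↑ʳ p) ↑ˡ n
  vertex (suc (suc zero)) p = (n + n) ↑ʳ p

  toℕ-vertex : ∀ r p → toℕ (vertex r p) ≡ offset r + toℕ p
  toℕ-vertex zero             p = trans (Fin.toℕ-↑ˡ (p ↑ˡ n) n) (Fin.toℕ-↑ˡ p n)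
  toℕ-vertex (suc zero)       p = trans (Fin.toℕ-↑ˡ (n ↑ʳ p) n) (Fin.toℕ-↑ʳ n p)
  toℕ-vertex (suc (suc zero)) p = Fin.toℕ-↑ʳ (n + n) p

  coordinates : ∀ u → ∃[ r ] ∃[ p ] vertex r p ≡ u
  coordinates u with splitAt (n + n) u | Fin.join-splitAt (n + n) n u
  ... | inj₂ p | eq = suc (suc zero) , p , eq
  ... | inj₁ v | eq with splitAt n v | Fin.join-splitAt n n v
  ...   | inj₁ p | eq′ = zero , p , trans (cong (_↑ˡ n) eq′) eq
  ...   | inj₂ p | eq′ = suc zero , p , trans (cong (_↑ˡ n) eq′) eq

  offset-injective : ∀ r s {p q} → p < n → q < n → offset r + p ≡ offset s + q → r ≡ s × p ≡ q
  offset-injective zero zero _ _ eq = refl , eq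
  offset-injective zero (suc zero) p<n _ eq = contradiction (ℕ.≤-trans (ℕ.m≤m+n n _) (ℕ.≤-reflexive (sym eq))) (ℕ.<⇒≱ p<n)
  offset-injective zero (suc (suc zero)) p<n _ eq = contradiction (ℕ.≤-trans (ℕ.≤-trans (ℕ.m≤m+n n n) (ℕ.m≤m+n (n + n) _)) (ℕ.≤-reflexive (sym eq))) (ℕ.<⇒≱ p<n)
  offset-injective (suc zero) zero _ q<n eq = contradiction (ℕ.≤-trans (ℕ.m≤m+n n _) (ℕ.≤-reflexive eq)) (ℕ.<⇒≱ q<n)
  offset-injective (suc zero) (suc zero) _ _ eq = refl , ℕ.+-cancelˡ-≡ n _ _ eq
  offset-injective (suc zero) (suc (suc zero)) {q = q} p<n _ eq =
    contradiction (ℕ.≤-trans (ℕ.m≤m+n n q) (ℕ.≤-reflexive (sym (ℕ.+-cancelˡ-≡ n _ _ (trans eq (ℕ.+-assoc n n q)))))) (ℕ.<⇒≱ p<n)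
  offset-injective (suc (suc zero)) zero _ q<n eq = contradiction (ℕ.≤-trans (ℕ.≤-trans (ℕ.m≤m+n n n) (ℕ.m≤m+n (n + n) _)) (ℕ.≤-reflexive eq)) (ℕ.<⇒≱ q<n)
  offset-injective (suc (suc zero)) (suc zero) {p} _ q<n eq =
    contradiction (ℕ.≤-trans (ℕ.m≤m+n n p) (ℕ.≤-reflexive (ℕ.+-cancelˡ-≡ n _ _ (trans (sym (ℕ.+-assoc n n p)) eq)))) (ℕ.<⇒≱ q<n)
  offset-injective (suc (suc zero)) (suc (suc zero)) _ _ eq = refl , ℕ.+-cancelˡ-≡ (n + n) _ _ eq

  vertex-injective : ∀ {r s p q} → vertex r p ≡ vertex s q → r ≡ s × p ≡ q
  vertex-injective {r} {s} {p} {q} eq with offset-injective r s (Fin.toℕ<n p) (Fin.toℕ<n q)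
    (trans (sym (toℕ-vertex r p)) (trans (cong toℕ eq) (toℕ-vertex s q)))
  ... | r≡s , p≡q = r≡s , Fin.toℕ-injective p≡q

  -- Adjacency in terms of the path `r` and the height `p`. The arithmetic of `ttEdge` is translated
  -- once, by `adj⇒link` and `link⇒adj`, so that the combinatorial arguments can work with four
  -- kinds of edges.
  data Link : Fin 3 → Fin n → Fin 3 → Fin n → Set where
    forward  : ∀ {r p q} → toℕ q ≡ suc (toℕ p) → Link r p r q
    backward : ∀ {r p q} → toℕ p ≡ suc (toℕ q) → Link r p r q
    top      : ∀ {r s p q} → r ≢ s → toℕ p ≡ 0 → toℕ q ≡ 0 → Link r p s q
    bottom   : ∀ {r s p q} → r ≢ s → toℕ p ≡ m → toℕ q ≡ m → Link r p s q

  link-sym : ∀ {r p s q} → Link r p s q → Link s q r p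
  link-sym (forward eq)       = backward eq
  link-sym (backward eq)      = forward eq
  link-sym (top r≢s p q)      = top (≢-sym r≢s) q p
  link-sym (bottom r≢s p q)   = bottom (≢-sym r≢s) q p

  -- Vertices are numbered from 0 here, whereas ttEdge numbers them from 1.
  data Edge (x y : ℕ) : Set where
    along  : ∀ r {p} → p < m → x ≡ offset r + p → y ≡ offset r + suc p → Edge x y
    upper  : ∀ r s → r ≢ s → x ≡ offset r + 0 → y ≡ offset s + 0 → Edge x y
    lower  : ∀ r s → r ≢ s → x ≡ offset r + m → y ≡ offset s + m → Edge x y

  private
    block : ∀ r x → offset r + 1 ≤ suc x → suc x ≤ offset r + m → ∃[ p ] p < m × x ≡ offset r + p
    block r x lo hi = x ∸ offset r ,
      ℕ.+-cancelˡ-< (offset r) _ _ (subst (_< offset r + m) (sym (ℕ.m+[n∸m]≡n o≤x)) hi) ,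
      sym (ℕ.m+[n∸m]≡n o≤x)
      where
      o≤x : offset r ≤ x
      o≤x = s≤s⁻¹ (subst (_≤ suc x) (ℕ.+-comm (offset r) 1) lo)

    along-block : ∀ r x y → y ≡ suc x → offset r + 1 ≤ suc x → suc x ≤ offset r + m → Edge x y
    along-block r x y y≡sx lo hi with block r x lo hi
    ... | p , p<m , refl = along r p<m refl (trans y≡sx (sym (ℕ.+-suc (offset r) p)))

    pred≡ : ∀ {x a} → suc x ≡ a + 1 → x ≡ a + 0
    pred≡ {x} {a} eq = ℕ.suc-injective (trans eq (trans (ℕ.+-suc a 0) refl))

    n≡ : n + n ≡ suc (n + m)
    n≡ = ℕ.+-suc n m

    nn≡ : n + n + n ≡ suc (n + n + m)
    nn≡ = ℕ.+-suc (n + n) m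

    0≢1 : _≢_ {A = Fin 3} zero (suc zero)
    0≢1 ()
    1≢2 : _≢_ {A = Fin 3} (suc zero) (suc (suc zero))
    1≢2 ()
    2≢0 : _≢_ {A = Fin 3} (suc (suc zero)) zero
    2≢0 ()

  edge-elim : ∀ x y → T (ttEdge n n n (suc x) (suc y)) → Edge x y
  edge-elim x y t with ∨-elim t
  ... | inj₁ t₁ with ∧-elim {suc y ≡ᵇ suc (suc x)} t₁
  ...   | y≡ᵇ , ranges with ∨-elim {inRange 1 (n ∸ 1) (suc x)} ranges
  ...     | inj₁ range = uncurry (along-block zero x y (ℕ.suc-injective (ℕ.≡ᵇ⇒≡ (suc y) (suc (suc x)) y≡ᵇ))) (inRange-elim (suc x) range)
  ...     | inj₂ ranges′ with ∨-elim {inRange (n + 1) (n + n ∸ 1) (suc x)} ranges′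
  ...       | inj₁ range with inRange-elim (suc x) range
  ...         | lo , hi = along-block (suc zero) x y (ℕ.suc-injective (ℕ.≡ᵇ⇒≡ (suc y) (suc (suc x)) y≡ᵇ)) lo (ℕ.≤-trans hi (ℕ.≤-reflexive (cong (_∸ 1) n≡)))
  edge-elim x y t | inj₁ t₁ | y≡ᵇ , ranges | inj₂ ranges′ | inj₂ range with inRange-elim (suc x) range
  ...         | lo , hi = along-block (suc (suc zero)) x y (ℕ.suc-injective (ℕ.≡ᵇ⇒≡ (suc y) (suc (suc x)) y≡ᵇ)) lo (ℕ.≤-trans hi (ℕ.≤-reflexive (cong (_∸ 1) nn≡)))
  edge-elim x y t | inj₂ t₁ with ∨-elim {isPair 1 (n + 1) (suc x) (suc y)} t₁
  ... | inj₁ pr with isPair-elim (suc x) (suc y) pr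
  ...   | p , q = upper zero (suc zero) 0≢1 (ℕ.suc-injective p) (pred≡ q)
  edge-elim x y t | inj₂ t₁ | inj₂ t₂ with ∨-elim {isPair (n + 1) (n + n + 1) (suc x) (suc y)} t₂
  ... | inj₁ pr with isPair-elim (suc x) (suc y) pr
  ...   | p , q = upper (suc zero) (suc (suc zero)) 1≢2 (pred≡ p) (pred≡ q)
  edge-elim x y t | inj₂ t₁ | inj₂ t₂ | inj₂ t₃ with ∨-elim {isPair (n + n + 1) 1 (suc x) (suc y)} t₃
  ... | inj₁ pr with isPair-elim (suc x) (suc y) pr
  ...   | p , q = upper (suc (suc zero)) zero 2≢0 (pred≡ p) (ℕ.suc-injective q)
  edge-elim x y t | inj₂ t₁ | inj₂ t₂ | inj₂ t₃ | inj₂ t₄ with ∨-elim {isPair n (n + n) (suc x) (suc y)} t₄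
  ... | inj₁ pr with isPair-elim (suc x) (suc y) pr
  ...   | p , q = lower zero (suc zero) 0≢1 (ℕ.suc-injective p) (ℕ.suc-injective (trans q n≡))
  edge-elim x y t | inj₂ t₁ | inj₂ t₂ | inj₂ t₃ | inj₂ t₄ | inj₂ t₅ with ∨-elim {isPair (n + n) (n + n + n) (suc x) (suc y)} t₅
  ... | inj₁ pr with isPair-elim (suc x) (suc y) pr
  ...   | p , q = lower (suc zero) (suc (suc zero)) 1≢2 (ℕ.suc-injective (trans p n≡)) (ℕ.suc-injective (trans q nn≡))
  edge-elim x y t | inj₂ t₁ | inj₂ t₂ | inj₂ t₃ | inj₂ t₄ | inj₂ t₅ | inj₂ pr with isPair-elim (suc x) (suc y) pr
  ...   | p , q = lower (suc (suc zero)) zero 2≢0 (ℕ.suc-injective (trans p nn≡)) (ℕ.suc-injective q)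

  edge⇒link : ∀ r p s q → Edge (offset r + toℕ p) (offset s + toℕ q) → Link r p s q
  edge⇒link r p s q (along k {p′} p′<m x≡ y≡)
    with offset-injective r k (Fin.toℕ<n p) (ℕ.m<n⇒m<1+n p′<m) x≡ | offset-injective s k (Fin.toℕ<n q) (s≤s p′<m) y≡
  ... | refl , p≡ | refl , q≡ = forward (trans q≡ (cong suc (sym p≡)))
  edge⇒link r p s q (upper k l k≢l x≡ y≡)
    with offset-injective r k (Fin.toℕ<n p) (s≤s z≤n) x≡ | offset-injective s l (Fin.toℕ<n q) (s≤s z≤n) y≡
  ... | refl , p≡ | refl , q≡ = top k≢l p≡ q≡
  edge⇒link r p s q (lower k l k≢l x≡ y≡)
    with offset-injective r k (Fin.toℕ<n p) (ℕ.n<1+n m) x≡ | offset-injective s l (Fin.toℕ<n q) (ℕ.n<1+n m) y≡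
  ... | refl , p≡ | refl , q≡ = bottom k≢l p≡ q≡

  adj⇒link : ∀ r p s q → Adj G (vertex r p) (vertex s q) → Link r p s q
  adj⇒link r p s q adj with ∨-elim {ttEdge n n n (suc (toℕ (vertex r p))) (suc (toℕ (vertex s q)))} (proj₁ (∧-elim (≡⇒T adj)))
  ... | inj₁ t = edge⇒link r p s q (subst₂ Edge (toℕ-vertex r p) (toℕ-vertex s q) (edge-elim _ _ t))
  ... | inj₂ t = link-sym (edge⇒link s q r p (subst₂ Edge (toℕ-vertex s q) (toℕ-vertex r p) (edge-elim _ _ t)))

  private
    range : ∀ r p {hi} → p < m → hi ≡ offset r + m → T (inRange (offset r + 1) hi (suc (offset r + p)))
    range r p p<m refl = inRange-intro (ℕ.≤-trans (ℕ.≤-reflexive (ℕ.+-comm (offset r) 1)) (s≤s (ℕ.m≤m+n (offset r) p)))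
      (ℕ.≤-trans (ℕ.≤-reflexive (sym (ℕ.+-suc (offset r) p))) (ℕ.+-monoʳ-≤ (offset r) p<m))

    step : ∀ r p → T (suc (offset r + suc p) ≡ᵇ suc (suc (offset r + p)))
    step r p = ℕ.≡⇒≡ᵇ (suc (offset r + suc p)) (suc (suc (offset r + p))) (cong suc (ℕ.+-suc (offset r) p))

    edge : ℕ → ℕ → Bool
    edge x y = ttEdge n n n (suc x) (suc y)

    pair₁ = λ x y → isPair 1 (n + 1) (suc x) (suc y)
    pair₂ = λ x y → isPair (n + 1) (n + n + 1) (suc x) (suc y)
    pair₃ = λ x y → isPair (n + n + 1) 1 (suc x) (suc y)
    pair₄ = λ x y → isPair n (n + n) (suc x) (suc y)
    pair₅ = λ x y → isPair (n + n) (n + n + n) (suc x) (suc y)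
    pair₆ = λ x y → isPair (n + n + n) n (suc x) (suc y)

    pairs : ∀ x y → T (pair₁ x y ∨ pair₂ x y ∨ pair₃ x y ∨ pair₄ x y ∨ pair₅ x y ∨ pair₆ x y) → T (edge x y)
    pairs x y = ∨-introʳ {(suc y ≡ᵇ suc (suc x)) ∧ (inRange 1 (n ∸ 1) (suc x) ∨ inRange (n + 1) (n + n ∸ 1) (suc x) ∨ inRange (n + n + 1) (n + n + n ∸ 1) (suc x))}

    suc≡ : ∀ a → suc (a + 0) ≡ a + 1
    suc≡ a = sym (ℕ.+-suc a 0)

  along-edge : ∀ r p → p < m → T (edge (offset r + p) (offset r + suc p))
  along-edge zero p p<m = ∨-introˡ {b = pair₁ p (suc p) ∨ _} (∧-intro {suc (suc p) ≡ᵇ suc (suc p)} (step zero p) (∨-introˡ (range zero p p<m refl)))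
  along-edge r@(suc zero) p p<m = ∨-introˡ (∧-intro {suc (offset r + suc p) ≡ᵇ suc (suc (offset r + p))} (step r p)
    (∨-introʳ {inRange 1 (n ∸ 1) (suc (offset r + p))} (∨-introˡ (range r p p<m (cong (_∸ 1) n≡)))))
  along-edge r@(suc (suc zero)) p p<m = ∨-introˡ (∧-intro {suc (offset r + suc p) ≡ᵇ suc (suc (offset r + p))} (step r p)
    (∨-introʳ {inRange 1 (n ∸ 1) (suc (offset r + p))} (∨-introʳ {inRange (n + 1) (n + n ∸ 1) (suc (offset r + p))} (range r p p<m (cong (_∸ 1) nn≡)))))

  upper-edge : ∀ r s → r ≢ s → T (edge (offset r + 0) (offset s + 0)) ⊎ T (edge (offset s + 0) (offset r + 0))
  upper-edge zero zero r≢s = contradiction refl r≢s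
  upper-edge zero (suc zero) _ = inj₁ (pairs 0 (n + 0) (∨-introˡ {pair₁ 0 (n + 0)} (isPair-intro (refl {x = 1}) (suc≡ n))))
  upper-edge zero (suc (suc zero)) _ = inj₂ (pairs (n + n + 0) 0 (∨-introʳ {pair₁ (n + n + 0) 0} (∨-introʳ {pair₂ (n + n + 0) 0} (∨-introˡ {pair₃ (n + n + 0) 0} (isPair-intro (suc≡ (n + n)) (refl {x = 1}))))))
  upper-edge (suc zero) zero _ = inj₂ (pairs 0 (n + 0) (∨-introˡ {pair₁ 0 (n + 0)} (isPair-intro (refl {x = 1}) (suc≡ n))))
  upper-edge (suc zero) (suc zero) r≢s = contradiction refl r≢s
  upper-edge (suc zero) (suc (suc zero)) _ = inj₁ (pairs (n + 0) (n + n + 0) (∨-introʳ {pair₁ (n + 0) (n + n + 0)} (∨-introˡ {pair₂ (n + 0) (n + n + 0)} (isPair-intro (suc≡ n) (suc≡ (n + n))))))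
  upper-edge (suc (suc zero)) zero _ = inj₁ (pairs (n + n + 0) 0 (∨-introʳ {pair₁ (n + n + 0) 0} (∨-introʳ {pair₂ (n + n + 0) 0} (∨-introˡ {pair₃ (n + n + 0) 0} (isPair-intro (suc≡ (n + n)) (refl {x = 1}))))))
  upper-edge (suc (suc zero)) (suc zero) _ = inj₂ (pairs (n + 0) (n + n + 0) (∨-introʳ {pair₁ (n + 0) (n + n + 0)} (∨-introˡ {pair₂ (n + 0) (n + n + 0)} (isPair-intro (suc≡ n) (suc≡ (n + n))))))
  upper-edge (suc (suc zero)) (suc (suc zero)) r≢s = contradiction refl r≢s

  private
    lower₀₁ : T (edge m (n + m))
    lower₀₁ = pairs x y (∨-introʳ {pair₁ x y} (∨-introʳ {pair₂ x y} (∨-introʳ {pair₃ x y} (∨-introˡ {pair₄ x y} (isPair-intro (refl {x = n}) (sym n≡))))))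
      where x = m ; y = n + m
    lower₁₂ : T (edge (n + m) (n + n + m))
    lower₁₂ = pairs x y (∨-introʳ {pair₁ x y} (∨-introʳ {pair₂ x y} (∨-introʳ {pair₃ x y} (∨-introʳ {pair₄ x y} (∨-introˡ {pair₅ x y} (isPair-intro (sym n≡) (sym nn≡)))))))
      where x = n + m ; y = n + n + m
    lower₂₀ : T (edge (n + n + m) m)
    lower₂₀ = pairs x y (∨-introʳ {pair₁ x y} (∨-introʳ {pair₂ x y} (∨-introʳ {pair₃ x y} (∨-introʳ {pair₄ x y} (∨-introʳ {pair₅ x y} (isPair-intro (sym nn≡) (refl {x = n})))))))
      where x = n + n + m ; y = m

  lower-edge : ∀ r s → r ≢ s → T (edge (offset r + m) (offset s + m)) ⊎ T (edge (offset s + m) (offset r + m))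
  lower-edge zero zero r≢s = contradiction refl r≢s
  lower-edge zero (suc zero) _ = inj₁ lower₀₁
  lower-edge zero (suc (suc zero)) _ = inj₂ lower₂₀
  lower-edge (suc zero) zero _ = inj₂ lower₀₁
  lower-edge (suc zero) (suc zero) r≢s = contradiction refl r≢s
  lower-edge (suc zero) (suc (suc zero)) _ = inj₁ lower₁₂
  lower-edge (suc (suc zero)) zero _ = inj₁ lower₂₀
  lower-edge (suc (suc zero)) (suc zero) _ = inj₂ lower₁₂
  lower-edge (suc (suc zero)) (suc (suc zero)) r≢s = contradiction refl r≢s

  link⇒edge : ∀ {r p s q} → Link r p s q →
    T (edge (offset r + toℕ p) (offset s + toℕ q)) ⊎ T (edge (offset s + toℕ q) (offset r + toℕ p))
  link⇒edge {r} {p} {s} {q} (forward eq) rewrite eq =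
    inj₁ (along-edge r (toℕ p) (s≤s⁻¹ (subst (_< n) eq (Fin.toℕ<n q))))
  link⇒edge {r} {p} {s} {q} (backward eq) rewrite eq =
    inj₂ (along-edge r (toℕ q) (s≤s⁻¹ (subst (_< n) eq (Fin.toℕ<n p))))
  link⇒edge {r} {p} {s} {q} (top r≢s p≡ q≡) rewrite p≡ | q≡ = upper-edge r s r≢s
  link⇒edge {r} {p} {s} {q} (bottom r≢s p≡ q≡) rewrite p≡ | q≡ = lower-edge r s r≢s

  link-irrefl : ∀ {r p} → ¬ Link r p r p
  link-irrefl (forward eq)     = ℕ.1+n≢n (sym eq)
  link-irrefl (backward eq)    = ℕ.1+n≢n (sym eq)
  link-irrefl (top r≢r _ _)    = r≢r refl
  link-irrefl (bottom r≢r _ _) = r≢r refl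

  link⇒adj : ∀ {r p s q} → Link r p s q → Adj G (vertex r p) (vertex s q)
  link⇒adj {r} {p} {s} {q} l = T⇒≡ (∧-intro {edge x y ∨ edge y x} either distinct)
    where
    x = toℕ (vertex r p)
    y = toℕ (vertex s q)
    either : T (edge x y ∨ edge y x)
    either rewrite toℕ-vertex r p | toℕ-vertex s q = Equivalence.from Bool.T-∨ (link⇒edge l)
    distinct : T (not (x ≡ᵇ y))
    distinct with x ≡ᵇ y in eq
    ... | false = _
    ... | true with vertex-injective {r} {s} {p} {q} (Fin.toℕ-injective (ℕ.≡ᵇ⇒≡ x y (subst T (sym eq) _)))
    ...   | refl , refl = link-irrefl l

  -- The neighbours of a vertex on either side of it form a clique, so no three neighbours are independent.
  data Side : Set where ahead behind : Side

  side : ∀ {r p s q} → Link r p s q → Side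
  side (forward _)    = ahead
  side (backward _)   = behind
  side (top _ _ _)    = behind
  side (bottom _ _ _) = ahead

  -- On one side of a vertex there is a single path neighbour or, at an end of the path, the two
  -- other corners of a triangle. The height of the vertex rules out a mixture.
  same-side : ∀ {r p s q s′ q′} (l : Link r p s q) (l′ : Link r p s′ q′) → side l ≡ side l′ →
    vertex s q ≡ vertex s′ q′ ⊎ Link s q s′ q′
  same-side {r} (forward e)  (forward e′)      _ = inj₁ (cong (vertex r) (Fin.toℕ-injective (trans e (sym e′))))
  same-side (forward {q = q} e) (bottom _ p≡ _) _ = contradiction (Fin.toℕ<n q) (ℕ.≤⇒≯ (ℕ.≤-reflexive (sym (trans e (cong suc p≡)))))
  same-side (bottom _ p≡ _)  (forward {q = q} e) _ = contradiction (Fin.toℕ<n q) (ℕ.≤⇒≯ (ℕ.≤-reflexive (sym (trans e (cong suc p≡)))))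
  same-side (bottom {s = s} _ _ q≡) (bottom {s = s′} _ _ q≡′) _ with s Fin.≟ s′
  ... | yes refl = inj₁ (cong (vertex s) (Fin.toℕ-injective (trans q≡ (sym q≡′))))
  ... | no s≢s′  = inj₂ (bottom s≢s′ q≡ q≡′)
  same-side {r} (backward e) (backward e′)     _ = inj₁ (cong (vertex r) (Fin.toℕ-injective (ℕ.suc-injective (trans (sym e) e′))))
  same-side (backward e)     (top _ p≡ _)      _ = contradiction (trans (sym p≡) e) ℕ.0≢1+n
  same-side (top _ p≡ _)     (backward e)      _ = contradiction (trans (sym p≡) e) ℕ.0≢1+n
  same-side (top {s = s} _ _ q≡) (top {s = s′} _ _ q≡′) _ with s Fin.≟ s′
  ... | yes refl = inj₁ (cong (vertex s) (Fin.toℕ-injective (trans q≡ (sym q≡′))))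
  ... | no s≢s′  = inj₂ (top s≢s′ q≡ q≡′)

  claw-free : ClawFree G
  claw-free v x y z (_ , _ , _ , x≢y , x≢z , y≢z , vx , vy , vz , ¬xy , ¬xz , ¬yz)
    with coordinates v | coordinates x | coordinates y | coordinates z
  ... | r , p , refl | rx , px , refl | ry , py , refl | rz , pz , refl = pigeonhole (side lx) (side ly) (side lz) refl refl refl
    where
    lx = adj⇒link r p rx px vx
    ly = adj⇒link r p ry py vy
    lz = adj⇒link r p rz pz vz
    xy : side lx ≢ side ly
    xy eq = [ x≢y , ¬xy ∘ link⇒adj ]′ (same-side lx ly eq)
    xz : side lx ≢ side lz
    xz eq = [ x≢z , ¬xz ∘ link⇒adj ]′ (same-side lx lz eq)
    yz : side ly ≢ side lz
    yz eq = [ y≢z , ¬yz ∘ link⇒adj ]′ (same-side ly lz eq)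
    pigeonhole : ∀ a b c → side lx ≡ a → side ly ≡ b → side lz ≡ c → ⊥
    pigeonhole ahead  ahead  _      p q r = xy (trans p (sym q))
    pigeonhole ahead  behind ahead  p q r = xz (trans p (sym r))
    pigeonhole ahead  behind behind p q r = yz (trans q (sym r))
    pigeonhole behind ahead  ahead  p q r = yz (trans q (sym r))
    pigeonhole behind ahead  behind p q r = xz (trans p (sym r))
    pigeonhole behind behind _      p q r = xy (trans p (sym q))

  -- Impossibility of a contraction to the claw

  module _ (label : Fin 3 → Fin n → Fin 4)
           (locate : ∀ c → ∃[ r ] ∃[ p ] label r p ≡ c)
           -- Connectedness of the classes in the form of an induction principle: a property that
           -- spreads along links within a class and holds somewhere in the class holds throughout
           -- it. Label `zero` is the centre, and `suc i` are the leaves.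
           (fibre-closed : ∀ {c} (C : Fin 3 → Fin n → Set) →
             (∀ {r p s q} → C r p → Link r p s q → label s q ≡ c → C s q) →
             ∀ {r p s q} → label r p ≡ c → label s q ≡ c → C r p → C s q)
           (label-step : ∀ {r p s q i j} → Link r p s q → label r p ≡ suc i → label s q ≡ suc j → i ≡ j) where

    private
      ≤∧label≢⇒< : ∀ {r p q c} → label r p ≡ c → label r q ≢ c → toℕ p ≤ toℕ q → toℕ p < toℕ q
      ≤∧label≢⇒< {r} p≡c q≢c p≤q = ℕ.≤∧≢⇒< p≤q (λ p≡q → q≢c (subst (λ x → label r x ≡ _) (Fin.toℕ-injective p≡q) p≡c))

    -- One vertex outside the class on each path forms a barrier. The links of the top triangle stay
    -- above it, those of the bottom triangle below it, and a link along a path cannot jump over it.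
    cut : ∀ {c} (b : Fin 3 → Fin n) → (∀ r → label r (b r) ≢ c) → ∀ {r p s q} →
      label r p ≡ c → label s q ≡ c → toℕ p < toℕ (b r) → toℕ q < toℕ (b s)
    cut {c} b b≢c = fibre-closed (λ r p → toℕ p < toℕ (b r)) closed
      where
      closed : ∀ {r p s q} → toℕ p < toℕ (b r) → Link r p s q → label s q ≡ c → toℕ q < toℕ (b s)
      closed p<b (forward e)      q≡c = ≤∧label≢⇒< q≡c (b≢c _) (subst (_≤ _) (sym e) p<b)
      closed p<b (backward e)     q≡c = ℕ.<-trans (ℕ.≤-reflexive (sym e)) p<b
      closed p<b (top _ _ e)      q≡c = ≤∧label≢⇒< q≡c (b≢c _) (subst (_≤ _) (sym e) z≤n)
      closed {r} p<b (bottom _ e _) q≡c = contradiction (Fin.toℕ<n (b r)) (ℕ.≤⇒≯ (subst (_< toℕ (b r)) e p<b))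

    -- Strictly between two vertices of a path no triangle is met, so a class that avoids both of
    -- them cannot leave that stretch.
    segment : ∀ {c r a b} → label r a ≢ c → label r b ≢ c → ∀ {p s q} → label r p ≡ c → label s q ≡ c →
      toℕ a < toℕ p → toℕ p < toℕ b → r ≡ s × toℕ a < toℕ q × toℕ q < toℕ b
    segment {c} {r} {a} {b} a≢c b≢c p≡c q≡c a<p p<b =
      fibre-closed (λ s q → r ≡ s × toℕ a < toℕ q × toℕ q < toℕ b) closed p≡c q≡c (refl , a<p , p<b)
      where
      <-label : ∀ {q} → label r q ≡ c → toℕ a ≤ toℕ q → toℕ a < toℕ q
      <-label {q} q≡c a≤q = ℕ.≤∧≢⇒< a≤q (λ a≡q → a≢c (subst (λ x → label r x ≡ c) (sym (Fin.toℕ-injective a≡q)) q≡c))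
      closed : ∀ {s p t q} → r ≡ s × toℕ a < toℕ p × toℕ p < toℕ b → Link s p t q → label t q ≡ c → r ≡ t × toℕ a < toℕ q × toℕ q < toℕ b
      closed (refl , a<p , p<b) (forward e)    q≡c = refl , ℕ.<-trans a<p (ℕ.≤-reflexive (sym e)) , ≤∧label≢⇒< q≡c b≢c (subst (_≤ _) (sym e) p<b)
      closed (refl , a<p , p<b) (backward e)   q≡c = refl , <-label q≡c (s≤s⁻¹ (subst (suc (toℕ a) ≤_) e a<p)) , ℕ.<-trans (ℕ.≤-reflexive (sym e)) p<b
      closed (refl , a<p , p<b) (top _ e _)    q≡c = contradiction (subst (toℕ a <_) e a<p) ℕ.n≮0
      closed (refl , a<p , p<b) (bottom _ e _) q≡c = contradiction (Fin.toℕ<n b) (ℕ.≤⇒≯ (subst (_< toℕ b) e p<b))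

    -- A discrete intermediate value argument: along the path, the leaf can change only by passing
    -- through the centre, because adjacent leaf vertices carry the same leaf.
    between : ∀ {r i j} d {a b} → toℕ b ≡ d + toℕ a → label r a ≡ suc i → label r b ≡ suc j → i ≢ j →
      ∃[ w ] label r w ≡ zero × toℕ a < toℕ w × toℕ w < toℕ b
    between {r} zero {a} {b} b≡a a≡i b≡j i≢j with Fin.toℕ-injective b≡a
    ... | refl = contradiction (Fin.suc-injective (trans (sym a≡i) b≡j)) i≢j
    between {r} {i} {j} (suc d) {a} {b} b≡a a≡i b≡j i≢j = next (label r a′) refl
      where
      a′<n : suc (toℕ a) < n
      a′<n = ℕ.≤-<-trans (ℕ.≤-trans (s≤s (ℕ.m≤n+m (toℕ a) d)) (ℕ.≤-reflexive (sym b≡a))) (Fin.toℕ<n b)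
      a′ : Fin n
      a′ = fromℕ< a′<n
      a′≡ : toℕ a′ ≡ suc (toℕ a)
      a′≡ = Fin.toℕ-fromℕ< a′<n
      a<a′ : toℕ a < toℕ a′
      a<a′ = ℕ.≤-reflexive (sym a′≡)
      a′≤b : toℕ a′ ≤ toℕ b
      a′≤b = subst₂ _≤_ (sym a′≡) (sym b≡a) (s≤s (ℕ.m≤n+m (toℕ a) d))
      next : ∀ c → label r a′ ≡ c → ∃[ w ] label r w ≡ zero × toℕ a < toℕ w × toℕ w < toℕ b
      next zero    a′≡0 = a′ , a′≡0 , a<a′ , ≤∧label≢⇒< a′≡0 (λ b≡0 → Fin.0≢1+n (trans (sym b≡0) b≡j)) a′≤b
      next (suc k) a′≡k with label-step {r} (forward a′≡) a≡i a′≡k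
      ... | refl with between {r} d (trans b≡a (trans (sym (ℕ.+-suc d (toℕ a))) (cong (d +_) (sym a′≡)))) a′≡k b≡j i≢j
      ...   | w , w≡0 , a′<w , w<b = w , w≡0 , ℕ.<-trans a<a′ a′<w , w<b

    between< : ∀ {r i j a b} → toℕ a < toℕ b → label r a ≡ suc i → label r b ≡ suc j → i ≢ j →
      ∃[ w ] label r w ≡ zero × toℕ a < toℕ w × toℕ w < toℕ b
    between< {a = a} {b} a<b = between (toℕ b ∸ toℕ a) (sym (ℕ.m∸n+n≡m (ℕ.<⇒≤ a<b)))

    private
      TopLeaf BottomLeaf : Fin 3 → Set
      TopLeaf    k = ∃[ r ] label r zero ≡ suc k
      BottomLeaf k = ∃[ r ] label r (fromℕ m) ≡ suc k

      top-unique : ∀ {k l} → TopLeaf k → TopLeaf l → k ≡ l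
      top-unique (r , r≡) (s , s≡) with r Fin.≟ s
      ... | yes refl = Fin.suc-injective (trans (sym r≡) s≡)
      ... | no r≢s   = label-step (top r≢s refl refl) r≡ s≡

      bottom-unique : ∀ {k l} → BottomLeaf k → BottomLeaf l → k ≡ l
      bottom-unique (r , r≡) (s , s≡) with r Fin.≟ s
      ... | yes refl = Fin.suc-injective (trans (sym r≡) s≡)
      ... | no r≢s   = label-step (bottom r≢s (Fin.toℕ-fromℕ m) (Fin.toℕ-fromℕ m)) r≡ s≡

      interior-leaf : ∃[ k ] ¬ (TopLeaf k ⊎ BottomLeaf k)
      interior-leaf = Fin.¬∀⟶∃¬ 3 _
        (λ k → Fin.any? (λ r → label r zero Fin.≟ suc k) ⊎-dec Fin.any? (λ r → label r (fromℕ m) Fin.≟ suc k))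
        (λ all → pigeonhole (all zero) (all (suc zero)) (all (suc (suc zero))))
        where
        pigeonhole : TopLeaf zero ⊎ BottomLeaf zero → TopLeaf (suc zero) ⊎ BottomLeaf (suc zero) →
          TopLeaf (suc (suc zero)) ⊎ BottomLeaf (suc (suc zero)) → ⊥
        pigeonhole (inj₁ a) (inj₁ b) _        = 0≢1 (top-unique a b)
        pigeonhole (inj₂ a) (inj₂ b) _        = 0≢1 (bottom-unique a b)
        pigeonhole (inj₁ a) (inj₂ b) (inj₁ c) = 2≢0 (top-unique c a)
        pigeonhole (inj₁ a) (inj₂ b) (inj₂ c) = 1≢2 (bottom-unique b c)
        pigeonhole (inj₂ a) (inj₁ b) (inj₁ c) = 1≢2 (top-unique b c)
        pigeonhole (inj₂ a) (inj₁ b) (inj₂ c) = 2≢0 (bottom-unique c a)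

      others : ∀ (k : Fin 3) → ∃[ i ] ∃[ j ] i ≢ k × j ≢ k × i ≢ j
      others zero             = suc zero , suc (suc zero) , ≢-sym 0≢1 , 2≢0 , 1≢2
      others (suc zero)       = zero , suc (suc zero) , 0≢1 , ≢-sym 1≢2 , ≢-sym 2≢0
      others (suc (suc zero)) = zero , suc zero , ≢-sym 2≢0 , 1≢2 , 0≢1

      third : ∀ (a b c s : Fin 3) → a ≢ b → a ≢ c → b ≢ c → s ≢ a → s ≢ b → s ≡ c
      third = toWitness {a? = Fin.all? λ a → Fin.all? λ b → Fin.all? λ c → Fin.all? λ s →
        ¬? (a Fin.≟ b) →-dec ¬? (a Fin.≟ c) →-dec ¬? (b Fin.≟ c) →-dec ¬? (s Fin.≟ a) →-dec ¬? (s Fin.≟ b) →-dec (s Fin.≟ c)} _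

    -- A leaf k of the contracted claw that meets neither triangle lies inside a path r, between two
    -- vertices x and y of the centre.  The centre joins x to y by way of another path, so neither
    -- r nor that path meets the other two leaves, and on the third path the centre would have to
    -- separate them without being cut off itself.
    contradictory : ⊥
    contradictory with interior-leaf
    ... | k , ¬tb with locate (suc k) | others k
    ...   | r , p , rp≡k | i , j , i≢k , j≢k , i≢j with locate (suc i) | locate (suc j)
    ...     | ri , zi , zi≡ | rj , zj , zj≡ = final
      where
      nonzero : ∀ {r p k} → label r p ≡ suc k → label r p ≢ zero
      nonzero ≡k ≡0 = Fin.0≢1+n (trans (sym ≡0) ≡k)
      -- The top corner of path `r` belongs to the centre or to a leaf other than `k`; in the latter
      -- case the centre occurs between it and `p`. The vertex `below` is found symmetrically.
      above : ∃[ x ] label r x ≡ zero × toℕ x < toℕ p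
      above = from-top (label r zero) refl
        where
        0<p : 0 < toℕ p
        0<p = ℕ.≤∧≢⇒< z≤n (λ 0≡p → ¬tb (inj₁ (r , subst (λ x → label r x ≡ suc k) (sym (Fin.toℕ-injective 0≡p)) rp≡k)))
        from-top : ∀ c → label r zero ≡ c → ∃[ x ] label r x ≡ zero × toℕ x < toℕ p
        from-top zero    eq = zero , eq , 0<p
        from-top (suc l) eq with between< {r} 0<p eq rp≡k (λ { refl → ¬tb (inj₁ (r , eq)) })
        ... | w , w≡0 , _ , w<p = w , w≡0 , w<p
      below : ∃[ y ] label r y ≡ zero × toℕ p < toℕ y
      below = from-bottom (label r (fromℕ m)) refl
        where
        p<m : toℕ p < toℕ (fromℕ m)
        p<m = ℕ.≤∧≢⇒< (subst (toℕ p ≤_) (sym (Fin.toℕ-fromℕ m)) (s≤s⁻¹ (Fin.toℕ<n p)))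
          (λ p≡m → ¬tb (inj₂ (r , subst (λ x → label r x ≡ suc k) (Fin.toℕ-injective p≡m) rp≡k)))
        from-bottom : ∀ c → label r (fromℕ m) ≡ c → ∃[ y ] label r y ≡ zero × toℕ p < toℕ y
        from-bottom zero    eq = fromℕ m , eq , p<m
        from-bottom (suc l) eq with between< {r} p<m rp≡k eq (λ { refl → ¬tb (inj₂ (r , eq)) })
        ... | w , w≡0 , p<w , _ = w , w≡0 , p<w
      x = proj₁ above
      x≡0 = proj₁ (proj₂ above)
      x<p = proj₂ (proj₂ above)
      y = proj₁ below
      y≡0 = proj₁ (proj₂ below)
      p<y = proj₂ (proj₂ below)
      -- Another leaf on path `r` would enclose, together with `p`, a vertex of the centre. By
      -- `segment` the whole centre would lie between them, although it has the vertices `x` and `y`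
      -- on either side of `p`.
      not-on-r : ∀ {l s z} → l ≢ k → label s z ≡ suc l → s ≢ r
      not-on-r {l} {s} {z} l≢k z≡l refl with ℕ.<-cmp (toℕ z) (toℕ p)
      ... | tri< z<p _ _ with between< {r} z<p z≡l rp≡k l≢k
      ...   | w , w≡0 , z<w , w<p = ℕ.<-asym p<y (proj₂ (proj₂ (segment (nonzero z≡l) (nonzero rp≡k) w≡0 y≡0 z<w w<p)))
      not-on-r {l} {s} {z} l≢k z≡l refl | tri≈ _ z≡p _ with Fin.toℕ-injective z≡p
      ... | refl = l≢k (Fin.suc-injective (trans (sym z≡l) rp≡k))
      not-on-r {l} {s} {z} l≢k z≡l refl | tri> _ _ p<z with between< {r} p<z rp≡k z≡l (≢-sym l≢k)
      ... | w , w≡0 , p<w , w<z = ℕ.<-asym x<p (proj₁ (proj₂ (segment (nonzero rp≡k) (nonzero z≡l) w≡0 x≡0 p<w w<z)))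
      -- The centre would be trapped between the two leaves on path `s`, but `x` lies on path `r`.
      separated : ∀ {i j s z z′} → s ≢ r → toℕ z < toℕ z′ → label s z ≡ suc i → label s z′ ≡ suc j → i ≢ j → ⊥
      separated {s = s} s≢r z<z′ z≡i z′≡j i≢j with between< {s} z<z′ z≡i z′≡j i≢j
      ... | w , w≡0 , z<w , w<z′ = s≢r (proj₁ (segment (nonzero z≡i) (nonzero z′≡j) w≡0 x≡0 z<w w<z′))
      ri≢r = not-on-r i≢k zi≡
      rj≢r = not-on-r j≢k zj≡
      final : ⊥
      final with ri Fin.≟ rj
      ... | yes refl with ℕ.<-cmp (toℕ zi) (toℕ zj)
      ...   | tri< zi<zj _ _ = separated ri≢r zi<zj zi≡ zj≡ i≢j
      ...   | tri≈ _ zi≡zj _ with Fin.toℕ-injective zi≡zj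
      ...     | refl = i≢j (Fin.suc-injective (trans (sym zi≡) zj≡))
      final | yes refl | tri> _ _ zj<zi = separated ri≢r zj<zi zj≡ zi≡ (≢-sym i≢j)
      final | no ri≢rj = ℕ.<-asym p<y (y<p (cut (proj₁ ∘ barrier) (proj₁ ∘ proj₂ ∘ barrier) x≡0 y≡0 (x<b (proj₂ (proj₂ (barrier r)) refl))))
        where
        -- The three leaves now block one vertex on each of the three paths, so `cut` would keep `y`
        -- on the same side of `p` as `x`.
        barrier : ∀ s → ∃[ b ] label s b ≢ zero × (s ≡ r → toℕ b ≡ toℕ p)
        barrier s with s Fin.≟ r
        ... | yes refl = p , nonzero rp≡k , λ _ → refl
        ... | no s≢r with s Fin.≟ ri
        ...   | yes refl = zi , nonzero zi≡ , λ s≡r → contradiction s≡r s≢r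
        ...   | no s≢ri with third r ri rj s (≢-sym ri≢r) (≢-sym rj≢r) ri≢rj s≢r s≢ri
        ...     | refl = zj , nonzero zj≡ , λ s≡r → contradiction s≡r s≢r
        x<b : ∀ {b : Fin n} → toℕ b ≡ toℕ p → toℕ x < toℕ b
        x<b eq = subst (toℕ x <_) (sym eq) x<p
        y<p : toℕ y < toℕ (proj₁ (barrier r)) → toℕ y < toℕ p
        y<p = subst (toℕ y <_) (proj₂ (proj₂ (barrier r)) refl)

  claw-contractible-free : ClawContractibleFree G
  claw-contractible-free (S , S⊆G , φ , surjective , connected , respects , quotient) =
    contradictory label locate fibre-closed label-step
    where
    label : Fin 3 → Fin n → Fin 4
    label r p = φ (vertex r p)

    locate : ∀ c → ∃[ r ] ∃[ p ] label r p ≡ c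
    locate c with surjective c
    ... | u , u≡c with coordinates u
    ...   | r , p , refl = r , p , u≡c

    leaves : ∀ {u v i j} → φ u ≡ suc i → φ v ≡ suc j → Adj G u v → i ≡ j
    leaves {u} {v} {i} {j} φu φv uv with i Fin.≟ j
    ... | yes i≡j = i≡j
    ... | no i≢j with Equivalence.from (quotient (suc i) (suc j) (i≢j ∘ Fin.suc-injective)) (u , v , φu , φv , uv)
    ...   | ()

    label-step : ∀ {r p s q i j} → Link r p s q → label r p ≡ suc i → label s q ≡ suc j → i ≡ j
    label-step l φ≡i φ≡j = leaves φ≡i φ≡j (link⇒adj l)

    step-link : ∀ r p s q → SEdge S (vertex r p) (vertex s q) → Link r p s q
    step-link r p s q (inj₁ st) = adj⇒link r p s q (S⊆G _ _ st)
    step-link r p s q (inj₂ st) = link-sym (adj⇒link s q r p (S⊆G _ _ st))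

    module _ {c : Fin 4} (C : Fin 3 → Fin n → Set)
             (closed : ∀ {r p s q} → C r p → Link r p s q → label s q ≡ c → C s q) where

      -- Contracted edges preserve the label, so the walk stays within the class and the property
      -- spreads along it. Coordinates of the intermediate vertices are recovered on the way.
      closed-star : ∀ {u v} r p s q → vertex r p ≡ u → vertex s q ≡ v → Star (SEdge S) u v → φ u ≡ c → C r p → C s q
      closed-star r p s q eq eq′ ε _ Crp with vertex-injective {r} {s} {p} {q} (trans eq (sym eq′))
      ... | refl , refl = Crp
      closed-star r p s q refl eq′ (_◅_ {j = w} st sts) φu Crp with coordinates w
      ... | t , o , refl = closed-star t o s q refl eq′ sts φw (closed Crp (step-link r p t o st) φw)
        where
        φw : label t o ≡ c
        φw = trans (sym (respects _ _ st)) φu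

      fibre-closed : ∀ {r p s q} → label r p ≡ c → label s q ≡ c → C r p → C s q
      fibre-closed {r} {p} {s} {q} rp sq = closed-star r p s q refl refl (connected _ _ (trans rp (sym sq))) rp

-- The chromatic symmetric function of the tower

T-ext : ∀ {a b} → (T a → T b) → (T b → T a) → a ≡ b
T-ext {true}  {true}  f g = refl
T-ext {true}  {false} f g = ⊥-elim (f _)
T-ext {false} {true}  f g = ⊥-elim (g _)
T-ext {false} {false} f g = refl

T-not-finEqᵇ : ∀ {k} {i j : Fin k} → T (not (finEqᵇ i j)) → i ≢ j
T-not-finEqᵇ {i = i} {j} t i≡j with i Fin.≟ j
... | no i≢j = i≢j i≡j

≢⇒T-not-finEqᵇ : ∀ {k} {i j : Fin k} → i ≢ j → T (not (finEqᵇ i j))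
≢⇒T-not-finEqᵇ {i = i} {j} i≢j with i Fin.≟ j
... | yes i≡j = i≢j i≡j
... | no _    = _

allᵇ-elim : ∀ {k} (p : Fin k → Bool) → T (allᵇ p (allFin k)) → ∀ i → T (p i)
allᵇ-elim {suc k} p t i with ∧-elim {p zero} (subst T (allᵇ-allFin-suc p) t) | i
... | t₀ , _  | zero  = t₀
... | _  , ts | suc i = allᵇ-elim (p ∘ suc) ts i

allᵇ-intro : ∀ {k} (p : Fin k → Bool) → (∀ i → T (p i)) → T (allᵇ p (allFin k))
allᵇ-intro {zero}  p t = _
allᵇ-intro {suc k} p t = subst T (sym (allᵇ-allFin-suc p)) (∧-intro {p zero} (t zero) (allᵇ-intro (p ∘ suc) (t ∘ suc)))

Properᵇ-elim : ∀ {N k} (G : Graph N) (κ : Fin N → Fin k) → T (Properᵇ G κ) → ∀ u v → Adj G u v → κ u ≢ κ v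
Properᵇ-elim {N} G κ t u v uv
  with allᵇ-elim (λ v → not (G u v) ∨ not (finEqᵇ (κ u) (κ v)))
    (allᵇ-elim (λ u → allᵇ (λ v → not (G u v) ∨ not (finEqᵇ (κ u) (κ v))) (allFin N)) t u) v
... | t′ rewrite uv = T-not-finEqᵇ t′

Properᵇ-intro : ∀ {N k} (G : Graph N) (κ : Fin N → Fin k) → (∀ u v → Adj G u v → κ u ≢ κ v) → T (Properᵇ G κ)
Properᵇ-intro {N} G κ proper =
  allᵇ-intro (λ u → allᵇ (λ v → not (G u v) ∨ not (finEqᵇ (κ u) (κ v))) (allFin N))
    (λ u → allᵇ-intro (λ v → not (G u v) ∨ not (finEqᵇ (κ u) (κ v))) (each u))
  where
  each : ∀ u v → T (not (G u v) ∨ not (finEqᵇ (κ u) (κ v)))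
  each u v with G u v in uv
  ... | false = _
  ... | true  = ≢⇒T-not-finEqᵇ (proper u v uv)

Properᵇ-cong : ∀ {N k} (G : Graph N) {κ κ′ : Fin N → Fin k} → (∀ u → κ u ≡ κ′ u) → Properᵇ G κ ≡ Properᵇ G κ′
Properᵇ-cong {N} G eq = allᵇ-cong (allFin N) (λ u → allᵇ-cong (allFin N) (λ v →
  cong₂ (λ i j → not (G u v) ∨ not (finEqᵇ i j)) (eq u) (eq v)))

pathᵇ-elim : ∀ {m k} (κ : Fin (suc m) → Fin k) → T (pathᵇ κ) → ∀ p q → toℕ q ≡ suc (toℕ p) → κ p ≢ κ q
pathᵇ-elim {suc m} κ t p q eq with ∧-elim {not (finEqᵇ (κ zero) (κ (suc zero)))} t
pathᵇ-elim {suc m} κ t zero    (suc zero) eq | t₀ , _ = T-not-finEqᵇ t₀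
pathᵇ-elim {suc m} κ t (suc p) (suc q)    eq | _ , ts = pathᵇ-elim (κ ∘ suc) ts p q (ℕ.suc-injective eq)
pathᵇ-elim {zero}  κ t zero    zero       ()

pathᵇ-intro : ∀ {m k} (κ : Fin (suc m) → Fin k) → (∀ p q → toℕ q ≡ suc (toℕ p) → κ p ≢ κ q) → T (pathᵇ κ)
pathᵇ-intro {zero}  κ proper = _
pathᵇ-intro {suc m} κ proper = ∧-intro {not (finEqᵇ (κ zero) (κ (suc zero)))}
  (≢⇒T-not-finEqᵇ (proper zero (suc zero) refl)) (pathᵇ-intro (κ ∘ suc) (λ p q eq → proper (suc p) (suc q) (cong suc eq)))

-- In each comparison the variable that is summed first stands on the right, where `∑-δ` contracts
-- it.
distinctᵇ : ∀ {k} → Fin k → Fin k → Fin k → Bool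
distinctᵇ a b c = not (finEqᵇ b a) ∧ not (finEqᵇ c a) ∧ not (finEqᵇ c b)

distinctᵇ-elim : ∀ {k} {a b c : Fin k} → T (distinctᵇ a b c) → a ≢ b × a ≢ c × b ≢ c
distinctᵇ-elim {a = a} {b} {c} t with ∧-elim {not (finEqᵇ b a)} t
... | ba , t′ with ∧-elim {not (finEqᵇ c a)} t′
...   | ca , cb = ≢-sym (T-not-finEqᵇ ba) , ≢-sym (T-not-finEqᵇ ca) , ≢-sym (T-not-finEqᵇ cb)

distinctᵇ-intro : ∀ {k} {a b c : Fin k} → a ≢ b → a ≢ c → b ≢ c → T (distinctᵇ a b c)
distinctᵇ-intro {a = a} {b} {c} a≢b a≢c b≢c = ∧-intro {not (finEqᵇ b a)} (≢⇒T-not-finEqᵇ (≢-sym a≢b))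
  (∧-intro {not (finEqᵇ c a)} (≢⇒T-not-finEqᵇ (≢-sym a≢c)) (≢⇒T-not-finEqᵇ (≢-sym b≢c)))

D : ∀ {k} → Fin k → Fin k → Fin k → ℚ
D a b c = ⟦ distinctᵇ a b c ⟧

++-cong : ∀ {m k} {α α′ : Fin m → A} (β : Fin k → A) → (∀ i → α i ≡ α′ i) → ∀ i → (α ++ᶠ β) i ≡ (α′ ++ᶠ β) i
++-cong {m = m} β eq i with splitAt m i
... | inj₁ j = eq j
... | inj₂ _ = refl

module _ (m : ℕ) where
  open Tower m

  module _ {k : ℕ} (κ₀ κ₁ κ₂ : Fin n → Fin k) where

    private
      κ : Fin (n + n + n) → Fin k
      κ = (κ₀ ++ᶠ κ₁) ++ᶠ κ₂

      column : Fin 3 → Fin n → Fin k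
      column zero             = κ₀
      column (suc zero)       = κ₁
      column (suc (suc zero)) = κ₂

      κ-vertex : ∀ r p → κ (vertex r p) ≡ column r p
      κ-vertex zero             p = trans (lookup-++ˡ (κ₀ ++ᶠ κ₁) κ₂ (p ↑ˡ n)) (lookup-++ˡ κ₀ κ₁ p)
      κ-vertex (suc zero)       p = trans (lookup-++ˡ (κ₀ ++ᶠ κ₁) κ₂ (n ↑ʳ p)) (lookup-++ʳ κ₀ κ₁ p)
      κ-vertex (suc (suc zero)) p = lookup-++ʳ (κ₀ ++ᶠ κ₁) κ₂ p

      last : Fin n
      last = fromℕ m

      towerᵇ : Bool
      towerᵇ = pathᵇ κ₀ ∧ pathᵇ κ₁ ∧ pathᵇ κ₂ ∧ distinctᵇ (κ₀ zero) (κ₁ zero) (κ₂ zero) ∧ distinctᵇ (κ₀ last) (κ₁ last) (κ₂ last)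

      level : ∀ {p} → T (distinctᵇ (κ₀ p) (κ₁ p) (κ₂ p)) → ∀ {r s q q′} → r ≢ s → toℕ q ≡ toℕ p → toℕ q′ ≡ toℕ p → column r q ≢ column s q′
      level {p} t {r} {s} r≢s q≡p q′≡p with Fin.toℕ-injective q≡p | Fin.toℕ-injective q′≡p | distinctᵇ-elim {a = κ₀ p} {κ₁ p} {κ₂ p} t
      ... | refl | refl | a≢b , a≢c , b≢c = go r s r≢s
        where
        go : ∀ r s → r ≢ s → column r p ≢ column s p
        go zero zero r≢s = contradiction refl r≢s
        go zero (suc zero) _ = a≢b
        go zero (suc (suc zero)) _ = a≢c
        go (suc zero) zero _ = ≢-sym a≢b
        go (suc zero) (suc zero) r≢s = contradiction refl r≢s
        go (suc zero) (suc (suc zero)) _ = b≢c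
        go (suc (suc zero)) zero _ = ≢-sym a≢c
        go (suc (suc zero)) (suc zero) _ = ≢-sym b≢c
        go (suc (suc zero)) (suc (suc zero)) r≢s = contradiction refl r≢s

    -- The edges are those of three paths and two triangles, so the paths interact through their end
    -- colours only.
    Properᵇ-tower : Properᵇ G κ ≡ towerᵇ
    Properᵇ-tower = T-ext to from
      where
      to : T (Properᵇ G κ) → T towerᵇ
      to t = ∧-intro {pathᵇ κ₀} (path zero) (∧-intro {pathᵇ κ₁} (path (suc zero)) (∧-intro {pathᵇ κ₂} (path (suc (suc zero)))
        (∧-intro {distinctᵇ (κ₀ zero) (κ₁ zero) (κ₂ zero)} (rung zero (λ r≢s → top r≢s refl refl))
          (rung last (λ r≢s → bottom r≢s (Fin.toℕ-fromℕ m) (Fin.toℕ-fromℕ m))))))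
        where
        proper : ∀ {r p s q} → Link r p s q → column r p ≢ column s q
        proper {r} {p} {s} {q} l = subst₂ _≢_ (κ-vertex r p) (κ-vertex s q) (Properᵇ-elim G κ t (vertex r p) (vertex s q) (link⇒adj l))
        path : ∀ r → T (pathᵇ (column r))
        path r = pathᵇ-intro (column r) (λ p q eq → proper {r} (forward eq))
        rung : ∀ p → (∀ {r s} → r ≢ s → Link r p s p) → T (distinctᵇ (κ₀ p) (κ₁ p) (κ₂ p))
        rung p link = distinctᵇ-intro (proper {zero} {p} {suc zero} {p} (link λ ()))
          (proper {zero} {p} {suc (suc zero)} {p} (link λ ())) (proper {suc zero} {p} {suc (suc zero)} {p} (link λ ()))
      from : T towerᵇ → T (Properᵇ G κ)
      from t with ∧-elim {pathᵇ κ₀} t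
      ... | t₀ , t′ with ∧-elim {pathᵇ κ₁} t′
      ...   | t₁ , t″ with ∧-elim {pathᵇ κ₂} t″
      ...     | t₂ , t‴ with ∧-elim {distinctᵇ (κ₀ zero) (κ₁ zero) (κ₂ zero)} t‴
      ...       | tt , tb = Properᵇ-intro G κ proper
        where
        path : ∀ r → T (pathᵇ (column r))
        path zero             = t₀
        path (suc zero)       = t₁
        path (suc (suc zero)) = t₂
        link-proper : ∀ {r p s q} → Link r p s q → column r p ≢ column s q
        link-proper {r} {p} {_} {q} (forward eq)  = pathᵇ-elim (column r) (path r) p q eq
        link-proper {r} {p} {_} {q} (backward eq) = ≢-sym (pathᵇ-elim (column r) (path r) q p eq)
        link-proper (top r≢s p≡ q≡)    = level tt r≢s p≡ q≡
        link-proper (bottom r≢s p≡ q≡) = level tb r≢s (trans p≡ (sym (Fin.toℕ-fromℕ m))) (trans q≡ (sym (Fin.toℕ-fromℕ m)))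
        proper : ∀ u v → Adj G u v → κ u ≢ κ v
        proper u v uv with coordinates u | coordinates v
        ... | r , p , refl | s , q , refl = subst₂ _≢_ (sym (κ-vertex r p)) (sym (κ-vertex s q)) (link-proper (adj⇒link r p s q uv))

-- Sums over the colours of the two triangles

∑-lin₅ : ∀ (xs : List A) (a b c d e : A → ℚ) →
  ∑ xs (λ x → a x -ℚ b x -ℚ c x -ℚ d x +ℚ e x) ≡ ∑ xs a -ℚ ∑ xs b -ℚ ∑ xs c -ℚ ∑ xs d +ℚ ∑ xs e
∑-lin₅ xs a b c d e = trans (∑-+ xs (λ x → a x -ℚ b x -ℚ c x -ℚ d x) e) (cong (_+ℚ ∑ xs e)
  (trans (∑-- xs (λ x → a x -ℚ b x -ℚ c x) d) (cong (_-ℚ ∑ xs d)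
    (trans (∑-- xs (λ x → a x -ℚ b x) c) (cong (_-ℚ ∑ xs c) (∑-- xs a b))))))

δ : ∀ {k} → Fin k → Fin k → ℚ
δ i j = ⟦ finEqᵇ i j ⟧

-- Multiply out the three factors 1 - δ. Any two of the equalities imply the third, so the three
-- double products and the triple product coincide, with total coefficient 3 - 1 = 2.
D-expand : ∀ {k} (a b c : Fin k) →
  D a b c ≡ 1ℚ -ℚ δ b a -ℚ δ c a -ℚ δ c b +ℚ (1ℚ +ℚ 1ℚ) *ℚ (δ b a *ℚ δ c b)
D-expand a b c with b Fin.≟ a | c Fin.≟ a | c Fin.≟ b
... | yes refl | yes refl | yes _ = refl
... | yes refl | yes refl | no ¬p = contradiction refl ¬p
... | yes refl | no ¬p | yes refl = contradiction refl ¬p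
... | yes refl | no _  | no _     = refl
... | no ¬p | yes refl | yes refl = contradiction refl ¬p
... | no _  | yes refl | no _     = refl
... | no _  | no _     | yes refl = refl
... | no _  | no _     | no _     = refl

-- Möbius inversion over the partitions of a three-element set, with coefficients 1, -1 and 2.
∑-distinct : ∀ {k} (a b c : Fin k → ℚ) → let F = allFin k in
  ∑ F (λ z → ∑ F (λ y → ∑ F (λ x → D x y z *ℚ (a x *ℚ b y *ℚ c z)))) ≡
  ∑ F a *ℚ ∑ F b *ℚ ∑ F c -ℚ ∑ F (λ x → a x *ℚ b x) *ℚ ∑ F c -ℚ ∑ F (λ x → a x *ℚ c x) *ℚ ∑ F b
    -ℚ ∑ F (λ x → b x *ℚ c x) *ℚ ∑ F a +ℚ (1ℚ +ℚ 1ℚ) *ℚ ∑ F (λ x → a x *ℚ b x *ℚ c x)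
∑-distinct {k} a b c = begin
  ∑ F (λ z → ∑ F (λ y → ∑ F (λ x → D x y z *ℚ (a x *ℚ b y *ℚ c z))))
    ≡⟨ ∑-cong F (λ z → ∑-cong F (λ y → sum-x y z)) ⟩
  ∑ F (λ z → ∑ F (λ y → (Σa *ℚ c z) *ℚ b y -ℚ c z *ℚ (a y *ℚ b y) -ℚ (a z *ℚ c z) *ℚ b y -ℚ δ z y *ℚ (Σa *ℚ b y *ℚ c z) +ℚ δ z y *ℚ (2ℚ *ℚ (a y *ℚ b y *ℚ c z))))
    ≡⟨ ∑-cong F sum-y ⟩
  ∑ F (λ z → (Σa *ℚ Σb) *ℚ c z -ℚ Σab *ℚ c z -ℚ Σb *ℚ (a z *ℚ c z) -ℚ Σa *ℚ (b z *ℚ c z) +ℚ 2ℚ *ℚ (a z *ℚ b z *ℚ c z))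
    ≡⟨ ∑-lin₅ F (λ z → (Σa *ℚ Σb) *ℚ c z) (λ z → Σab *ℚ c z) (λ z → Σb *ℚ (a z *ℚ c z)) (λ z → Σa *ℚ (b z *ℚ c z)) (λ z → 2ℚ *ℚ (a z *ℚ b z *ℚ c z)) ⟩
  ∑ F (λ z → (Σa *ℚ Σb) *ℚ c z) -ℚ ∑ F (λ z → Σab *ℚ c z) -ℚ ∑ F (λ z → Σb *ℚ (a z *ℚ c z)) -ℚ ∑ F (λ z → Σa *ℚ (b z *ℚ c z)) +ℚ ∑ F (λ z → 2ℚ *ℚ (a z *ℚ b z *ℚ c z))
    ≡⟨ cong₂ _+ℚ_ (cong₂ _-ℚ_ (cong₂ _-ℚ_ (cong₂ _-ℚ_ (∑-* F (Σa *ℚ Σb) c) (∑-* F Σab c)) (trans (∑-* F Σb (λ z → a z *ℚ c z)) (ℚ.*-comm Σb _)))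
         (trans (∑-* F Σa (λ z → b z *ℚ c z)) (ℚ.*-comm Σa _))) (∑-* F 2ℚ (λ z → a z *ℚ b z *ℚ c z)) ⟩
  Σa *ℚ Σb *ℚ ∑ F c -ℚ Σab *ℚ ∑ F c -ℚ ∑ F (λ x → a x *ℚ c x) *ℚ Σb -ℚ ∑ F (λ x → b x *ℚ c x) *ℚ Σa +ℚ 2ℚ *ℚ ∑ F (λ x → a x *ℚ b x *ℚ c x) ∎
  where
  F = allFin k
  Σa = ∑ F a
  Σb = ∑ F b
  Σab = ∑ F (λ x → a x *ℚ b x)
  2ℚ = 1ℚ +ℚ 1ℚ
  distribute : ∀ d₁ d₂ d₃ a b c → (1ℚ -ℚ d₁ -ℚ d₂ -ℚ d₃ +ℚ (1ℚ +ℚ 1ℚ) *ℚ (d₁ *ℚ d₃)) *ℚ (a *ℚ b *ℚ c) ≡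
    (b *ℚ c) *ℚ a -ℚ d₁ *ℚ (a *ℚ b *ℚ c) -ℚ d₂ *ℚ (a *ℚ b *ℚ c) -ℚ (d₃ *ℚ b *ℚ c) *ℚ a +ℚ d₁ *ℚ ((1ℚ +ℚ 1ℚ) *ℚ d₃ *ℚ (a *ℚ b *ℚ c))
  distribute = solve-∀ ℚ-ring
  collect : ∀ d a a′ Σa b c → (b *ℚ c) *ℚ Σa -ℚ a *ℚ b *ℚ c -ℚ a′ *ℚ b *ℚ c -ℚ (d *ℚ b *ℚ c) *ℚ Σa +ℚ (1ℚ +ℚ 1ℚ) *ℚ d *ℚ (a *ℚ b *ℚ c) ≡
    (Σa *ℚ c) *ℚ b -ℚ c *ℚ (a *ℚ b) -ℚ (a′ *ℚ c) *ℚ b -ℚ d *ℚ (Σa *ℚ b *ℚ c) +ℚ d *ℚ ((1ℚ +ℚ 1ℚ) *ℚ (a *ℚ b *ℚ c))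
  collect = solve-∀ ℚ-ring
  sum-x : ∀ y z → ∑ F (λ x → D x y z *ℚ (a x *ℚ b y *ℚ c z)) ≡
    (Σa *ℚ c z) *ℚ b y -ℚ c z *ℚ (a y *ℚ b y) -ℚ (a z *ℚ c z) *ℚ b y -ℚ δ z y *ℚ (Σa *ℚ b y *ℚ c z) +ℚ δ z y *ℚ (2ℚ *ℚ (a y *ℚ b y *ℚ c z))
  sum-x y z = begin
    ∑ F (λ x → D x y z *ℚ (a x *ℚ b y *ℚ c z))
      ≡⟨ ∑-cong F (λ x → trans (cong (_*ℚ (a x *ℚ b y *ℚ c z)) (D-expand x y z)) (distribute (δ y x) (δ z x) (δ z y) (a x) (b y) (c z))) ⟩
    ∑ F (λ x → (b y *ℚ c z) *ℚ a x -ℚ δ y x *ℚ (a x *ℚ b y *ℚ c z) -ℚ δ z x *ℚ (a x *ℚ b y *ℚ c z) -ℚ (δ z y *ℚ b y *ℚ c z) *ℚ a x +ℚ δ y x *ℚ (2ℚ *ℚ δ z y *ℚ (a x *ℚ b y *ℚ c z)))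
      ≡⟨ ∑-lin₅ F (λ x → (b y *ℚ c z) *ℚ a x) (λ x → δ y x *ℚ (a x *ℚ b y *ℚ c z)) (λ x → δ z x *ℚ (a x *ℚ b y *ℚ c z))
           (λ x → (δ z y *ℚ b y *ℚ c z) *ℚ a x) (λ x → δ y x *ℚ (2ℚ *ℚ δ z y *ℚ (a x *ℚ b y *ℚ c z))) ⟩
    ∑ F (λ x → (b y *ℚ c z) *ℚ a x) -ℚ ∑ F (λ x → δ y x *ℚ (a x *ℚ b y *ℚ c z)) -ℚ ∑ F (λ x → δ z x *ℚ (a x *ℚ b y *ℚ c z))
      -ℚ ∑ F (λ x → (δ z y *ℚ b y *ℚ c z) *ℚ a x) +ℚ ∑ F (λ x → δ y x *ℚ (2ℚ *ℚ δ z y *ℚ (a x *ℚ b y *ℚ c z)))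
      ≡⟨ cong₂ _+ℚ_ (cong₂ _-ℚ_ (cong₂ _-ℚ_ (cong₂ _-ℚ_ (∑-* F (b y *ℚ c z) a) (∑-δ y (λ x → a x *ℚ b y *ℚ c z)))
           (∑-δ z (λ x → a x *ℚ b y *ℚ c z))) (∑-* F (δ z y *ℚ b y *ℚ c z) a)) (∑-δ y (λ x → 2ℚ *ℚ δ z y *ℚ (a x *ℚ b y *ℚ c z))) ⟩
    (b y *ℚ c z) *ℚ Σa -ℚ a y *ℚ b y *ℚ c z -ℚ a z *ℚ b y *ℚ c z -ℚ (δ z y *ℚ b y *ℚ c z) *ℚ Σa +ℚ 2ℚ *ℚ δ z y *ℚ (a y *ℚ b y *ℚ c z)
      ≡⟨ collect (δ z y) (a y) (a z) Σa (b y) (c z) ⟩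
    (Σa *ℚ c z) *ℚ b y -ℚ c z *ℚ (a y *ℚ b y) -ℚ (a z *ℚ c z) *ℚ b y -ℚ δ z y *ℚ (Σa *ℚ b y *ℚ c z) +ℚ δ z y *ℚ (2ℚ *ℚ (a y *ℚ b y *ℚ c z)) ∎
  tidy : ∀ Σa Σb Σab a b c → (Σa *ℚ c) *ℚ Σb -ℚ c *ℚ Σab -ℚ (a *ℚ c) *ℚ Σb -ℚ Σa *ℚ b *ℚ c +ℚ (1ℚ +ℚ 1ℚ) *ℚ (a *ℚ b *ℚ c) ≡
    (Σa *ℚ Σb) *ℚ c -ℚ Σab *ℚ c -ℚ Σb *ℚ (a *ℚ c) -ℚ Σa *ℚ (b *ℚ c) +ℚ (1ℚ +ℚ 1ℚ) *ℚ (a *ℚ b *ℚ c)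
  tidy = solve-∀ ℚ-ring
  sum-y : ∀ z → ∑ F (λ y → (Σa *ℚ c z) *ℚ b y -ℚ c z *ℚ (a y *ℚ b y) -ℚ (a z *ℚ c z) *ℚ b y -ℚ δ z y *ℚ (Σa *ℚ b y *ℚ c z) +ℚ δ z y *ℚ (2ℚ *ℚ (a y *ℚ b y *ℚ c z)))
    ≡ (Σa *ℚ Σb) *ℚ c z -ℚ Σab *ℚ c z -ℚ Σb *ℚ (a z *ℚ c z) -ℚ Σa *ℚ (b z *ℚ c z) +ℚ 2ℚ *ℚ (a z *ℚ b z *ℚ c z)
  sum-y z = begin
    ∑ F (λ y → (Σa *ℚ c z) *ℚ b y -ℚ c z *ℚ (a y *ℚ b y) -ℚ (a z *ℚ c z) *ℚ b y -ℚ δ z y *ℚ (Σa *ℚ b y *ℚ c z) +ℚ δ z y *ℚ (2ℚ *ℚ (a y *ℚ b y *ℚ c z)))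
      ≡⟨ ∑-lin₅ F (λ y → (Σa *ℚ c z) *ℚ b y) (λ y → c z *ℚ (a y *ℚ b y)) (λ y → (a z *ℚ c z) *ℚ b y)
           (λ y → δ z y *ℚ (Σa *ℚ b y *ℚ c z)) (λ y → δ z y *ℚ (2ℚ *ℚ (a y *ℚ b y *ℚ c z))) ⟩
    ∑ F (λ y → (Σa *ℚ c z) *ℚ b y) -ℚ ∑ F (λ y → c z *ℚ (a y *ℚ b y)) -ℚ ∑ F (λ y → (a z *ℚ c z) *ℚ b y)
      -ℚ ∑ F (λ y → δ z y *ℚ (Σa *ℚ b y *ℚ c z)) +ℚ ∑ F (λ y → δ z y *ℚ (2ℚ *ℚ (a y *ℚ b y *ℚ c z)))
      ≡⟨ cong₂ _+ℚ_ (cong₂ _-ℚ_ (cong₂ _-ℚ_ (cong₂ _-ℚ_ (∑-* F (Σa *ℚ c z) b) (∑-* F (c z) (λ y → a y *ℚ b y)))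
           (∑-* F (a z *ℚ c z) b)) (∑-δ z (λ y → Σa *ℚ b y *ℚ c z))) (∑-δ z (λ y → 2ℚ *ℚ (a y *ℚ b y *ℚ c z))) ⟩
    (Σa *ℚ c z) *ℚ Σb -ℚ c z *ℚ Σab -ℚ (a z *ℚ c z) *ℚ Σb -ℚ Σa *ℚ b z *ℚ c z +ℚ 2ℚ *ℚ (a z *ℚ b z *ℚ c z)
      ≡⟨ tidy Σa Σb Σab (a z) (b z) (c z) ⟩
    (Σa *ℚ Σb) *ℚ c z -ℚ Σab *ℚ c z -ℚ Σb *ℚ (a z *ℚ c z) -ℚ Σa *ℚ (b z *ℚ c z) +ℚ 2ℚ *ℚ (a z *ℚ b z *ℚ c z) ∎

δ-orthogonal : ∀ {k} {i j : Fin k} → i ≢ j → ∀ x → δ i x *ℚ δ j x ≡ 0ℚ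
δ-orthogonal {i = i} {j} i≢j x with i Fin.≟ x | j Fin.≟ x
... | yes refl | yes refl = contradiction refl i≢j
... | yes _    | no _     = refl
... | no _     | yes _    = refl
... | no _     | no _     = refl

∑-δ-1 : ∀ {k} (i : Fin k) → ∑ (allFin k) (δ i) ≡ 1ℚ
∑-δ-1 {k} i = trans (∑-cong (allFin k) (λ j → sym (ℚ.*-identityʳ (δ i j)))) (∑-δ i (λ _ → 1ℚ))

module _ (m : ℕ) where
  private
    n = suc m
    F = allFin n
    M = fromℕℚ m

    u : Fin n → Fin n → ℚ
    u i j = 1ℚ -ℚ M *ℚ δ i j

    ∑-1-M : ∀ (g : Fin n → ℚ) → ∑ F (λ j → 1ℚ -ℚ M *ℚ g j) ≡ 1ℚ +ℚ M -ℚ M *ℚ ∑ F g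
    ∑-1-M g = trans (∑-- F (λ _ → 1ℚ) (λ j → M *ℚ g j)) (cong₂ _-ℚ_ (trans (∑-1 n) (fromℕℚ-suc m)) (∑-* F M g))

  ∑-u : ∀ i → ∑ F (u i) ≡ 1ℚ
  ∑-u i = trans (∑-1-M (δ i)) (trans (cong (λ x → 1ℚ +ℚ M -ℚ M *ℚ x) (∑-δ-1 i)) (tidy M))
    where
    tidy : ∀ a → 1ℚ +ℚ a -ℚ a *ℚ 1ℚ ≡ 1ℚ
    tidy = solve-∀ ℚ-ring

  -- Products of the δ's of different colours vanish, so products of such rows stay affine in the
  -- δ's. Their sums are n - (n-1), n - 2 (n-1) and n - 3 (n-1) for one, two and three rows.
  u-* : ∀ {i j} → i ≢ j → ∀ x → u i x *ℚ u j x ≡ 1ℚ -ℚ M *ℚ (δ i x +ℚ δ j x)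
  u-* {i} {j} i≢j x = trans (expand M (δ i x) (δ j x)) (trans (cong (λ y → 1ℚ -ℚ M *ℚ (δ i x +ℚ δ j x) +ℚ M *ℚ M *ℚ y) (δ-orthogonal i≢j x))
    (tidy (1ℚ -ℚ M *ℚ (δ i x +ℚ δ j x)) M))
    where
    expand : ∀ m a b → (1ℚ -ℚ m *ℚ a) *ℚ (1ℚ -ℚ m *ℚ b) ≡ 1ℚ -ℚ m *ℚ (a +ℚ b) +ℚ m *ℚ m *ℚ (a *ℚ b)
    expand = solve-∀ ℚ-ring
    tidy : ∀ a m → a +ℚ m *ℚ m *ℚ 0ℚ ≡ a
    tidy = solve-∀ ℚ-ring

  ∑-uu : ∀ {i j} → i ≢ j → ∑ F (λ x → u i x *ℚ u j x) ≡ 1ℚ -ℚ M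
  ∑-uu {i} {j} i≢j = trans (∑-cong F (u-* i≢j)) (trans (∑-1-M (λ x → δ i x +ℚ δ j x))
    (trans (cong (λ x → 1ℚ +ℚ M -ℚ M *ℚ x) (trans (∑-+ F (δ i) (δ j)) (cong₂ _+ℚ_ (∑-δ-1 i) (∑-δ-1 j)))) (tidy M)))
    where
    tidy : ∀ a → 1ℚ +ℚ a -ℚ a *ℚ (1ℚ +ℚ 1ℚ) ≡ 1ℚ -ℚ a
    tidy = solve-∀ ℚ-ring

  ∑-uuu : ∀ {i j k} → i ≢ j → i ≢ k → j ≢ k → ∑ F (λ x → u i x *ℚ u j x *ℚ u k x) ≡ 1ℚ -ℚ M -ℚ M
  ∑-uuu {i} {j} {k} i≢j i≢k j≢k = begin
    ∑ F (λ x → u i x *ℚ u j x *ℚ u k x)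
      ≡⟨ ∑-cong F (λ x → trans (cong (_*ℚ u k x) (u-* i≢j x)) (trans (expand M (δ i x) (δ j x) (δ k x))
           (trans (cong₂ (λ y z → 1ℚ -ℚ M *ℚ (δ i x +ℚ δ j x +ℚ δ k x) +ℚ M *ℚ M *ℚ (y +ℚ z)) (δ-orthogonal i≢k x) (δ-orthogonal j≢k x))
             (drop (1ℚ -ℚ M *ℚ (δ i x +ℚ δ j x +ℚ δ k x)) M)))) ⟩
    ∑ F (λ x → 1ℚ -ℚ M *ℚ (δ i x +ℚ δ j x +ℚ δ k x))
      ≡⟨ ∑-1-M (λ x → δ i x +ℚ δ j x +ℚ δ k x) ⟩
    1ℚ +ℚ M -ℚ M *ℚ ∑ F (λ x → δ i x +ℚ δ j x +ℚ δ k x)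
      ≡⟨ cong (λ x → 1ℚ +ℚ M -ℚ M *ℚ x) (trans (∑-+ F (λ x → δ i x +ℚ δ j x) (δ k))
           (cong₂ _+ℚ_ (trans (∑-+ F (δ i) (δ j)) (cong₂ _+ℚ_ (∑-δ-1 i) (∑-δ-1 j))) (∑-δ-1 k))) ⟩
    1ℚ +ℚ M -ℚ M *ℚ (1ℚ +ℚ 1ℚ +ℚ 1ℚ)
      ≡⟨ tidy M ⟩
    1ℚ -ℚ M -ℚ M ∎
    where
    expand : ∀ m a b c → (1ℚ -ℚ m *ℚ (a +ℚ b)) *ℚ (1ℚ -ℚ m *ℚ c) ≡ 1ℚ -ℚ m *ℚ (a +ℚ b +ℚ c) +ℚ m *ℚ m *ℚ (a *ℚ c +ℚ b *ℚ c)
    expand = solve-∀ ℚ-ring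
    drop : ∀ a m → a +ℚ m *ℚ m *ℚ (0ℚ +ℚ 0ℚ) ≡ a
    drop = solve-∀ ℚ-ring
    tidy : ∀ a → 1ℚ +ℚ a -ℚ a *ℚ (1ℚ +ℚ 1ℚ +ℚ 1ℚ) ≡ 1ℚ -ℚ a -ℚ a
    tidy = solve-∀ ℚ-ring

  bottoms : Fin n → Fin n → Fin n → ℚ
  bottoms i₀ i₁ i₂ = ∑ F (λ z → ∑ F (λ y → ∑ F (λ x → D x y z *ℚ (u i₀ x *ℚ u i₁ y *ℚ u i₂ z))))

  -- `∑-distinct` gives 1 - 3 (1 - M) + 2 (1 - 2M), whatever the three distinct colours are. This is
  -- where the sign turns negative.
  bottoms-eval : ∀ {i₀ i₁ i₂} → i₀ ≢ i₁ → i₀ ≢ i₂ → i₁ ≢ i₂ → bottoms i₀ i₁ i₂ ≡ -ℚ M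
  bottoms-eval {i₀} {i₁} {i₂} p q r = trans (∑-distinct (u i₀) (u i₁) (u i₂)) (trans (combine (∑-u i₀) (∑-u i₁) (∑-u i₂) (∑-uu p) (∑-uu q) (∑-uu r) (∑-uuu p q r)) (tidy M))
    where
    tidy : ∀ m → 1ℚ *ℚ 1ℚ *ℚ 1ℚ -ℚ (1ℚ -ℚ m) *ℚ 1ℚ -ℚ (1ℚ -ℚ m) *ℚ 1ℚ -ℚ (1ℚ -ℚ m) *ℚ 1ℚ +ℚ (1ℚ +ℚ 1ℚ) *ℚ (1ℚ -ℚ m -ℚ m) ≡ -ℚ m
    tidy = solve-∀ ℚ-ring
    combine : ∀ {a b c ab ac bc abc a′ b′ c′ ab′ ac′ bc′ abc′} → a ≡ a′ → b ≡ b′ → c ≡ c′ → ab ≡ ab′ → ac ≡ ac′ → bc ≡ bc′ → abc ≡ abc′ →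
      a *ℚ b *ℚ c -ℚ ab *ℚ c -ℚ ac *ℚ b -ℚ bc *ℚ a +ℚ (1ℚ +ℚ 1ℚ) *ℚ abc ≡ a′ *ℚ b′ *ℚ c′ -ℚ ab′ *ℚ c′ -ℚ ac′ *ℚ b′ -ℚ bc′ *ℚ a′ +ℚ (1ℚ +ℚ 1ℚ) *ℚ abc′
    combine refl refl refl refl refl refl refl = refl

  D*bottoms : ∀ i₀ i₁ i₂ → D i₀ i₁ i₂ *ℚ bottoms i₀ i₁ i₂ ≡ D i₀ i₁ i₂ *ℚ (-ℚ M)
  D*bottoms i₀ i₁ i₂ with distinctᵇ i₀ i₁ i₂ in eq
  ... | false = trans (ℚ.*-zeroˡ (bottoms i₀ i₁ i₂)) (sym (ℚ.*-zeroˡ (-ℚ M)))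
  ... | true with distinctᵇ-elim {a = i₀} {i₁} {i₂} (subst T (sym eq) _)
  ...   | p , q , r = cong (1ℚ *ℚ_) (bottoms-eval p q r)

  -- The falling factorial n (n-1) (n-2), obtained from n³ - 3 n² + 2 n with n = 1 + M.
  ∑-D : ∑ F (λ z → ∑ F (λ y → ∑ F (λ x → D x y z))) ≡ (1ℚ +ℚ M) *ℚ M *ℚ (M -ℚ 1ℚ)
  ∑-D = begin
    ∑ F (λ z → ∑ F (λ y → ∑ F (λ x → D x y z)))
      ≡⟨ ∑-cong F (λ z → ∑-cong F (λ y → ∑-cong F (λ x → ℚ.*-identityʳ (D x y z)))) ⟨
    ∑ F (λ z → ∑ F (λ y → ∑ F (λ x → D x y z *ℚ (1ℚ *ℚ 1ℚ *ℚ 1ℚ))))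
      ≡⟨ ∑-distinct {n} (λ _ → 1ℚ) (λ _ → 1ℚ) (λ _ → 1ℚ) ⟩
    N′ *ℚ N′ *ℚ N′ -ℚ N′ *ℚ N′ -ℚ N′ *ℚ N′ -ℚ N′ *ℚ N′ +ℚ (1ℚ +ℚ 1ℚ) *ℚ N′
      ≡⟨ cong (λ x → x *ℚ x *ℚ x -ℚ x *ℚ x -ℚ x *ℚ x -ℚ x *ℚ x +ℚ (1ℚ +ℚ 1ℚ) *ℚ x) (trans (∑-1 n) (fromℕℚ-suc m)) ⟩
    (1ℚ +ℚ M) *ℚ (1ℚ +ℚ M) *ℚ (1ℚ +ℚ M) -ℚ (1ℚ +ℚ M) *ℚ (1ℚ +ℚ M) -ℚ (1ℚ +ℚ M) *ℚ (1ℚ +ℚ M) -ℚ (1ℚ +ℚ M) *ℚ (1ℚ +ℚ M) +ℚ (1ℚ +ℚ 1ℚ) *ℚ (1ℚ +ℚ M)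
      ≡⟨ tidy M ⟩
    (1ℚ +ℚ M) *ℚ M *ℚ (M -ℚ 1ℚ) ∎
    where
    N′ = ∑ F (λ _ → 1ℚ)
    tidy : ∀ m → (1ℚ +ℚ m) *ℚ (1ℚ +ℚ m) *ℚ (1ℚ +ℚ m) -ℚ (1ℚ +ℚ m) *ℚ (1ℚ +ℚ m) -ℚ (1ℚ +ℚ m) *ℚ (1ℚ +ℚ m) -ℚ (1ℚ +ℚ m) *ℚ (1ℚ +ℚ m) +ℚ (1ℚ +ℚ 1ℚ) *ℚ (1ℚ +ℚ m)
      ≡ (1ℚ +ℚ m) *ℚ m *ℚ (m -ℚ 1ℚ)
    tidy = solve-∀ ℚ-ring

  -- The bracketing is the one that three successive uses of `pathSum-full` produce; `nested-eval`
  -- reorders it to sum over the bottom triangle first.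
  nested : ℚ
  nested = ∑ F (λ i₂ → ∑ F (λ j₂ → ∑ F (λ i₁ → ∑ F (λ j₁ → ∑ F (λ i₀ → ∑ F (λ j₀ →
    D i₀ i₁ i₂ *ℚ D j₀ j₁ j₂ *ℚ u i₀ j₀)) *ℚ u i₁ j₁)) *ℚ u i₂ j₂))

  ∑-pull : ∀ (g : Fin n → Fin n → ℚ) (w : Fin n → ℚ) →
    ∑ F (λ j → ∑ F (λ i → g i j) *ℚ w j) ≡ ∑ F (λ i → ∑ F (λ j → g i j *ℚ w j))
  ∑-pull g w = trans (∑-cong F (λ j → sym (∑-*ʳ F (λ i → g i j) (w j)))) (∑-swap F F (λ j i → g i j *ℚ w j))

  nested-eval : nested ≡ (1ℚ +ℚ M) *ℚ M *ℚ (M -ℚ 1ℚ) *ℚ (-ℚ M)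
  nested-eval = begin
    ∑ F (λ i₂ → ∑ F (λ j₂ → ∑ F (λ i₁ → ∑ F (λ j₁ → ∑ F (λ i₀ → ∑ F (λ j₀ → d i₀ i₁ i₂ j₀ j₁ j₂)) *ℚ u i₁ j₁)) *ℚ u i₂ j₂))
      ≡⟨ ∑-cong F (λ i₂ → begin
           ∑ F (λ j₂ → ∑ F (λ i₁ → ∑ F (λ j₁ → ∑ F (λ i₀ → ∑ F (λ j₀ → d i₀ i₁ i₂ j₀ j₁ j₂)) *ℚ u i₁ j₁)) *ℚ u i₂ j₂)
             ≡⟨ ∑-cong F (λ j₂ → cong (_*ℚ u i₂ j₂) (∑-cong F (λ i₁ →
                  ∑-pull (λ i₀ j₁ → ∑ F (λ j₀ → d i₀ i₁ i₂ j₀ j₁ j₂)) (u i₁)))) ⟩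
           ∑ F (λ j₂ → ∑ F (λ i₁ → ∑ F (λ i₀ → e₁ i₀ i₁ i₂ j₂)) *ℚ u i₂ j₂)
             ≡⟨ ∑-pull (λ i₁ j₂ → ∑ F (λ i₀ → e₁ i₀ i₁ i₂ j₂)) (u i₂) ⟩
           ∑ F (λ i₁ → ∑ F (λ j₂ → ∑ F (λ i₀ → e₁ i₀ i₁ i₂ j₂) *ℚ u i₂ j₂))
             ≡⟨ ∑-cong F (λ i₁ → begin
                  ∑ F (λ j₂ → ∑ F (λ i₀ → e₁ i₀ i₁ i₂ j₂) *ℚ u i₂ j₂)  ≡⟨ ∑-pull (λ i₀ j₂ → e₁ i₀ i₁ i₂ j₂) (u i₂) ⟩
                  ∑ F (λ i₀ → ∑ F (λ j₂ → e₁ i₀ i₁ i₂ j₂ *ℚ u i₂ j₂))  ≡⟨ ∑-cong F (λ i₀ → inner i₀ i₁ i₂) ⟩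
                  ∑ F (λ i₀ → D i₀ i₁ i₂ *ℚ (-ℚ M))                    ≡⟨ ∑-*ʳ F (λ i₀ → D i₀ i₁ i₂) (-ℚ M) ⟩
                  ∑ F (λ i₀ → D i₀ i₁ i₂) *ℚ (-ℚ M)                    ∎) ⟩
           ∑ F (λ i₁ → ∑ F (λ i₀ → D i₀ i₁ i₂) *ℚ (-ℚ M))
             ≡⟨ ∑-*ʳ F (λ i₁ → ∑ F (λ i₀ → D i₀ i₁ i₂)) (-ℚ M) ⟩
           ∑ F (λ i₁ → ∑ F (λ i₀ → D i₀ i₁ i₂)) *ℚ (-ℚ M) ∎) ⟩
    ∑ F (λ i₂ → ∑ F (λ i₁ → ∑ F (λ i₀ → D i₀ i₁ i₂)) *ℚ (-ℚ M))
      ≡⟨ ∑-*ʳ F (λ i₂ → ∑ F (λ i₁ → ∑ F (λ i₀ → D i₀ i₁ i₂))) (-ℚ M) ⟩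
    ∑ F (λ i₂ → ∑ F (λ i₁ → ∑ F (λ i₀ → D i₀ i₁ i₂))) *ℚ (-ℚ M)
      ≡⟨ cong (_*ℚ (-ℚ M)) ∑-D ⟩
    (1ℚ +ℚ M) *ℚ M *ℚ (M -ℚ 1ℚ) *ℚ (-ℚ M) ∎
    where
    d : (i₀ i₁ i₂ j₀ j₁ j₂ : Fin n) → ℚ
    d i₀ i₁ i₂ j₀ j₁ j₂ = D i₀ i₁ i₂ *ℚ D j₀ j₁ j₂ *ℚ u i₀ j₀
    e₁ : (i₀ i₁ i₂ j₂ : Fin n) → ℚ
    e₁ i₀ i₁ i₂ j₂ = ∑ F (λ j₁ → ∑ F (λ j₀ → d i₀ i₁ i₂ j₀ j₁ j₂) *ℚ u i₁ j₁)
    regroup : ∀ d d′ a b c → d *ℚ d′ *ℚ a *ℚ b *ℚ c ≡ d *ℚ (d′ *ℚ (a *ℚ b *ℚ c))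
    regroup = solve-∀ ℚ-ring
    inner : ∀ i₀ i₁ i₂ → ∑ F (λ j₂ → e₁ i₀ i₁ i₂ j₂ *ℚ u i₂ j₂) ≡ D i₀ i₁ i₂ *ℚ (-ℚ M)
    inner i₀ i₁ i₂ = begin
      ∑ F (λ j₂ → e₁ i₀ i₁ i₂ j₂ *ℚ u i₂ j₂)
        ≡⟨ ∑-cong F (λ j₂ → begin
             e₁ i₀ i₁ i₂ j₂ *ℚ u i₂ j₂
               ≡⟨ ∑-*ʳ F (λ j₁ → ∑ F (λ j₀ → d i₀ i₁ i₂ j₀ j₁ j₂) *ℚ u i₁ j₁) (u i₂ j₂) ⟨
             ∑ F (λ j₁ → ∑ F (λ j₀ → d i₀ i₁ i₂ j₀ j₁ j₂) *ℚ u i₁ j₁ *ℚ u i₂ j₂)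
               ≡⟨ ∑-cong F (λ j₁ → begin
                    ∑ F (λ j₀ → d i₀ i₁ i₂ j₀ j₁ j₂) *ℚ u i₁ j₁ *ℚ u i₂ j₂
                      ≡⟨ cong (_*ℚ u i₂ j₂) (∑-*ʳ F (λ j₀ → d i₀ i₁ i₂ j₀ j₁ j₂) (u i₁ j₁)) ⟨
                    ∑ F (λ j₀ → d i₀ i₁ i₂ j₀ j₁ j₂ *ℚ u i₁ j₁) *ℚ u i₂ j₂
                      ≡⟨ ∑-*ʳ F (λ j₀ → d i₀ i₁ i₂ j₀ j₁ j₂ *ℚ u i₁ j₁) (u i₂ j₂) ⟨
                    ∑ F (λ j₀ → d i₀ i₁ i₂ j₀ j₁ j₂ *ℚ u i₁ j₁ *ℚ u i₂ j₂)
                      ≡⟨ ∑-cong F (λ j₀ → regroup (D i₀ i₁ i₂) (D j₀ j₁ j₂) (u i₀ j₀) (u i₁ j₁) (u i₂ j₂)) ⟩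
                    ∑ F (λ j₀ → D i₀ i₁ i₂ *ℚ b i₀ i₁ i₂ j₀ j₁ j₂)
                      ≡⟨ ∑-* F (D i₀ i₁ i₂) (λ j₀ → b i₀ i₁ i₂ j₀ j₁ j₂) ⟩
                    D i₀ i₁ i₂ *ℚ ∑ F (λ j₀ → b i₀ i₁ i₂ j₀ j₁ j₂) ∎) ⟩
             ∑ F (λ j₁ → D i₀ i₁ i₂ *ℚ ∑ F (λ j₀ → b i₀ i₁ i₂ j₀ j₁ j₂))
               ≡⟨ ∑-* F (D i₀ i₁ i₂) (λ j₁ → ∑ F (λ j₀ → b i₀ i₁ i₂ j₀ j₁ j₂)) ⟩
             D i₀ i₁ i₂ *ℚ ∑ F (λ j₁ → ∑ F (λ j₀ → b i₀ i₁ i₂ j₀ j₁ j₂)) ∎) ⟩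
      ∑ F (λ j₂ → D i₀ i₁ i₂ *ℚ ∑ F (λ j₁ → ∑ F (λ j₀ → b i₀ i₁ i₂ j₀ j₁ j₂)))
        ≡⟨ ∑-* F (D i₀ i₁ i₂) (λ j₂ → ∑ F (λ j₁ → ∑ F (λ j₀ → b i₀ i₁ i₂ j₀ j₁ j₂))) ⟩
      D i₀ i₁ i₂ *ℚ bottoms i₀ i₁ i₂
        ≡⟨ D*bottoms i₀ i₁ i₂ ⟩
      D i₀ i₁ i₂ *ℚ (-ℚ M) ∎
      where
      b : (i₀ i₁ i₂ j₀ j₁ j₂ : Fin n) → ℚ
      b i₀ i₁ i₂ j₀ j₁ j₂ = D j₀ j₁ j₂ *ℚ (u i₀ j₀ *ℚ u i₁ j₁ *ℚ u i₂ j₂)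

-- Gluing the three paths

module _ {m : ℕ} {f : ℕ → ℚ} (B : Balanced (suc m) f) where
  open Tower m using (n; G)
  private
    F = allFin n
    Fs = allFunsOver F n
    last = fromℕ m
    s = sgn m
    u = transfer B

  -- The paths are summed one after another. Each use of `pathSum-full` leaves a factor `s`, the
  -- value of `f` at the weight of the remaining paths, and a function of their end colours (`H₀`,
  -- then `H₁`) that serves as the end weight of the next path.
  ∑-tower : ∑ (allFunsOver F (n + n + n)) (λ κ → ⟦ Properᵇ G κ ⟧ *ℚ f (weight κ)) ≡ s *ℚ s *ℚ s *ℚ nested m *ℚ f 0
  ∑-tower = begin
    ∑ (allFunsOver F (n + n + n)) g
      ≡⟨ ∑-allFunsOver-++ F (n + n) n g g-ext ⟩
    ∑ Fs (λ κ₂ → ∑ (allFunsOver F (n + n)) (λ γ → g (γ ++ᶠ κ₂)))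
      ≡⟨ ∑-cong Fs (λ κ₂ → ∑-allFunsOver-++ F n n (λ γ → g (γ ++ᶠ κ₂)) (λ eq → g-ext (++-cong κ₂ eq))) ⟩
    ∑ Fs (λ κ₂ → ∑ Fs (λ κ₁ → ∑ Fs (λ κ₀ → g ((κ₀ ++ᶠ κ₁) ++ᶠ κ₂))))
      ≡⟨ ∑-cong Fs (λ κ₂ → ∑-cong Fs (λ κ₁ → sum₀ κ₁ κ₂)) ⟩
    ∑ Fs (λ κ₂ → ∑ Fs (λ κ₁ → ⟦ pathᵇ κ₁ ⟧ *ℚ ⟦ pathᵇ κ₂ ⟧ *ℚ (s *ℚ H₀ (κ₁ zero) (κ₂ zero) (κ₁ last) (κ₂ last) *ℚ f (weight κ₁ + weight κ₂))))
      ≡⟨ ∑-cong Fs sum₁ ⟩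
    ∑ Fs (λ κ₂ → ⟦ pathᵇ κ₂ ⟧ *ℚ (s *ℚ s *ℚ H₁ (κ₂ zero) (κ₂ last) *ℚ f (weight κ₂)))
      ≡⟨ sum₂ ⟩
    s *ℚ s *ℚ s *ℚ nested m *ℚ f 0 ∎
    where
    g : (Fin (n + n + n) → Fin n) → ℚ
    g κ = ⟦ Properᵇ G κ ⟧ *ℚ f (weight κ)
    g-ext : Extensional g
    g-ext eq = cong₂ (λ a b → ⟦ a ⟧ *ℚ f b) (Properᵇ-cong G eq) (weight-cong eq)
    H₀ : Fin n → Fin n → Fin n → Fin n → ℚ
    H₀ i₁ i₂ j₁ j₂ = ∑ F (λ i₀ → ∑ F (λ j₀ → D i₀ i₁ i₂ *ℚ D j₀ j₁ j₂ *ℚ u i₀ j₀))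
    H₁ : Fin n → Fin n → ℚ
    H₁ i₂ j₂ = ∑ F (λ i₁ → ∑ F (λ j₁ → H₀ i₁ i₂ j₁ j₂ *ℚ u i₁ j₁))
    indicator-split : ∀ a b c d e → ⟦ a ∧ b ∧ c ∧ d ∧ e ⟧ ≡ ⟦ b ⟧ *ℚ ⟦ c ⟧ *ℚ (⟦ a ⟧ *ℚ (⟦ d ⟧ *ℚ ⟦ e ⟧))
    indicator-split a b c d e = begin
      ⟦ a ∧ b ∧ c ∧ d ∧ e ⟧                        ≡⟨ ⟦⟧-∧ a (b ∧ c ∧ d ∧ e) ⟩
      ⟦ a ⟧ *ℚ ⟦ b ∧ c ∧ d ∧ e ⟧                   ≡⟨ cong (⟦ a ⟧ *ℚ_) (⟦⟧-∧ b (c ∧ d ∧ e)) ⟩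
      ⟦ a ⟧ *ℚ (⟦ b ⟧ *ℚ ⟦ c ∧ d ∧ e ⟧)            ≡⟨ cong (λ x → ⟦ a ⟧ *ℚ (⟦ b ⟧ *ℚ x)) (trans (⟦⟧-∧ c (d ∧ e)) (cong (⟦ c ⟧ *ℚ_) (⟦⟧-∧ d e))) ⟩
      ⟦ a ⟧ *ℚ (⟦ b ⟧ *ℚ (⟦ c ⟧ *ℚ (⟦ d ⟧ *ℚ ⟦ e ⟧))) ≡⟨ shuffle ⟦ a ⟧ ⟦ b ⟧ ⟦ c ⟧ (⟦ d ⟧ *ℚ ⟦ e ⟧) ⟩
      ⟦ b ⟧ *ℚ ⟦ c ⟧ *ℚ (⟦ a ⟧ *ℚ (⟦ d ⟧ *ℚ ⟦ e ⟧)) ∎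
      where
      shuffle : ∀ a b c d → a *ℚ (b *ℚ (c *ℚ d)) ≡ b *ℚ c *ℚ (a *ℚ d)
      shuffle = solve-∀ ℚ-ring
    assoc₄ : ∀ x a d y → x *ℚ (a *ℚ d) *ℚ y ≡ x *ℚ (a *ℚ (d *ℚ y))
    assoc₄ = solve-∀ ℚ-ring
    rotate : ∀ a b c → a + b + c ≡ b + c + a
    rotate = ℕ-solve-∀
    sum₀ : ∀ κ₁ κ₂ → ∑ Fs (λ κ₀ → g ((κ₀ ++ᶠ κ₁) ++ᶠ κ₂)) ≡
      ⟦ pathᵇ κ₁ ⟧ *ℚ ⟦ pathᵇ κ₂ ⟧ *ℚ (s *ℚ H₀ (κ₁ zero) (κ₂ zero) (κ₁ last) (κ₂ last) *ℚ f (weight κ₁ + weight κ₂))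
    sum₀ κ₁ κ₂ = begin
      ∑ Fs (λ κ₀ → g ((κ₀ ++ᶠ κ₁) ++ᶠ κ₂))
        ≡⟨ ∑-cong Fs (λ κ₀ → trans (cong₂ _*ℚ_
             (trans (cong ⟦_⟧ (Properᵇ-tower m κ₀ κ₁ κ₂)) (indicator-split (pathᵇ κ₀) (pathᵇ κ₁) (pathᵇ κ₂) (distinctᵇ (κ₀ zero) (κ₁ zero) (κ₂ zero)) (distinctᵇ (κ₀ last) (κ₁ last) (κ₂ last))))
             (cong f (trans (weight-++ (κ₀ ++ᶠ κ₁) κ₂) (trans (cong (_+ weight κ₂) (weight-++ κ₀ κ₁)) (rotate (weight κ₀) (weight κ₁) (weight κ₂))))))
             (assoc₄ (⟦ pathᵇ κ₁ ⟧ *ℚ ⟦ pathᵇ κ₂ ⟧) ⟦ pathᵇ κ₀ ⟧ (K (κ₀ zero) (κ₀ last)) (f (weight κ₁ + weight κ₂ + weight κ₀)))) ⟩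
      ∑ Fs (λ κ₀ → ⟦ pathᵇ κ₁ ⟧ *ℚ ⟦ pathᵇ κ₂ ⟧ *ℚ (⟦ pathᵇ κ₀ ⟧ *ℚ (K (κ₀ zero) (κ₀ last) *ℚ f (weight κ₁ + weight κ₂ + weight κ₀))))
        ≡⟨ ∑-* Fs (⟦ pathᵇ κ₁ ⟧ *ℚ ⟦ pathᵇ κ₂ ⟧) (λ κ₀ → ⟦ pathᵇ κ₀ ⟧ *ℚ (K (κ₀ zero) (κ₀ last) *ℚ f (weight κ₁ + weight κ₂ + weight κ₀))) ⟩
      ⟦ pathᵇ κ₁ ⟧ *ℚ ⟦ pathᵇ κ₂ ⟧ *ℚ pathSum B m K (weight κ₁ + weight κ₂)
        ≡⟨ cong (⟦ pathᵇ κ₁ ⟧ *ℚ ⟦ pathᵇ κ₂ ⟧ *ℚ_) (pathSum-full B K (weight κ₁ + weight κ₂)) ⟩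
      ⟦ pathᵇ κ₁ ⟧ *ℚ ⟦ pathᵇ κ₂ ⟧ *ℚ (s *ℚ H₀ (κ₁ zero) (κ₂ zero) (κ₁ last) (κ₂ last) *ℚ f (weight κ₁ + weight κ₂)) ∎
      where
      K : Fin n → Fin n → ℚ
      K i j = D i (κ₁ zero) (κ₂ zero) *ℚ D j (κ₁ last) (κ₂ last)
    regroup₁ : ∀ a b s h y → a *ℚ b *ℚ (s *ℚ h *ℚ y) ≡ b *ℚ s *ℚ (a *ℚ (h *ℚ y))
    regroup₁ = solve-∀ ℚ-ring
    collect₁ : ∀ b s h y → b *ℚ s *ℚ (s *ℚ h *ℚ y) ≡ b *ℚ (s *ℚ s *ℚ h *ℚ y)
    collect₁ = solve-∀ ℚ-ring
    sum₁ : ∀ κ₂ → ∑ Fs (λ κ₁ → ⟦ pathᵇ κ₁ ⟧ *ℚ ⟦ pathᵇ κ₂ ⟧ *ℚ (s *ℚ H₀ (κ₁ zero) (κ₂ zero) (κ₁ last) (κ₂ last) *ℚ f (weight κ₁ + weight κ₂)))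
      ≡ ⟦ pathᵇ κ₂ ⟧ *ℚ (s *ℚ s *ℚ H₁ (κ₂ zero) (κ₂ last) *ℚ f (weight κ₂))
    sum₁ κ₂ = begin
      ∑ Fs (λ κ₁ → ⟦ pathᵇ κ₁ ⟧ *ℚ ⟦ pathᵇ κ₂ ⟧ *ℚ (s *ℚ H₀ (κ₁ zero) (κ₂ zero) (κ₁ last) (κ₂ last) *ℚ f (weight κ₁ + weight κ₂)))
        ≡⟨ ∑-cong Fs (λ κ₁ → trans (regroup₁ ⟦ pathᵇ κ₁ ⟧ ⟦ pathᵇ κ₂ ⟧ s (K (κ₁ zero) (κ₁ last)) (f (weight κ₁ + weight κ₂)))
             (cong (λ x → ⟦ pathᵇ κ₂ ⟧ *ℚ s *ℚ (⟦ pathᵇ κ₁ ⟧ *ℚ (K (κ₁ zero) (κ₁ last) *ℚ f x))) (ℕ.+-comm (weight κ₁) (weight κ₂)))) ⟩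
      ∑ Fs (λ κ₁ → ⟦ pathᵇ κ₂ ⟧ *ℚ s *ℚ (⟦ pathᵇ κ₁ ⟧ *ℚ (K (κ₁ zero) (κ₁ last) *ℚ f (weight κ₂ + weight κ₁))))
        ≡⟨ ∑-* Fs (⟦ pathᵇ κ₂ ⟧ *ℚ s) (λ κ₁ → ⟦ pathᵇ κ₁ ⟧ *ℚ (K (κ₁ zero) (κ₁ last) *ℚ f (weight κ₂ + weight κ₁))) ⟩
      ⟦ pathᵇ κ₂ ⟧ *ℚ s *ℚ pathSum B m K (weight κ₂)
        ≡⟨ cong (⟦ pathᵇ κ₂ ⟧ *ℚ s *ℚ_) (pathSum-full B K (weight κ₂)) ⟩
      ⟦ pathᵇ κ₂ ⟧ *ℚ s *ℚ (s *ℚ H₁ (κ₂ zero) (κ₂ last) *ℚ f (weight κ₂))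
        ≡⟨ collect₁ ⟦ pathᵇ κ₂ ⟧ s (H₁ (κ₂ zero) (κ₂ last)) (f (weight κ₂)) ⟩
      ⟦ pathᵇ κ₂ ⟧ *ℚ (s *ℚ s *ℚ H₁ (κ₂ zero) (κ₂ last) *ℚ f (weight κ₂)) ∎
      where
      K : Fin n → Fin n → ℚ
      K i j = H₀ i (κ₂ zero) j (κ₂ last)
    regroup₂ : ∀ b s h y → b *ℚ (s *ℚ s *ℚ h *ℚ y) ≡ s *ℚ s *ℚ (b *ℚ (h *ℚ y))
    regroup₂ = solve-∀ ℚ-ring
    collect₂ : ∀ s h y → s *ℚ s *ℚ (s *ℚ h *ℚ y) ≡ s *ℚ s *ℚ s *ℚ h *ℚ y
    collect₂ = solve-∀ ℚ-ring
    sum₂ : ∑ Fs (λ κ₂ → ⟦ pathᵇ κ₂ ⟧ *ℚ (s *ℚ s *ℚ H₁ (κ₂ zero) (κ₂ last) *ℚ f (weight κ₂))) ≡ s *ℚ s *ℚ s *ℚ nested m *ℚ f 0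
    sum₂ = begin
      ∑ Fs (λ κ₂ → ⟦ pathᵇ κ₂ ⟧ *ℚ (s *ℚ s *ℚ H₁ (κ₂ zero) (κ₂ last) *ℚ f (weight κ₂)))
        ≡⟨ ∑-cong Fs (λ κ₂ → regroup₂ ⟦ pathᵇ κ₂ ⟧ s (H₁ (κ₂ zero) (κ₂ last)) (f (weight κ₂))) ⟩
      ∑ Fs (λ κ₂ → s *ℚ s *ℚ (⟦ pathᵇ κ₂ ⟧ *ℚ (H₁ (κ₂ zero) (κ₂ last) *ℚ f (weight κ₂))))
        ≡⟨ ∑-* Fs (s *ℚ s) (λ κ₂ → ⟦ pathᵇ κ₂ ⟧ *ℚ (H₁ (κ₂ zero) (κ₂ last) *ℚ f (weight κ₂))) ⟩
      s *ℚ s *ℚ pathSum B m H₁ 0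
        ≡⟨ cong (s *ℚ s *ℚ_) (pathSum-full B H₁ 0) ⟩
      s *ℚ s *ℚ (s *ℚ nested m *ℚ f 0)
        ≡⟨ collect₂ s (nested m) (f 0) ⟩
      s *ℚ s *ℚ s *ℚ nested m *ℚ f 0 ∎

-- Comparison of signs

power : ℚ → ℕ → ℚ
power x zero    = 1ℚ
power x (suc k) = x *ℚ power x k

module _ {m : ℕ} {f : ℕ → ℚ} (B : Balanced (suc m) f) (f0≡1 : f 0 ≡ 1ℚ) where
  private
    n = suc m
    N = n + n + n
    s = sgn m
  open Evaluation f N n

  -- A part b contributes 1 if b = 0, `s` if b = n, and 0 otherwise, so a nonzero product has `l`
  -- parts equal to n and total size l n.
  coefficients-cases : ∀ λs → coefficients B N λs ≡ 0ℚ ⊎ ∃[ l ] sum λs ≡ l * n × coefficients B N λs ≡ power s l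
  coefficients-cases [] = inj₂ (0 , refl , refl)
  coefficients-cases (b ∷ λs) with proj₂ (proj₂ (e-eval B b)) | coefficients-cases λs
  ... | inj₁ c≡0 | _ = inj₁ (trans (cong (_*ℚ coefficients B N λs) c≡0) (ℚ.*-zeroˡ (coefficients B N λs)))
  ... | inj₂ _ | inj₁ C≡0 = inj₁ (trans (cong (coefficient B N b *ℚ_) C≡0) (ℚ.*-zeroʳ (coefficient B N b)))
  ... | inj₂ (inj₁ (refl , c≡1)) | inj₂ (l , Σ≡ , C≡) = inj₂ (l , Σ≡ , trans (cong₂ _*ℚ_ c≡1 C≡) (ℚ.*-identityˡ (power s l)))
  ... | inj₂ (inj₂ (refl , c≡s)) | inj₂ (l , Σ≡ , C≡) = inj₂ (suc l , cong (n +_) Σ≡ , cong₂ _*ℚ_ c≡s C≡)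

  -- A surviving e_λ of degree 3n has exactly three parts n, hence the value s³, and s³ s³ = 1.
  -- Multiplying by s³ thus removes the dependence of the sign on the parity of n.
  eval-eBasis-sign : ∀ λs → 0ℚ ≤ℚ s *ℚ s *ℚ s *ℚ eval (eBasis λs)
  eval-eBasis-sign λs = subst (λ x → 0ℚ ≤ℚ s *ℚ s *ℚ s *ℚ x) (sym (eval-eBasis B N λs)) sign
    where
    tidy₀ : ∀ x a y → x *ℚ (a *ℚ (0ℚ *ℚ y)) ≡ 0ℚ
    tidy₀ = solve-∀ ℚ-ring
    tidy₁ : ∀ x y → x *ℚ (0ℚ *ℚ y) ≡ 0ℚ
    tidy₁ = solve-∀ ℚ-ring
    tidy₂ : ∀ s → s *ℚ s *ℚ s *ℚ (1ℚ *ℚ (s *ℚ (s *ℚ (s *ℚ 1ℚ)) *ℚ 1ℚ)) ≡ s *ℚ s *ℚ (s *ℚ s) *ℚ (s *ℚ s)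
    tidy₂ = solve-∀ ℚ-ring
    three-n : ∀ n → n + n + n ≡ 3 * n
    three-n = ℕ-solve-∀
    sign : 0ℚ ≤ℚ s *ℚ s *ℚ s *ℚ (⟦ sum λs ≡ᵇ N ⟧ *ℚ (coefficients B N λs *ℚ f 0))
    sign with coefficients-cases λs
    ... | inj₁ C≡0 = ℚ.≤-reflexive (sym (trans (cong (λ x → s *ℚ s *ℚ s *ℚ (⟦ sum λs ≡ᵇ N ⟧ *ℚ (x *ℚ f 0))) C≡0) (tidy₀ (s *ℚ s *ℚ s) ⟦ sum λs ≡ᵇ N ⟧ (f 0))))
    ... | inj₂ (l , Σ≡ , C≡) with sum λs ≡ᵇ N in eq
    ...   | false = ℚ.≤-reflexive (sym (tidy₁ (s *ℚ s *ℚ s) (coefficients B N λs *ℚ f 0)))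
    ...   | true with ℕ.*-cancelʳ-≡ l 3 n (trans (sym Σ≡) (trans (ℕ.≡ᵇ⇒≡ (sum λs) N (subst T (sym eq) _)) (three-n n)))
    ...     | refl = subst (0ℚ ≤ℚ_) (sym (begin
      s *ℚ s *ℚ s *ℚ (1ℚ *ℚ (coefficients B N λs *ℚ f 0))   ≡⟨ cong₂ (λ x y → s *ℚ s *ℚ s *ℚ (1ℚ *ℚ (x *ℚ y))) C≡ f0≡1 ⟩
      s *ℚ s *ℚ s *ℚ (1ℚ *ℚ (power s 3 *ℚ 1ℚ))              ≡⟨ tidy₂ s ⟩
      s *ℚ s *ℚ (s *ℚ s) *ℚ (s *ℚ s)                        ≡⟨ cong (λ x → x *ℚ x *ℚ x) (sgn² m) ⟩
      1ℚ *ℚ 1ℚ *ℚ 1ℚ                                        ∎)) (ℚ.nonNegative⁻¹ 1ℚ)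

  eval-linComb-sign : ∀ ts → All (λ t → (0ℚ ≤ℚ proj₁ t) × IsPartition (proj₂ t)) ts → 0ℚ ≤ℚ s *ℚ s *ℚ s *ℚ eval (linComb ts)
  eval-linComb-sign [] [] = ℚ.≤-reflexive (sym (trans (cong (s *ℚ s *ℚ s *ℚ_) (∑-zero αs (λ α → ℚ.*-zeroˡ (evalMonomial α)))) (ℚ.*-zeroʳ (s *ℚ s *ℚ s))))
    where αs = allFunsOver (upTo (suc N)) n
  eval-linComb-sign ((c , λs) ∷ ts) ((0≤c , _) ∷ ps) = subst (0ℚ ≤ℚ_) (sym linear)
    (ℚ.+-mono-≤ {0ℚ} {c *ℚ (s *ℚ s *ℚ s *ℚ eval (eBasis λs))} {0ℚ}
      (subst (_≤ℚ c *ℚ (s *ℚ s *ℚ s *ℚ eval (eBasis λs))) (ℚ.*-zeroʳ c) (ℚ.*-monoˡ-≤-nonNeg c {{nonNegative 0≤c}} (eval-eBasis-sign λs)))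
      (eval-linComb-sign ts ps))
    where
    αs = allFunsOver (upTo (suc N)) n
    expand : ∀ c e l w → (c *ℚ e +ℚ l) *ℚ w ≡ c *ℚ (e *ℚ w) +ℚ l *ℚ w
    expand = solve-∀ ℚ-ring
    regroup : ∀ x c e l → x *ℚ (c *ℚ e +ℚ l) ≡ c *ℚ (x *ℚ e) +ℚ x *ℚ l
    regroup = solve-∀ ℚ-ring
    linear : s *ℚ s *ℚ s *ℚ eval (linComb ((c , λs) ∷ ts)) ≡ c *ℚ (s *ℚ s *ℚ s *ℚ eval (eBasis λs)) +ℚ s *ℚ s *ℚ s *ℚ eval (linComb ts)
    linear = trans (cong (s *ℚ s *ℚ s *ℚ_) (begin
      eval (linComb ((c , λs) ∷ ts))
        ≡⟨ ∑-cong αs (λ α → expand c (eBasis λs n α) (linComb ts n α) (evalMonomial α)) ⟩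
      ∑ αs (λ α → c *ℚ (eBasis λs n α *ℚ evalMonomial α) +ℚ linComb ts n α *ℚ evalMonomial α)
        ≡⟨ ∑-+ αs (λ α → c *ℚ (eBasis λs n α *ℚ evalMonomial α)) (λ α → linComb ts n α *ℚ evalMonomial α) ⟩
      ∑ αs (λ α → c *ℚ (eBasis λs n α *ℚ evalMonomial α)) +ℚ eval (linComb ts)
        ≡⟨ cong (_+ℚ eval (linComb ts)) (∑-* αs c (λ α → eBasis λs n α *ℚ evalMonomial α)) ⟩
      c *ℚ eval (eBasis λs) +ℚ eval (linComb ts) ∎)) (regroup (s *ℚ s *ℚ s) c (eval (eBasis λs)) (eval (linComb ts)))

  eval-tower : s *ℚ s *ℚ s *ℚ eval (chromatic (TT n n n)) ≡ nested m
  eval-tower = begin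
    s *ℚ s *ℚ s *ℚ eval (chromatic (TT n n n))
      ≡⟨ cong (s *ℚ s *ℚ s *ℚ_) (trans (eval-chromatic f (TT n n n) n) (∑-tower B)) ⟩
    s *ℚ s *ℚ s *ℚ (s *ℚ s *ℚ s *ℚ nested m *ℚ f 0)
      ≡⟨ regroup s (nested m) (f 0) ⟩
    s *ℚ s *ℚ (s *ℚ s) *ℚ (s *ℚ s) *ℚ (nested m *ℚ f 0)
      ≡⟨ cong₂ (λ x y → x *ℚ x *ℚ x *ℚ (nested m *ℚ y)) (sgn² m) f0≡1 ⟩
    1ℚ *ℚ 1ℚ *ℚ 1ℚ *ℚ (nested m *ℚ 1ℚ)
      ≡⟨ tidy (nested m) ⟩
    nested m ∎
    where
    regroup : ∀ s a b → s *ℚ s *ℚ s *ℚ (s *ℚ s *ℚ s *ℚ a *ℚ b) ≡ s *ℚ s *ℚ (s *ℚ s) *ℚ (s *ℚ s) *ℚ (a *ℚ b)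
    regroup = solve-∀ ℚ-ring
    tidy : ∀ a → 1ℚ *ℚ 1ℚ *ℚ 1ℚ *ℚ (a *ℚ 1ℚ) ≡ a
    tidy = solve-∀ ℚ-ring

-- With n = k + 3 the numbers `a`, `b`, `c` are n-2, n-1 and n, all positive, and the value is the
-- negative of n (n-1)² (n-2).
nested-negative : ∀ k → nested (suc (suc k)) <ℚ 0ℚ
nested-negative k = subst (_<ℚ 0ℚ) (sym eq) (ℚ.neg-antimono-< 0<P)
  where
  a = fromℕℚ (suc k)
  b = fromℕℚ (suc (suc k))
  c = fromℕℚ (suc (suc (suc k)))
  instance
    a>0 = positive (0<fromℕℚ-suc k)
    b>0 = positive (0<fromℕℚ-suc (suc k))
    c>0 = positive (0<fromℕℚ-suc (suc (suc k)))
    cb>0 = ℚ.pos*pos⇒pos c b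
    cba>0 = ℚ.pos*pos⇒pos (c *ℚ b) a
    cbab>0 = ℚ.pos*pos⇒pos (c *ℚ b *ℚ a) b
  0<P : 0ℚ <ℚ c *ℚ b *ℚ a *ℚ b
  0<P = ℚ.positive⁻¹ (c *ℚ b *ℚ a *ℚ b)
  cancel : ∀ x → 1ℚ +ℚ x -ℚ 1ℚ ≡ x
  cancel = solve-∀ ℚ-ring
  pull : ∀ x y → x *ℚ (-ℚ y) ≡ -ℚ (x *ℚ y)
  pull = solve-∀ ℚ-ring
  eq : nested (suc (suc k)) ≡ -ℚ (c *ℚ b *ℚ a *ℚ b)
  eq = trans (nested-eval (suc (suc k))) (trans
    (cong₂ (λ x y → x *ℚ b *ℚ y *ℚ (-ℚ b)) (sym (fromℕℚ-suc (suc (suc k)))) (trans (cong (_-ℚ 1ℚ) (fromℕℚ-suc (suc k))) (cancel a)))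
    (pull (c *ℚ b *ℚ a) b))

not-e-positive : ∀ m → nested m <ℚ 0ℚ → let n = suc m in ¬ EPositive (chromatic (TT n n n))
not-e-positive m negative (ts , positive-ts , X≡) = contradictory (balanced-exists n)
  where
  n = suc m
  contradictory : ¬ (∃[ f ] Balanced n f × f 0 ≡ 1ℚ)
  contradictory (f , B , f0≡1) =
    ℚ.<-irrefl refl (ℚ.≤-<-trans (subst (0ℚ ≤ℚ_) eq (eval-linComb-sign B f0≡1 ts positive-ts)) negative)
    where
    open Evaluation f (n + n + n) n
    s = sgn m
    eq : s *ℚ s *ℚ s *ℚ eval (linComb ts) ≡ nested m
    eq = trans (cong (s *ℚ s *ℚ s *ℚ_) (eval-cong {linComb ts} {chromatic (TT n n n)} (λ α → sym (X≡ n α)))) (eval-tower B f0≡1)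

theorem4p5 : (n : ℕ) → 3 ≤ n →
    ClawContractibleFree (TT n n n) × ClawFree (TT n n n) × ¬ EPositive (chromatic (TT n n n))
theorem4p5 (suc m@(suc (suc k))) (s≤s (s≤s (s≤s z≤n))) =
  Tower.claw-contractible-free m , Tower.claw-free m , not-e-positive m (nested-negative k)
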